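{- Let $C$ be a cycle on $n\ge 3$ vertices and let $h:V(C)\to\mathbb{N}$ be a hatness function with $h(v)\geq 2$ for every vertex $v$ of $C$. Then the hat guessing game $\langle C,h\rangle$ is winning if and only if at least one of the following conditions holds: 1. The length $n$ is either equal to $4$ or divisible by $3$, and moreover $h(v)\leq 3$ for all $v\in V(C)$. 2. $n=3$ and $\sum_{v\in V(C)}\frac{1}{h(v)}\geq 1$. 3. The game $\langle C,h\rangle$ contains a winning proper subgame. 4. Both of the following hold: (a) there exist three consecutive vertices of $C$ (read along the cycle in one of its two directions) whose hatnesses are, in this order, $(2,3,3)$ or $(3,2,3)$; and (b) $h(v)\leq 4$ for all $v\in V(C)$.
   Context: All graphs are finite, simple and undirected. Given a graph $G$ and a function $h:V(G)\to\mathbb{N}$ to the positive integers (the hatness function; $h(v)$ is the hatness of $v$), the hat guessing game $\langle G,h\rangle$ is as follows. A coloring assigns to each vertex $v$ a color from $[h(v)]=\{1,\dots,h(v)\}$. A strategy assigns to each vertex $v$ a deterministic guessing function $f_v$ whose input is the tuple of colors of the neighbors of $v$ in $G$ and whose output is a guess in $[h(v)]$. The players win on a coloring if at least one vertex $v$ has its guess equal to its own assigned color. The game $\langle G,h\rangle$ is winning if there is a strategy for which the players win on every coloring, and losing otherwise. A subgame of $\langle G,h\rangle$ is a game $\langle G',h'\rangle$ with $G'\subseteq G$ a subgraph and $h'=h|_{V(G')}$; it is proper if $G'$ is a proper subgraph of $G$. -}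

module Defs where

open import Data.Bool.Properties using (T-≡)
open import Data.Fin.Base using (Fin; toℕ)
open import Data.Fin.Properties using (_≟_; toℕ<n; toℕ-fromℕ<)
open import Data.Fin.Subset using (Subset; _∈_; _∉_; _⊆_; ⊤)
open import Data.Fin.Subset.Properties using (∈⊤)
open import Data.Integer.Base using (+_)
open import Data.Nat.Base using (ℕ; suc; _≤_; s≤s; NonZero)
open import Data.Nat.DivMod using (_%_; _mod_; m%n<n; m<n⇒m%n≡m; n%n≡0)
open import Data.Nat.Properties using (<⇒≤; m≤n⇒m<n∨m≡n; 1+n≢n; <⇒≢; suc-injective)
open import Data.Product.Base using (Σ-syntax; ∃-syntax; _×_; _,_)
open import Data.Rational.Base using (ℚ; _/_)
open import Data.Rational.Properties using (+-0-commutativeMonoid)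
open import Data.Sum.Base using (_⊎_; inj₁; inj₂; swap)
open import Data.Vec.Base using (tabulate)
open import Data.Vec.Properties using (lookup∘tabulate; []=⇒lookup; lookup⇒[]=)
open import Function.Bundles using (Equivalence)
open import Relation.Binary.PropositionalEquality using (_≡_; _≢_; refl; sym; trans; cong)
open import Relation.Nullary using (¬_; Dec; does)
open import Relation.Nullary.Decidable using (_⊎-dec_; toWitness; dec-true; isYes≗does)

import Algebra.Properties.CommutativeMonoid.Sum as Sum

-- A finite simple undirected graph whose vertices are drawn from the ambient
-- set Fin n.  The vertex set need not be all of Fin n, so that the subgraphs
-- of a graph are again graphs over the same ambient set.
record Graph (n : ℕ) : Set where
  field
    vertices   : Subset n
    neighbours : Fin n → Subset n
    neighbours⊆vertices : ∀ v → neighbours v ⊆ vertices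
    symmetric           : ∀ {u v} → u ∈ neighbours v → v ∈ neighbours u
    irreflexive         : ∀ v → v ∉ neighbours v

open Graph public

infix 4 _⊆ᴳ_ _⊂ᴳ_

_⊆ᴳ_ : ∀ {n} → Graph n → Graph n → Set
H ⊆ᴳ G = vertices H ⊆ vertices G × (∀ v → neighbours H v ⊆ neighbours G v)

_⊂ᴳ_ : ∀ {n} → Graph n → Graph n → Set
H ⊂ᴳ G = H ⊆ᴳ G × ¬ (G ⊆ᴳ H)

-- Tuples of colors indexed by the vertices in S; Fin (h v) plays the role of
-- the color set [h(v)].  Membership is irrelevant so that a color depends on
-- the vertex only.
Colors : ∀ {n} → (Fin n → ℕ) → Subset n → Set
Colors h S = ∀ v → .(v ∈ S) → Fin (h v)

Coloring : ∀ {n} → Graph n → (Fin n → ℕ) → Set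
Coloring G h = Colors h (vertices G)

-- Tuples are encoded as functions, and function extensionality is not
-- available; guess-cong says that a guess depends only on the entries of the
-- tuple.
record Strategy {n} (G : Graph n) (h : Fin n → ℕ) : Set where
  field
    guess : ∀ v → .(v ∈ vertices G) → Colors h (neighbours G v) → Fin (h v)
    guess-cong : ∀ v .(v∈G : v ∈ vertices G) {c d : Colors h (neighbours G v)} →
                 (∀ u .(u∈N : u ∈ neighbours G v) → c u u∈N ≡ d u u∈N) →
                 guess v v∈G c ≡ guess v v∈G d

open Strategy public

visible : ∀ {n} (G : Graph n) {h : Fin n → ℕ} →
          Coloring G h → ∀ v → Colors h (neighbours G v)
visible G c v u u∈N = c u (neighbours⊆vertices G v u∈N)

-- Only the values of h on the vertices of G matter, so Winning H h, for a
-- subgraph H of G, is the statement that the subgame on H with the restricted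
-- hatness function is winning.
Winning : ∀ {n} → Graph n → (Fin n → ℕ) → Set
Winning G h =
  Σ[ s ∈ Strategy G h ] ∀ (c : Coloring G h) →
    ∃[ v ] Σ[ v∈G ∈ v ∈ vertices G ] guess s v v∈G (visible G c v) ≡ c v v∈G

HasWinningProperSubgame : ∀ {n} → Graph n → (Fin n → ℕ) → Set
HasWinningProperSubgame G h = ∃[ H ] H ⊂ᴳ G × Winning H h

next : ∀ {n} → Fin n → Fin n
next {suc m} v = suc (toℕ v) mod suc m

next≢ : ∀ {n} → 2 ≤ n → (v : Fin n) → v ≢ next v
next≢ {suc m} (s≤s 1≤m) v v≡next with m≤n⇒m<n∨m≡n (toℕ<n v)
... | inj₁ 1+v<n = 1+n≢n (sym (trans (cong toℕ v≡next)
        (trans (toℕ-fromℕ< (m%n<n (suc (toℕ v)) (suc m))) (m<n⇒m%n≡m 1+v<n))))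
... | inj₂ 1+v≡n = <⇒≢ 1≤m (trans (sym v≡0) (suc-injective 1+v≡n))
  where
  v≡0 : toℕ v ≡ 0
  v≡0 = trans (cong toℕ v≡next)
          (trans (toℕ-fromℕ< (m%n<n (suc (toℕ v)) (suc m)))
            (trans (cong (_% suc m) 1+v≡n) (n%n≡0 (suc m))))

CycleAdjacent : ∀ {n} → Fin n → Fin n → Set
CycleAdjacent v u = u ≡ next v ⊎ v ≡ next u

cycleAdjacent? : ∀ {n} (v u : Fin n) → Dec (CycleAdjacent v u)
cycleAdjacent? v u = (u ≟ next v) ⊎-dec (v ≟ next u)

cycleNeighbours : ∀ {n} → Fin n → Subset n
cycleNeighbours v = tabulate (λ u → does (cycleAdjacent? v u))

∈-cycleNeighbours⁻ : ∀ {n} {u v : Fin n} → u ∈ cycleNeighbours v → CycleAdjacent v u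
∈-cycleNeighbours⁻ {u = u} {v} u∈N = toWitness {a? = cycleAdjacent? v u}
  (Equivalence.from T-≡ (trans (isYes≗does (cycleAdjacent? v u))
    (trans (sym (lookup∘tabulate _ u)) ([]=⇒lookup u∈N))))

∈-cycleNeighbours⁺ : ∀ {n} {u v : Fin n} → CycleAdjacent v u → u ∈ cycleNeighbours v
∈-cycleNeighbours⁺ {u = u} {v} adj =
  lookup⇒[]= u _ (trans (lookup∘tabulate _ u) (dec-true (cycleAdjacent? v u) adj))

cycle : (n : ℕ) → 3 ≤ n → Graph n
cycle n 3≤n = record
  { vertices            = ⊤
  ; neighbours          = cycleNeighbours
  ; neighbours⊆vertices = λ _ _ → ∈⊤
  ; symmetric           = λ u∈N → ∈-cycleNeighbours⁺ (swap (∈-cycleNeighbours⁻ u∈N))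
  ; irreflexive         = λ v v∈N → loopless v (∈-cycleNeighbours⁻ v∈N)
  }
  where
  loopless : ∀ v → ¬ CycleAdjacent v v
  loopless v (inj₁ eq) = next≢ (<⇒≤ 3≤n) v eq
  loopless v (inj₂ eq) = next≢ (<⇒≤ 3≤n) v eq

-- a, b, c are consecutive on the cycle, read in one of the two directions.
Consecutive : ∀ {n} → Fin n → Fin n → Fin n → Set
Consecutive a b c = (b ≡ next a × c ≡ next b) ⊎ (b ≡ next c × a ≡ next b)

reciprocalSum : ∀ {n} (h : Fin n → ℕ) → (∀ v → NonZero (h v)) → ℚ
reciprocalSum h h≢0 = sum (λ v → _/_ (+ 1) (h v) {{h≢0 v}})
  where open Sum +-0-commutativeMonoid using (sum)

≥2⇒nonZero : ∀ {k} → 2 ≤ k → NonZero k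
≥2⇒nonZero (s≤s _) = _

{-# OPTIONS --safe #-}

-- Losing games.  Cut the cycle at a vertex, fix its color x and walk around the cycle.  For
-- a color q of the next vertex let N q be the set of colors p of the current vertex such
-- that (p , q) is reached by a coloring on which everybody so far guesses wrong.  The colors
-- that the next vertex loses to its guesses have pairwise disjoint sets N q, so two states
-- propagate: "any two N q meet" (kept by three or more colors, weakened by two colors) and
-- "no three N q are pairwise disjoint" (kept by three or more colors, improved to the first
-- state by five or more).  A winning strategy lets the walks through the different colors x
-- close up only for disjoint sets of colors of the two neighbours of the cut, whereas the
-- states make these sets too large.
--
-- If all vertices have three colors, a count of the guesses on the two sides of an edge is
-- tight.  It makes every edge carry a Latin square ρ such that a vertex guesses right only
-- if ρ increases there.  So a walk along which ρ is constant is nowhere guessed, and such a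
-- walk closes up unless 3 ∣ n; the degenerate case of the count is excluded for n ≥ 5.
--
-- Winning games.  With three colors and 3 ∣ n, each player bets that the difference of
-- successive colors drops at its vertex, after a twist on one edge.  Vertices with four
-- colors, read as pairs of bits, transmit one bit from one end of a path to the other.
module Submission where

open import Defs
open import Data.Bool.Base using (Bool; true; false; not)
import Data.Bool.Properties as Bool
open import Data.Empty using (⊥; ⊥-elim)
open import Data.Fin.Base using (Fin; zero; suc; toℕ; fromℕ<; combine; remQuot; join; splitAt)
import Data.Fin.Properties as Fin
open import Data.Fin.Properties
  using (all?; any?; toℕ<n; toℕ-fromℕ<; toℕ-injective; injective⇒≤; combine-remQuot; combine-injective; splitAt-join)
open import Data.Fin.Subset using (Subset; _∈_; ⊤)
open import Data.Fin.Subset.Properties using (_∈?_; ∈⊤)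
import Data.Integer.Base as ℤ
open import Data.Integer.Base using () renaming (+_ to pos)
import Data.Integer.Properties as ℤ
open import Data.List.Base using (List; []; _∷_; length)
open import Data.Nat.Base
  using (ℕ; zero; suc; _+_; _*_; _∸_; _⊔_; _≤_; _<_; z≤n; s≤s; s≤s⁻¹; NonZero)
open import Data.Nat.Divisibility using (_∣_; _∣?_; _∣0; divides; ∣-refl; ∣m∣n⇒∣m+n)
open import Data.Nat.DivMod
open import Data.Nat.Properties
open import Data.Nat.Solver using (module +-*-Solver)
open import Data.Product.Base using (Σ-syntax; ∃-syntax; _×_; _,_; proj₁; proj₂)
import Data.Rational.Base as ℚ
open import Data.Rational.Base using (ℚ; 0ℚ; 1ℚ; toℚᵘ) renaming (_≤_ to _≤ℚ_)
import Data.Rational.Properties as ℚ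
import Data.Rational.Unnormalised.Base as ℚᵘ
open import Data.Rational.Unnormalised.Base using (ℚᵘ; mkℚᵘ; *≤*)
import Data.Rational.Unnormalised.Properties as ℚᵘ
open import Data.Sum.Base using (_⊎_; inj₁; inj₂; [_,_]′; map₂)
open import Data.Sum.Properties using (inj₁-injective; inj₂-injective)
open import Data.Vec.Base using (tabulate)
open import Data.Vec.Properties using (lookup∘tabulate; []=⇒lookup; lookup⇒[]=)
open import Function.Base using (_∘_; _$_; id; case_of_; it)
open import Function.Bundles using (_⇔_; mk⇔)
open import Relation.Binary.PropositionalEquality
open import Relation.Nullary using (¬_; Dec; yes; no; does; contradiction; ¬¬-excluded-middle)
open import Relation.Nullary.Decidable
  using (from-yes; ¬?; _×-dec_; _⊎-dec_; _→-dec_; decidable-stable; recompute; dec-true)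

-- Strategies with natural numbers as colors

-- The two ends of a walk interact through a restriction of its first color, the label. The cut
-- vertex sees the label ℓ and the color u of its last neighbour. Two such u, each with its own
-- label set, then have disjoint sets of colors one vertex earlier. Each pair (ℓ , u) serves only
-- one x, so some x keeps many labels for many u. The thresholds are pigeonholes: two families that
-- lose one color each still meet at a vertex with three colors, two that lose two each at a vertex
-- with five. A vertex with two colors spoils the strong state, and only five or more colors restore
-- it. Two vertices with two colors already win along a path with at most four colors at each inner
-- vertex; without such a path, any two of them are separated by a vertex that restores the state.
-- Sets of reached colors are bare predicates, so every state is a negation; this is enough because
-- each losing argument ends in a contradiction.

clip : ∀ {k} → Fin k → ℕ → Fin k
clip {k} d x with x <? k
... | yes x<k = fromℕ< x<k
... | no  _   = d

clip-toℕ : ∀ {k} (d i : Fin k) {x} → x ≡ toℕ i → clip d x ≡ i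
clip-toℕ {k} d i {x} eq with x <? k
... | yes x<k = toℕ-injective (trans (toℕ-fromℕ< x<k) eq)
... | no  x≮k = contradiction (subst (_< k) (sym eq) (toℕ<n i)) x≮k

mask : ∀ {n} → Subset n → (Fin n → ℕ) → Fin n → ℕ
mask S C u with u ∈? S
... | yes _ = C u
... | no  _ = 0

mask-∈ : ∀ {n} {S : Subset n} (C : Fin n → ℕ) {u} → u ∈ S → mask S C u ≡ C u
mask-∈ {S = S} C {u} u∈S with u ∈? S
... | yes _   = refl
... | no  u∉S = contradiction u∈S u∉S

extend : ∀ {n} {h : Fin n → ℕ} (S : Subset n) → Colors h S → Fin n → ℕ
extend S c u with u ∈? S
... | yes u∈S = toℕ (c u u∈S)
... | no  _   = 0

extend-∈ : ∀ {n} {h : Fin n → ℕ} {S : Subset n} (c : Colors h S) {u} (u∈S : u ∈ S) →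
           extend S c u ≡ toℕ (c u u∈S)
extend-∈ {S = S} c {u} u∈S with u ∈? S
... | yes _   = refl
... | no  u∉S = contradiction u∈S u∉S

-- `F` may be written as a function of the whole coloring: applying it to the masked coloring makes
-- it a guess from visible colors only, and the congruence hypothesis stands in for extensionality.
winning⁺ : ∀ {n} (G : Graph n) {h : Fin n → ℕ} → (∀ v → 1 ≤ h v) →
  (F : Fin n → (Fin n → ℕ) → ℕ) →
  (∀ v {c d} → (∀ u → c u ≡ d u) → F v c ≡ F v d) →
  (∀ C → (∀ v → C v < h v) → ∃[ v ] v ∈ vertices G × F v (mask (neighbours G v) C) ≡ C v) →
  Winning G h
winning⁺ {n} G {h} 1≤h F F-cong wins = s , won
  where
  default : ∀ v → Fin (h v)
  default v = fromℕ< (1≤h v)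

  extend-cong : ∀ {S : Subset n} {c d : Colors h S} → (∀ u .(u∈S : u ∈ S) → c u u∈S ≡ d u u∈S) →
                ∀ u → extend S c u ≡ extend S d u
  extend-cong {S} eq u with u ∈? S
  ... | yes u∈S = cong toℕ (eq u u∈S)
  ... | no  _   = refl

  s : Strategy G h
  s = record
    { guess      = λ v _ c → clip (default v) (F v (extend (neighbours G v) c))
    ; guess-cong = λ v _ eq → cong (clip (default v)) (F-cong v (extend-cong eq))
    }

  extend<h : ∀ {S : Subset n} (c : Colors h S) u → extend S c u < h u
  extend<h {S} c u with u ∈? S
  ... | yes u∈S = toℕ<n (c u u∈S)
  ... | no  _   = 1≤h u

  seen : ∀ (c : Coloring G h) v u →
         extend (neighbours G v) (visible G c v) u ≡ mask (neighbours G v) (extend (vertices G) c) u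
  seen c v u with u ∈? neighbours G v
  ... | yes u∈N = sym (extend-∈ c (neighbours⊆vertices G v u∈N))
  ... | no  _   = refl

  won : ∀ c → ∃[ v ] Σ[ v∈G ∈ v ∈ vertices G ] guess s v v∈G (visible G c v) ≡ c v v∈G
  won c with wins (extend (vertices G) c) (extend<h c)
  ... | v , v∈G , eq = v , v∈G ,
    clip-toℕ (default v) (c v v∈G) (trans (F-cong v (seen c v)) (trans eq (extend-∈ c v∈G)))

winning-⊆ᴳ : ∀ {n} {H G : Graph n} {h : Fin n → ℕ} → (∀ v → 1 ≤ h v) → H ⊆ᴳ G → Winning H h → Winning G h
winning-⊆ᴳ {n} {H} {G} {h} 1≤h (V⊆ , N⊆) (s , won) = s′ , won′
  where
  guess′ : ∀ v → Dec (v ∈ vertices H) → Colors h (neighbours G v) → Fin (h v)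
  guess′ v (yes v∈H) c = guess s v v∈H (λ u u∈N → c u (N⊆ v u∈N))
  guess′ v (no  _)   c = fromℕ< (1≤h v)

  guess′-cong : ∀ v (v∈H? : Dec (v ∈ vertices H)) {c d : Colors h (neighbours G v)} →
                (∀ u .(u∈N : u ∈ neighbours G v) → c u u∈N ≡ d u u∈N) →
                guess′ v v∈H? c ≡ guess′ v v∈H? d
  guess′-cong v (yes v∈H) eq = guess-cong s v v∈H (λ u u∈N → eq u (N⊆ v u∈N))
  guess′-cong v (no  _)   eq = refl

  guess′-yes : ∀ v (v∈H : v ∈ vertices H) (v∈H? : Dec (v ∈ vertices H)) c →
               guess′ v v∈H? c ≡ guess s v v∈H (λ u u∈N → c u (N⊆ v u∈N))
  guess′-yes v v∈H (yes _)   c = refl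
  guess′-yes v v∈H (no  v∉H) c = contradiction v∈H v∉H

  s′ : Strategy G h
  s′ = record
    { guess      = λ v _ → guess′ v (v ∈? vertices H)
    ; guess-cong = λ v _ → guess′-cong v (v ∈? vertices H)
    }

  won′ : ∀ c → ∃[ v ] Σ[ v∈G ∈ v ∈ vertices G ] guess s′ v v∈G (visible G c v) ≡ c v v∈G
  won′ c with won (λ u u∈H → c u (V⊆ u∈H))
  ... | v , v∈H , eq = v , V⊆ v∈H , trans (guess′-yes v v∈H (v ∈? vertices H) (visible G c v)) eq

-- Walks around the cycle

data Direction : Set where
  forward backward : Direction

module _ {m : ℕ} where

  advance : ℕ → Fin (suc m) → Fin (suc m)
  advance i v = fromℕ< (m%n<n (toℕ v + i) (suc m))

  toℕ-advance : ∀ i v → toℕ (advance i v) ≡ (toℕ v + i) % suc m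
  toℕ-advance i v = toℕ-fromℕ< _

  toℕ-next : ∀ (v : Fin (suc m)) → toℕ (next v) ≡ suc (toℕ v) % suc m
  toℕ-next v = toℕ-fromℕ< _

  [m%n+o]%n : ∀ x y → (x % suc m + y) % suc m ≡ (x + y) % suc m
  [m%n+o]%n x y = begin
    (x % suc m + y) % suc m                   ≡⟨ %-distribˡ-+ (x % suc m) y (suc m) ⟩
    (x % suc m % suc m + y % suc m) % suc m   ≡⟨ cong (λ k → (k + y % suc m) % suc m) (m%n%n≡m%n x (suc m)) ⟩
    (x % suc m + y % suc m) % suc m           ≡⟨ %-distribˡ-+ x y (suc m) ⟨
    (x + y) % suc m                           ∎
    where open ≡-Reasoning

  advance-+ : ∀ i j v → advance i (advance j v) ≡ advance (j + i) v
  advance-+ i j v = toℕ-injective $ begin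
    toℕ (advance i (advance j v))          ≡⟨ toℕ-advance i (advance j v) ⟩
    (toℕ (advance j v) + i) % suc m        ≡⟨ cong (λ k → (k + i) % suc m) (toℕ-advance j v) ⟩
    ((toℕ v + j) % suc m + i) % suc m      ≡⟨ [m%n+o]%n (toℕ v + j) i ⟩
    (toℕ v + j + i) % suc m                ≡⟨ cong (_% suc m) (+-assoc (toℕ v) j i) ⟩
    (toℕ v + (j + i)) % suc m              ≡⟨ toℕ-advance (j + i) v ⟨
    toℕ (advance (j + i) v)                ∎
    where open ≡-Reasoning

  advance-0 : ∀ v → advance 0 v ≡ v
  advance-0 v = toℕ-injective (trans (toℕ-advance 0 v)
    (trans (cong (_% suc m) (+-identityʳ (toℕ v))) (m<n⇒m%n≡m (toℕ<n v))))

  advance-n : ∀ v → advance (suc m) v ≡ v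
  advance-n v = toℕ-injective (trans (toℕ-advance (suc m) v)
    (trans ([m+n]%n≡m%n (toℕ v) (suc m)) (m<n⇒m%n≡m (toℕ<n v))))

  next≡advance : ∀ v → next v ≡ advance 1 v
  next≡advance v = toℕ-injective (trans (toℕ-next v)
    (trans (cong (_% suc m) (+-comm 1 (toℕ v))) (sym (toℕ-advance 1 v))))

  prev : Fin (suc m) → Fin (suc m)
  prev = advance m

  next-prev : ∀ v → next (prev v) ≡ v
  next-prev v = trans (next≡advance (prev v)) (trans (advance-+ 1 m v)
    (trans (cong (λ k → advance k v) (+-comm m 1)) (advance-n v)))

  prev-next : ∀ v → prev (next v) ≡ v
  prev-next v = trans (cong prev (next≡advance v)) (trans (advance-+ m 1 v) (advance-n v))

  distance : Fin (suc m) → Fin (suc m) → ℕ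
  distance a v = (toℕ v + (suc m ∸ toℕ a)) % suc m

  distance<n : ∀ a v → distance a v < suc m
  distance<n a v = m%n<n (toℕ v + (suc m ∸ toℕ a)) (suc m)

  [m+o+[n∸m]] : ∀ (a : Fin (suc m)) x → toℕ a + (x + (suc m ∸ toℕ a)) ≡ x + suc m
  [m+o+[n∸m]] a x = begin
    toℕ a + (x + (suc m ∸ toℕ a))   ≡⟨ +-assoc (toℕ a) x _ ⟨
    toℕ a + x + (suc m ∸ toℕ a)     ≡⟨ cong (_+ (suc m ∸ toℕ a)) (+-comm (toℕ a) x) ⟩
    x + toℕ a + (suc m ∸ toℕ a)     ≡⟨ +-assoc x (toℕ a) _ ⟩
    x + (toℕ a + (suc m ∸ toℕ a))   ≡⟨ cong (x +_) (m+[n∸m]≡n (<⇒≤ (toℕ<n a))) ⟩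
    x + suc m                       ∎
    where open ≡-Reasoning

  advance-distance : ∀ a v → advance (distance a v) a ≡ v
  advance-distance a v = toℕ-injective $ begin
    toℕ (advance (distance a v) a)             ≡⟨ toℕ-advance (distance a v) a ⟩
    (toℕ a + x % suc m) % suc m                ≡⟨ cong (_% suc m) (+-comm (toℕ a) (x % suc m)) ⟩
    (x % suc m + toℕ a) % suc m                ≡⟨ [m%n+o]%n x (toℕ a) ⟩
    (x + toℕ a) % suc m                        ≡⟨ cong (_% suc m) (trans (+-comm x (toℕ a)) ([m+o+[n∸m]] a (toℕ v))) ⟩
    (toℕ v + suc m) % suc m                    ≡⟨ [m+n]%n≡m%n (toℕ v) (suc m) ⟩
    toℕ v % suc m                              ≡⟨ m<n⇒m%n≡m (toℕ<n v) ⟩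
    toℕ v                                      ∎
    where
    open ≡-Reasoning
    x = toℕ v + (suc m ∸ toℕ a)

  distance-advance : ∀ a {i} → i < suc m → distance a (advance i a) ≡ i
  distance-advance a {i} i<n = begin
    (toℕ (advance i a) + (suc m ∸ toℕ a)) % suc m   ≡⟨ cong (λ k → (k + (suc m ∸ toℕ a)) % suc m) (toℕ-advance i a) ⟩
    ((toℕ a + i) % suc m + (suc m ∸ toℕ a)) % suc m ≡⟨ [m%n+o]%n (toℕ a + i) _ ⟩
    (toℕ a + i + (suc m ∸ toℕ a)) % suc m           ≡⟨ cong (_% suc m) (trans (+-assoc (toℕ a) i _) ([m+o+[n∸m]] a i)) ⟩
    (i + suc m) % suc m                             ≡⟨ [m+n]%n≡m%n i (suc m) ⟩
    i % suc m                                       ≡⟨ m<n⇒m%n≡m i<n ⟩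
    i                                               ∎
    where open ≡-Reasoning

  after before : Direction → Fin (suc m) → Fin (suc m)
  after  forward  = next
  after  backward = prev
  before forward  = prev
  before backward = next

  after-before : ∀ d v → after d (before d v) ≡ v
  after-before forward  = next-prev
  after-before backward = prev-next

  before-after : ∀ d v → before d (after d v) ≡ v
  before-after forward  = prev-next
  before-after backward = next-prev

  walk : Direction → Fin (suc m) → ℕ → Fin (suc m)
  walk d a zero    = a
  walk d a (suc i) = after d (walk d a i)

  walk-+ : ∀ d a i j → walk d (walk d a i) j ≡ walk d a (i + j)
  walk-+ d a i zero    = cong (walk d a) (sym (+-identityʳ i))
  walk-+ d a i (suc j) = trans (cong (after d) (walk-+ d a i j)) (cong (walk d a) (sym (+-suc i j)))

  walk-forward : ∀ a i → walk forward a i ≡ advance i a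
  walk-forward a zero    = sym (advance-0 a)
  walk-forward a (suc i) = begin
    next (walk forward a i)   ≡⟨ cong next (walk-forward a i) ⟩
    next (advance i a)        ≡⟨ next≡advance (advance i a) ⟩
    advance 1 (advance i a)   ≡⟨ advance-+ 1 i a ⟩
    advance (i + 1) a         ≡⟨ cong (λ k → advance k a) (+-comm i 1) ⟩
    advance (suc i) a         ∎
    where open ≡-Reasoning

  walk-before : ∀ d a i → walk d (before d a) (suc i) ≡ walk d a i
  walk-before d a zero    = after-before d a
  walk-before d a (suc i) = cong (after d) (walk-before d a i)

  walk-backward : ∀ a i → walk forward (walk backward a i) i ≡ a
  walk-backward a zero    = refl
  walk-backward a (suc i) = trans (walk-before forward (walk backward a i) i) (walk-backward a i)

  position : Direction → Fin (suc m) → Fin (suc m) → ℕ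
  position forward  a v = distance a v
  position backward a v = distance v a

  position<n : ∀ d a v → position d a v < suc m
  position<n forward  a v = distance<n a v
  position<n backward a v = distance<n v a

  position-walk : ∀ d a {i} → i < suc m → position d a (walk d a i) ≡ i
  position-walk forward  a {i} i<n = trans (cong (distance a) (walk-forward a i)) (distance-advance a i<n)
  position-walk backward a {i} i<n = trans
    (cong (distance w) (trans (sym (walk-backward a i)) (walk-forward w i)))
    (distance-advance w i<n)
    where w = walk backward a i

  after-injective : ∀ d {u v} → after d u ≡ after d v → u ≡ v
  after-injective d {u} {v} eq = trans (sym (before-after d u)) (trans (cong (before d) eq) (before-after d v))

  walk-injective : ∀ d i {u v} → walk d u i ≡ walk d v i → u ≡ v
  walk-injective d zero    eq = eq
  walk-injective d (suc i) eq = walk-injective d i (after-injective d eq)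

  walk-position : ∀ d a v → walk d a (position d a v) ≡ v
  walk-position forward  a v = trans (walk-forward a (distance a v)) (advance-distance a v)
  walk-position backward a v = walk-injective forward (distance v a)
    (trans (walk-backward a (distance v a))
      (sym (trans (walk-forward v (distance v a)) (advance-distance v a))))

  walk-n : ∀ d a → walk d a (suc m) ≡ a
  walk-n forward  a = trans (walk-forward a (suc m)) (advance-n a)
  walk-n backward a = walk-injective forward (suc m)
    (trans (walk-backward a (suc m)) (sym (walk-n forward a)))

  after∈N : ∀ d v → after d v ∈ cycleNeighbours v
  after∈N forward  v = ∈-cycleNeighbours⁺ (inj₁ refl)
  after∈N backward v = ∈-cycleNeighbours⁺ (inj₂ (sym (next-prev v)))

  before∈N : ∀ d v → before d v ∈ cycleNeighbours v
  before∈N forward  v = ∈-cycleNeighbours⁺ (inj₂ (sym (next-prev v)))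
  before∈N backward v = ∈-cycleNeighbours⁺ (inj₁ refl)

  neighbour⇒after⊎before : ∀ d {u v} → u ∈ cycleNeighbours v → u ≡ after d v ⊎ u ≡ before d v
  neighbour⇒after⊎before d {u} {v} u∈N with d | ∈-cycleNeighbours⁻ u∈N
  ... | forward  | inj₁ eq = inj₁ eq
  ... | forward  | inj₂ eq = inj₂ (trans (sym (prev-next u)) (cong prev (sym eq)))
  ... | backward | inj₁ eq = inj₂ eq
  ... | backward | inj₂ eq = inj₁ (trans (sym (prev-next u)) (cong prev (sym eq)))

predecessor : ∀ {A : Set} → ℕ → (ℕ → A) → ℕ → A
predecessor m c zero    = c m
predecessor m c (suc i) = c i

-- The game on the cycle read along a walk: c lists the colors of the suc m vertices
-- met by the walk, and returns to the starting vertex at index suc m.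
Unbeaten : ℕ → (ℕ → ℕ) → (ℕ → ℕ → ℕ → ℕ) → Set
Unbeaten m H G = ∀ c → (∀ i → i < suc m → c i < H i) → c (suc m) ≡ c 0 →
  ∃[ i ] i < suc m × G i (predecessor m c i) (c (suc i)) ≡ c i

SequenceWin : ℕ → (ℕ → ℕ) → Set
SequenceWin m H = ∃[ G ] Unbeaten m H G

sequenceWin-≤ : ∀ {m H H′} → (∀ i → i < suc m → H′ i ≤ H i) → SequenceWin m H → SequenceWin m H′
sequenceWin-≤ H′≤H (G , wins) = G , λ c c<H′ → wins c (λ i i<n → <-≤-trans (c<H′ i i<n) (H′≤H i i<n))

module _ {m : ℕ} (3≤n : 3 ≤ suc m) {h : Fin (suc m) → ℕ} (1≤h : ∀ v → 1 ≤ h v) (d : Direction) where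

  private
    n = suc m

  walk-predecessor : ∀ a i → predecessor m (walk d a) i ≡ before d (walk d a i)
  walk-predecessor a zero    = after-injective d (trans (walk-n {m} d a) (sym (after-before d a)))
  walk-predecessor a (suc i) = sym (before-after d (walk d a i))

  predecessor-∘ : ∀ (C : Fin n → ℕ) e i → predecessor m (C ∘ e) i ≡ C (predecessor m e i)
  predecessor-∘ C e zero    = refl
  predecessor-∘ C e (suc i) = refl

  cycle-winning⁺ : ∀ a → SequenceWin m (h ∘ walk d a) → Winning (cycle n 3≤n) h
  cycle-winning⁺ a (G , wins) = winning⁺ (cycle n 3≤n) 1≤h F
    (λ v eq → cong₂ (G (position d a v)) (eq (before d v)) (eq (after d v))) won
    where
    e = walk d a

    F : Fin n → (Fin n → ℕ) → ℕ
    F v C = G (position d a v) (C (before d v)) (C (after d v))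

    won : ∀ C → (∀ v → C v < h v) → ∃[ v ] v ∈ _ × F v (mask (cycleNeighbours v) C) ≡ C v
    won C C<h with wins (C ∘ e) (λ i _ → C<h (e i)) (cong C (walk-n d a))
    ... | i , i<n , eq = e i , ∈⊤ , (begin
      F (e i) (mask (cycleNeighbours (e i)) C)
        ≡⟨ cong₂ (G _) (mask-∈ C (before∈N d (e i))) (mask-∈ C (after∈N d (e i))) ⟩
      G (position d a (e i)) (C (before d (e i))) (C (e (suc i)))
        ≡⟨ cong₂ (λ j y → G j y (C (e (suc i)))) (position-walk d a i<n)
             (trans (cong C (sym (walk-predecessor a i))) (sym (predecessor-∘ C e i))) ⟩
      G i (predecessor m (C ∘ e) i) (C (e (suc i))) ≡⟨ eq ⟩
      C (e i)                                       ∎)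
      where open ≡-Reasoning

  -- The same guesses `g` serve the walks from every start. The case of three colors everywhere
  -- compares the edges all around the cycle under one strategy, which separate instances of
  -- `SequenceWin` would not provide.
  cycle-guesses : Winning (cycle n 3≤n) h →
                  Σ[ g ∈ (Fin n → ℕ → ℕ → ℕ) ] (∀ a → Unbeaten m (h ∘ walk d a) (g ∘ walk d a))
  cycle-guesses (s , won) = g , wins
    where
    shown : ∀ v → ℕ → ℕ → Colors h (cycleNeighbours v)
    shown v y z u _ with u Fin.≟ after d v
    ... | yes _ = clip (fromℕ< (1≤h u)) z
    ... | no  _ = clip (fromℕ< (1≤h u)) y

    g : Fin n → ℕ → ℕ → ℕ
    g v y z = toℕ (guess s v ∈⊤ (shown v y z))

    shown-correct : ∀ (c : Coloring (cycle n 3≤n) h) v {y z} →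
      y ≡ toℕ (c (before d v) ∈⊤) → z ≡ toℕ (c (after d v) ∈⊤) →
      ∀ u .(u∈N : u ∈ cycleNeighbours v) → shown v y z u u∈N ≡ c u ∈⊤
    shown-correct c v y≡ z≡ u u∈N with u Fin.≟ after d v
    ... | yes refl = clip-toℕ (fromℕ< (1≤h u)) (c u ∈⊤) z≡
    ... | no  u≢ with neighbour⇒after⊎before d (recompute (u ∈? cycleNeighbours v) u∈N)
    ...   | inj₁ u≡   = contradiction u≡ u≢
    ...   | inj₂ refl = clip-toℕ (fromℕ< (1≤h u)) (c u ∈⊤) y≡

    module _ (a : Fin n) (c : ℕ → ℕ) (c<h : ∀ i → i < n → c i < h (walk d a i)) (closed : c n ≡ c 0) where

      e = walk d a

      C<h : ∀ v → c (position d a v) < h v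
      C<h v = subst (λ u → c (position d a v) < h u) (walk-position d a v)
                    (c<h (position d a v) (position<n d a v))

      coloring : Coloring (cycle n 3≤n) h
      coloring v _ = fromℕ< (C<h v)

      position-e : ∀ {j u} → j < n → e j ≡ u → c j ≡ c (position d a u)
      position-e {j} j<n eq = cong c (trans (sym (position-walk d a j<n)) (cong (position d a) eq))

      after-color : ∀ {v i} → i < n → e i ≡ v → c (suc i) ≡ c (position d a (after d v))
      after-color {v} {i} i<n ei≡v with m≤n⇒m<n∨m≡n i<n
      ... | inj₁ 1+i<n = position-e 1+i<n (cong (after d) ei≡v)
      ... | inj₂ 1+i≡n = trans (cong c 1+i≡n) (trans closed
        (position-e (s≤s z≤n) (trans (sym (walk-n d a)) (trans (cong e (sym 1+i≡n)) (cong (after d) ei≡v)))))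

      before-color : ∀ {v} i → i < n → e i ≡ v → predecessor m c i ≡ c (position d a (before d v))
      before-color zero    _   ei≡v = position-e ≤-refl (trans (walk-predecessor a 0) (cong (before d) ei≡v))
      before-color (suc j) i<n ei≡v = position-e (<⇒≤ i<n) (trans (walk-predecessor a (suc j)) (cong (before d) ei≡v))

      guessed : ∃[ i ] i < n × g (e i) (predecessor m c i) (c (suc i)) ≡ c i
      guessed with won coloring
      ... | v , _ , eq = i , i<n , (begin
        g (e i) (predecessor m c i) (c (suc i))
          ≡⟨ cong (λ u → g u (predecessor m c i) (c (suc i))) ei≡v ⟩
        toℕ (guess s v ∈⊤ (shown v (predecessor m c i) (c (suc i))))
          ≡⟨ cong toℕ (guess-cong s v ∈⊤ (shown-correct coloring v
               (trans (before-color i i<n ei≡v) (sym (toℕ-fromℕ< _))) (trans (after-color i<n ei≡v) (sym (toℕ-fromℕ< _))))) ⟩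
        toℕ (guess s v ∈⊤ (visible (cycle n 3≤n) coloring v))
          ≡⟨ cong toℕ eq ⟩
        toℕ (fromℕ< (C<h v))
          ≡⟨ toℕ-fromℕ< _ ⟩
        c i ∎)
        where
        open ≡-Reasoning
        i    = position d a v
        i<n  = position<n d a v
        ei≡v = walk-position d a v

    wins : ∀ a → Unbeaten m (h ∘ walk d a) (g ∘ walk d a)
    wins = guessed

  cycle-winning⁻ : ∀ a → Winning (cycle n 3≤n) h → SequenceWin m (h ∘ walk d a)
  cycle-winning⁻ a won = let g , wins = cycle-guesses won in g ∘ walk d a , wins a

-- Sets of reachable colors

Disjoint : {A : Set} → (A → Set) → (A → Set) → Set
Disjoint X Y = ∀ p → X p → Y p → ⊥

-- The case `q` = `q′` is included, so that `N q` cannot be empty; likewise three equal colors in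
-- `NoThreeDisjoint`.
Meeting : {Q P : Set} → (Q → P → Set) → Set
Meeting N = ∀ q q′ → ¬ Disjoint (N q) (N q′)

NoThreeDisjoint : {Q P : Set} → (Q → P → Set) → Set
NoThreeDisjoint N = ∀ q₁ q₂ q₃ → Disjoint (N q₁) (N q₂) → Disjoint (N q₁) (N q₃) → Disjoint (N q₂) (N q₃) → ⊥

-- N q is the set of colors p of a vertex for which the pair (p , q) on the edge to the
-- next vertex can be reached by a coloring on which everybody so far guesses wrong.
-- When the next vertex q guesses F p r, the color q is lost for r exactly when F sends
-- all of N q to q; hence the colors lost for the same r have pairwise disjoint sets N q.
record Alive (B : ℕ → Set) (N : ℕ → ℕ → Set) (F : ℕ → ℕ) (q : ℕ) : Set where
  constructor alive
  field
    color-ok : B q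
    {source} : ℕ
    reached  : N q source
    wrong    : F source ≢ q

-- The two families of sets may differ as long as the guess `F` is the same: walks with different
-- label sets are compared in this way.
lost-disjoint : ∀ {B B′ N N′ F q q′} → B q → B′ q′ → q ≢ q′ →
                ¬ Alive B N F q → ¬ Alive B′ N′ F q′ → Disjoint (N q) (N′ q′)
lost-disjoint {F = F} {q} {q′} Bq Bq′ q≢q′ dead dead′ p Np N′p =
  q≢q′ (trans (sym (decidable-stable (F p ≟ q)  (λ Fp≢q  → dead  (alive Bq Np Fp≢q))))
              (decidable-stable (F p ≟ q′) (λ Fp≢q′ → dead′ (alive Bq′ N′p Fp≢q′))))

module _ {B : ℕ → Set} {N : ℕ → ℕ → Set} where

  meeting⇒≤1-lost : ∀ {F q q′} → Meeting N → B q → B q′ → q ≢ q′ →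
                    ¬ Alive B N F q → ¬ Alive B N F q′ → ⊥
  meeting⇒≤1-lost {q = q} {q′} meet Bq Bq′ q≢q′ dead dead′ =
    meet q q′ (lost-disjoint Bq Bq′ q≢q′ dead dead′)

  noThree⇒≤2-lost : ∀ {F q₁ q₂ q₃} → NoThreeDisjoint N → B q₁ → B q₂ → B q₃ →
                    q₁ ≢ q₂ → q₁ ≢ q₃ → q₂ ≢ q₃ →
                    ¬ Alive B N F q₁ → ¬ Alive B N F q₂ → ¬ Alive B N F q₃ → ⊥
  noThree⇒≤2-lost {q₁ = q₁} {q₂} {q₃} no3 B₁ B₂ B₃ 1≢2 1≢3 2≢3 dead₁ dead₂ dead₃ =
    no3 q₁ q₂ q₃ (lost-disjoint B₁ B₂ 1≢2 dead₁ dead₂)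
                 (lost-disjoint B₁ B₃ 1≢3 dead₁ dead₃)
                 (lost-disjoint B₂ B₃ 2≢3 dead₂ dead₃)

-- A lower bound on the size of a set. Each listed element is excluded from the set that supplies
-- the rest, so matching yields the inequalities.
data Many : ℕ → (ℕ → Set) → Set₁ where
  done : ∀ {B} → Many 0 B
  more : ∀ {k B a} → B a → Many k (λ q → B q × a ≢ q) → Many (suc k) B

many-map : ∀ {k B B′} → (∀ {q} → B q → B′ q) → Many k B → Many k B′
many-map B⊆B′ done          = done
many-map B⊆B′ (more Ba rest) = more (B⊆B′ Ba) (many-map (λ (Bq , a≢q) → B⊆B′ Bq , a≢q) rest)

many-≤ : ∀ {j k B} → j ≤ k → Many k B → Many j B
many-≤ z≤n       _              = done
many-≤ (s≤s j≤k) (more Ba rest) = more Ba (many-≤ j≤k rest)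

many-< : ∀ k → Many k (_< k)
many-< zero    = done
many-< (suc k) = more ≤-refl (many-map (λ q<k → m<n⇒m<1+n q<k , ≢-sym (<⇒≢ q<k)) (many-< k))

many-without : ∀ {k B} e → Many (suc k) B → Many k (λ q → B q × q ≢ e)
many-without {k} e (more {a = a} Ba rest) with a ≟ e
... | yes refl = many-map (λ (Bq , e≢q) → Bq , ≢-sym e≢q) rest
many-without {zero}  e (more Ba rest) | no a≢e = done
many-without {suc k} e (more Ba rest) | no a≢e =
  more (Ba , a≢e) (many-map (λ ((Bq , a≢q) , q≢e) → (Bq , q≢e) , a≢q) (many-without e rest))

Without : (ℕ → Set) → List ℕ → ℕ → Set
Without B []       q = B q
Without B (e ∷ es) q = Without B es q × q ≢ e

many-Without : ∀ {k B} es → Many (length es + k) B → Many k (Without B es)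
many-Without         []       many = many
many-Without {k} {B} (e ∷ es) many =
  many-without e (many-Without es (subst (λ j → Many j B) (sym (+-suc (length es) k)) many))

Without-⊆ : ∀ {B} es {q} → Without B es q → B q
Without-⊆ []       Bq       = Bq
Without-⊆ (e ∷ es) (Bq , _) = Without-⊆ es Bq

AtMostOne AtMostTwo : (ℕ → Set) → (ℕ → Set) → Set
AtMostOne B K = ∀ {q q′} → B q → B q′ → q ≢ q′ → ¬ (K q × K q′)
AtMostTwo B K = ∀ {q₁ q₂ q₃} → B q₁ → B q₂ → B q₃ → q₁ ≢ q₂ → q₁ ≢ q₃ → q₂ ≢ q₃ → ¬ (K q₁ × K q₂ × K q₃)

-- Pigeonhole, 1 + 1 < 3. Membership in `K₁` and `K₂` is not decidable, so the covering is a doubly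
-- negated disjunction.
three-in-two : ∀ {B K₁ K₂} → Many 3 B → AtMostOne B K₁ → AtMostOne B K₂ →
               (∀ q → B q → ¬ K₁ q → ¬ K₂ q → ⊥) → ⊥
three-in-two (more {a = a} Ba (more {a = b} (Bb , a≢b) (more {a = c} ((Bc , a≢c) , b≢c) done))) one₁ one₂ all =
  ¬¬-excluded-middle λ where
    (yes ka) → all b Bb (λ kb → one₁ Ba Bb a≢b (ka , kb)) λ lb →
               all c Bc (λ kc → one₁ Ba Bc a≢c (ka , kc)) λ lc →
               one₂ Bb Bc b≢c (lb , lc)
    (no ¬ka) → all a Ba ¬ka λ la →
               all b Bb (λ kb → all c Bc (λ kc → one₁ Bb Bc b≢c (kb , kc)) λ lc → one₂ Ba Bc a≢c (la , lc)) λ lb →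
               one₂ Ba Bb a≢b (la , lb)

five-in-two : ∀ {B K₁ K₂} → Many 5 B → AtMostTwo B K₁ → AtMostTwo B K₂ →
              (∀ q → B q → ¬ K₁ q → ¬ K₂ q → ⊥) → ⊥
five-in-two (more {a = a} Ba (more {a = b} (Bb , a≢b) rest@(more {a = c} ((Bc , a≢c) , b≢c)
  (more {a = d} (((Bd , a≢d) , b≢d) , c≢d) (more {a = e} ((((Be , a≢e) , b≢e) , c≢e) , d≢e) done))))) two₁ two₂ all =
  all a Ba (half two₁ two₂ all) (half two₂ two₁ (λ q Bq k₂ k₁ → all q Bq k₁ k₂))
  where
  -- Let `a` lie in `K₁`. If `b` does too, the other three all fall to `K₂`; if `b` lies in `K₂`,
  -- each set has room for only one of the other three.
  half : ∀ {K₁ K₂} → AtMostTwo _ K₁ → AtMostTwo _ K₂ → (∀ q → _ → ¬ K₁ q → ¬ K₂ q → ⊥) → ¬ K₁ a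
  half {K₁} {K₂} two₁ two₂ all ka = all b Bb
    (λ kb → all c Bc (λ k → two₁ Ba Bb Bc a≢b a≢c b≢c (ka , kb , k)) λ lc →
            all d Bd (λ k → two₁ Ba Bb Bd a≢b a≢d b≢d (ka , kb , k)) λ ld →
            all e Be (λ k → two₁ Ba Bb Be a≢b a≢e b≢e (ka , kb , k)) λ le →
            two₂ Bc Bd Be c≢d c≢e d≢e (lc , ld , le))
    (λ lb → three-in-two {K₁ = K₁} {K₂}
      rest
      (λ { ((Bq , a≢q) , _) ((Bq′ , a≢q′) , _) q≢q′ (k , k′) → two₁ Ba Bq Bq′ a≢q a≢q′ q≢q′ (ka , k , k′) })
      (λ { ((Bq , _) , b≢q) ((Bq′ , _) , b≢q′) q≢q′ (l , l′) → two₂ Bb Bq Bq′ b≢q b≢q′ q≢q′ (lb , l , l′) })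
      (λ q ((Bq , _) , _) → all q Bq))

module _ {B : ℕ → Set} {N N′ : ℕ → ℕ → Set} (g : ℕ → ℕ → ℕ) where

  -- Each family loses at most one of three colors, so some color stays alive in both. With `N′` =
  -- `N` this keeps `Meeting`; different families come from different label sets.
  meeting³-cross : Many 3 B → Meeting N → Meeting N′ → ∀ r r′ →
                   ¬ Disjoint (Alive B N (λ p → g p r)) (Alive B N′ (λ p → g p r′))
  meeting³-cross colors meet meet′ r r′ disjoint = three-in-two {K₁ = λ q → ¬ Alive B N _ q} {λ q → ¬ Alive B N′ _ q} colors
    (λ { Bq Bq′ q≢q′ (k , k′) → meeting⇒≤1-lost meet Bq Bq′ q≢q′ k k′ })
    (λ { Bq Bq′ q≢q′ (k , k′) → meeting⇒≤1-lost meet′ Bq Bq′ q≢q′ k k′ })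
    (λ q Bq alive alive′ → alive λ x → alive′ λ y → disjoint q x y)

  -- Each family loses at most two of five colors. With `N′` = `N` this restores `Meeting` from the
  -- weaker state.
  noThree⁵-cross : Many 5 B → NoThreeDisjoint N → NoThreeDisjoint N′ → ∀ r r′ →
                   ¬ Disjoint (Alive B N (λ p → g p r)) (Alive B N′ (λ p → g p r′))
  noThree⁵-cross colors no3 no3′ r r′ disjoint = five-in-two {K₁ = λ q → ¬ Alive B N _ q} {λ q → ¬ Alive B N′ _ q} colors
    (λ { B₁ B₂ B₃ x y z (k₁ , k₂ , k₃) → noThree⇒≤2-lost no3 B₁ B₂ B₃ x y z k₁ k₂ k₃ })
    (λ { B₁ B₂ B₃ x y z (k₁ , k₂ , k₃) → noThree⇒≤2-lost no3′ B₁ B₂ B₃ x y z k₁ k₂ k₃ })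
    (λ q Bq alive alive′ → alive λ x → alive′ λ y → disjoint q x y)

module _ {B : ℕ → Set} {N : ℕ → ℕ → Set} (g : ℕ → ℕ → ℕ) where

  private
    N⁺ : ℕ → ℕ → Set
    N⁺ r = Alive B N (λ p → g p r)

  -- Each `r` keeps one of the two colors alive, and among three `r` two keep the same one.
  meeting² : Many 2 B → Meeting N → NoThreeDisjoint N⁺
  meeting² (more {a = a} Ba (more {a = b} (Bb , a≢b) done)) meet r₁ r₂ r₃ d₁₂ d₁₃ d₂₃ =
    alive-or r₁ λ where
      (inj₁ x₁) → alive-or r₂ λ where
        (inj₁ x₂) → d₁₂ a x₁ x₂
        (inj₂ y₂) → alive-or r₃ λ where
          (inj₁ x₃) → d₁₃ a x₁ x₃
          (inj₂ y₃) → d₂₃ b y₂ y₃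
      (inj₂ y₁) → alive-or r₂ λ where
        (inj₁ x₂) → alive-or r₃ λ where
          (inj₁ x₃) → d₂₃ a x₂ x₃
          (inj₂ y₃) → d₁₃ b y₁ y₃
        (inj₂ y₂) → d₁₂ b y₁ y₂
    where
    alive-or : ∀ r → ¬ ¬ (N⁺ r a ⊎ N⁺ r b)
    alive-or r k = meeting⇒≤1-lost meet Ba Bb a≢b (k ∘ inj₁) (k ∘ inj₂)

  -- Each `rᵢ` keeps some color `qᵢ` alive. If the sets for the `rᵢ` are disjoint, `q₁` and `q₂` are
  -- both lost for `r₃`, so `N q₁` and `N q₂` are disjoint; the other two pairs follow by symmetry.
  noThree³ : Many 3 B → NoThreeDisjoint N → NoThreeDisjoint N⁺
  noThree³ (more Ba (more (Bb , a≢b) (more ((Bc , a≢c) , b≢c) done))) no3 r₁ r₂ r₃ d₁₂ d₁₃ d₂₃ =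
    some r₁ λ (q₁ , x₁) → some r₂ λ (q₂ , x₂) → some r₃ λ (q₃ , x₃) →
    no3 q₁ q₂ q₃
      (disjoint x₁ x₂ d₁₂ (d₁₃ q₁ x₁) (d₂₃ q₂ x₂))
      (disjoint x₁ x₃ d₁₃ (d₁₂ q₁ x₁) (λ y → d₂₃ q₃ y x₃))
      (disjoint x₂ x₃ d₂₃ (λ y → d₁₂ q₂ y x₂) (λ y → d₁₃ q₃ y x₃))
    where
    some : ∀ r → ¬ ¬ (∃[ q ] N⁺ r q)
    some r k = noThree⇒≤2-lost no3 Ba Bb Bc a≢b a≢c b≢c (k ∘ (_ ,_)) (k ∘ (_ ,_)) (k ∘ (_ ,_))
    disjoint : ∀ {r r′ s q q′} → N⁺ r q → N⁺ r′ q′ → Disjoint (N⁺ r) (N⁺ r′) →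
               ¬ N⁺ s q → ¬ N⁺ s q′ → Disjoint (N q) (N q′)
    disjoint {q = q} x x′ d = lost-disjoint (color-ok x) (color-ok x′) λ { refl → d q x x′ }
      where open Alive

many-<⇒≤ : ∀ {k n} → Many k (_< n) → k ≤ n
many-<⇒≤ done = z≤n
many-<⇒≤ {suc k} {suc n} many@(more _ _) =
  s≤s (many-<⇒≤ (many-map (λ (q<1+n , q≢n) → ≤∧≢⇒< (s≤s⁻¹ q<1+n) q≢n) (many-without n many)))
  where open import Data.Nat.Base using (s≤s⁻¹)

_∷?_ : ∀ {P : Set} → (Dec P × ℕ) → List ℕ → List ℕ
(yes _ , k) ∷? ks = k ∷ ks
(no  _ , k) ∷? ks = ks

hits : (ℕ → ℕ) → ℕ → ℕ → List ℕ
hits f x zero    = []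
hits f x (suc k) = ((f k ≟ x) , k) ∷? hits f x k

without-hits : ∀ {f x} k j {ℓ} → ℓ < k → Without (_< j) (hits f x k) ℓ → f ℓ ≢ x
without-hits {f} {x} (suc k) j {ℓ} ℓ<1+k out with f k ≟ x | m≤n⇒m<n∨m≡n ℓ<1+k
... | yes _    | inj₁ (s≤s ℓ<k) = without-hits k j ℓ<k (proj₁ out)
... | yes _    | inj₂ refl      = contradiction refl (proj₂ out)
... | no  _    | inj₁ (s≤s ℓ<k) = without-hits k j ℓ<k out
... | no  fk≢x | inj₂ refl      = fk≢x

hits₂ : ∀ f k → length (hits f 0 k) + length (hits f 1 k) ≤ k
hits₂ f zero    = z≤n
hits₂ f (suc k) with f k | hits₂ f k
... | 0           | ih = s≤s ih
... | 1           | ih = subst (_≤ suc k) (sym (+-suc (length (hits f 0 k)) _)) (s≤s ih)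
... | suc (suc _) | ih = m≤n⇒m≤1+n ih

hits₄ : ∀ f k → length (hits f 0 k) + (length (hits f 1 k) + (length (hits f 2 k) + length (hits f 3 k))) ≤ k
hits₄ f zero    = z≤n
hits₄ f (suc k) with f k | hits₄ f k
... | 0 | ih = s≤s ih
... | 1 | ih = subst (_≤ suc k) (sym (+-suc (length (hits f 0 k)) _)) (s≤s ih)
... | 2 | ih = subst (_≤ suc k) (sym (trans (cong (length (hits f 0 k) +_) (+-suc (length (hits f 1 k)) _))
                 (+-suc (length (hits f 0 k)) _))) (s≤s ih)
... | 3 | ih = subst (_≤ suc k) (sym (trans (cong (length (hits f 0 k) +_)
                   (trans (cong (length (hits f 1 k) +_) (+-suc (length (hits f 2 k)) _)) (+-suc (length (hits f 1 k)) _)))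
                 (+-suc (length (hits f 0 k)) _))) (s≤s ih)
... | suc (suc (suc (suc _))) | ih = m≤n⇒m≤1+n ih

-- Walks from a cut vertex with restricted labels

Palette : (ℕ → Set) → (ℕ → ℕ) → ℕ → ℕ → Set
Palette Λ H zero          = _< H 0
Palette Λ H (suc zero)    = Λ
Palette Λ H (suc (suc i)) = _< H (suc (suc i))

module Cut {k : ℕ} {H : ℕ → ℕ} (win : SequenceWin (3 + k) H) where

  private
    G = proj₁ win

  -- `Reach Λ x i q p`: a walk starts with color `x`, takes its label at vertex 1 from `Λ`, has
  -- wrong guesses at the vertices 1 to `i`, and shows `p` at `i` and `q` at `i + 1`. The look-ahead
  -- `q` is not yet bounded, and the guess of vertex 0 is left open.
  Reach : (ℕ → Set) → ℕ → ℕ → ℕ → ℕ → Set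
  Reach Λ x zero    q p = p ≡ x
  Reach Λ x (suc i) r   = Alive (Palette Λ H (suc i)) (Reach Λ x i) (λ p → G (suc i) p r)

  record Trail (Λ : ℕ → Set) (x i q p : ℕ) : Set where
    field
      color    : ℕ → ℕ
      start    : color 0 ≡ x
      end      : color i ≡ p
      look     : color (suc i) ≡ q
      bounded  : ∀ j → j < i → Palette Λ H (suc j) (color (suc j))
      mistaken : ∀ j → j < i → G (suc j) (color j) (color (suc (suc j))) ≢ color (suc j)

  trail : ∀ {Λ x} i {q p} → Reach Λ x i q p → Trail Λ x i q p
  trail {x = x} zero {q} p≡x = record
    { color    = λ { zero → x ; (suc _) → q }
    ; start    = refl
    ; end      = sym p≡x
    ; look     = refl
    ; bounded  = λ _ ()
    ; mistaken = λ _ ()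
    }
  trail {Λ} {x} (suc i) {r} {q} (alive Λq {p} reach wrong) = record
    { color    = color
    ; start    = trans (old z≤n) T.start
    ; end      = trans (old ≤-refl) T.look
    ; look     = new
    ; bounded  = λ j j<1+i → subst (Palette Λ H (suc j)) (sym (old j<1+i)) (bounded j j<1+i)
    ; mistaken = mistaken
    }
    where
    module T = Trail (trail i reach)
    color : ℕ → ℕ
    color j with j ≤? suc i
    ... | yes _ = T.color j
    ... | no  _ = r
    old : ∀ {j} → j ≤ suc i → color j ≡ T.color j
    old {j} j≤1+i with j ≤? suc i
    ... | yes _     = refl
    ... | no  j≰1+i = contradiction j≤1+i j≰1+i
    new : color (suc (suc i)) ≡ r
    new with suc (suc i) ≤? suc i
    ... | yes 2+i≤1+i = contradiction 2+i≤1+i (<⇒≱ ≤-refl)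
    ... | no  _       = refl
    bounded : ∀ j → j < suc i → Palette Λ H (suc j) (T.color (suc j))
    bounded j j<1+i with m≤n⇒m<n∨m≡n j<1+i
    ... | inj₁ (s≤s j<i) = T.bounded j j<i
    ... | inj₂ refl      = subst (Palette Λ H (suc i)) (sym T.look) Λq
    mistaken : ∀ j → j < suc i → G (suc j) (color j) (color (suc (suc j))) ≢ color (suc j)
    mistaken j j<1+i eq with m≤n⇒m<n∨m≡n j<1+i
    ... | inj₁ (s≤s j<i) = T.mistaken j j<i
      (trans (sym (cong₂ (G (suc j)) (old (<⇒≤ j<1+i)) (old (s≤s j<i)))) (trans eq (old j<1+i)))
    ... | inj₂ refl = wrong (trans (sym (cong₂ (G (suc i)) (trans (old (<⇒≤ j<1+i)) T.end) new))
      (trans eq (trans (old ≤-refl) T.look)))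

  -- On a closed trail everybody but the cut vertex is wrong, so the cut vertex must guess `x`.
  closed-trail-guessed : ∀ {Λ x u} → (∀ {ℓ} → Λ ℓ → ℓ < H 1) → x < H 0 → Reach Λ x (3 + k) x u →
                         ∃[ ℓ ] Λ ℓ × G 0 u ℓ ≡ x
  closed-trail-guessed {Λ} {x} {u} Λ<H x<H reach = conclude (proj₂ win color in-range (trans look (sym start)))
    where
    open Trail (trail (3 + k) reach)
    in-range : ∀ i → i < 4 + k → color i < H i
    in-range zero          _           = subst (_< H 0) (sym start) x<H
    in-range (suc zero)    (s≤s 1≤3+k) = Λ<H (bounded 0 1≤3+k)
    in-range (suc (suc i)) (s≤s i<3+k) = bounded (suc i) i<3+k
    conclude : (∃[ i ] i < 4 + k × G i (predecessor (3 + k) color i) (color (suc i)) ≡ color i) → ∃[ ℓ ] Λ ℓ × G 0 u ℓ ≡ x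
    conclude (zero  , _ , eq)         = color 1 , bounded 0 (s≤s z≤n) , trans (cong (λ p → G 0 p (color 1)) (sym end)) (trans eq start)
    conclude (suc i , s≤s i<3+k , eq) = contradiction eq (mistaken i i<3+k)

  reach₀-meeting : ∀ {Λ x} → Meeting (Reach Λ x 0)
  reach₀-meeting {x = x} q q′ disjoint = disjoint x refl refl

  Guessed : ℕ → ℕ → ℕ → List ℕ
  Guessed K x u = hits (λ ℓ → G 0 u ℓ) x K

  -- With the labels restricted to these, no walk through color x can close up at the cut.
  Missed : ℕ → ℕ → ℕ → ℕ → Set
  Missed K x u = Without (_< K) (Guessed K x u)

  missed⊆ : ∀ {K x u ℓ} → K ≤ H 1 → Missed K x u ℓ → ℓ < H 1
  missed⊆ {K} {x} {u} K≤H out = <-≤-trans (Without-⊆ (Guessed K x u) out) K≤H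

  many-missed : ∀ {j} K x u → length (Guessed K x u) + j ≤ K → Many j (Missed K x u)
  many-missed K x u few = many-Without (Guessed K x u) (many-≤ few (many-< K))

  missed-dead : ∀ {K x u} → K ≤ H 1 → x < H 0 → 
                ¬ Alive (_< H (3 + k)) (Reach (Missed K x u) x (2 + k)) (λ p → G (3 + k) p x) u
  missed-dead {K} {x} {u} K≤H x<H reach with closed-trail-guessed (missed⊆ {K} {x} {u} K≤H) x<H reach
  ... | ℓ , out , eq = without-hits K K (Without-⊆ (Guessed K x u) out) out eq

  -- Before the color `x` of the cut, the last vertex applies the same guess function to both
  -- families, and it loses `u` in one and `u′` in the other. The losing arguments that count labels
  -- contradict this disjointness.
  missed-disjoint : ∀ {K x u u′} → K ≤ H 1 → x < H 0 → u < H (3 + k) → u′ < H (3 + k) → u ≢ u′ →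
    Disjoint (Reach (Missed K x u) x (2 + k) u) (Reach (Missed K x u′) x (2 + k) u′)
  missed-disjoint K≤H x<H u<H u′<H u≢u′ =
    lost-disjoint u<H u′<H u≢u′ (missed-dead K≤H x<H) (missed-dead K≤H x<H)

  module _ (3≤H : ∀ i → 3 ≤ H (2 + i)) where

    -- The number of labels acts as the number of colors of vertex 1: three labels start the strong
    -- state, two the weak one.
    reach-meeting : ∀ {Λ x} → Many 3 Λ → ∀ i → Meeting (Reach Λ x i)
    reach-meeting {Λ} {x} 3Λ zero r r′ = reach₀-meeting {Λ} {x} r r′
    reach-meeting {Λ} {x} 3Λ (suc zero) r r′ =
      meeting³-cross (G 1) 3Λ (reach₀-meeting {Λ} {x}) (reach₀-meeting {Λ} {x}) r r′
    reach-meeting 3Λ (suc (suc i)) r r′ =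
      meeting³-cross (G (2 + i)) (many-≤ (3≤H i) (many-< _)) (reach-meeting 3Λ (suc i)) (reach-meeting 3Λ (suc i)) r r′

    reach-noThree : ∀ {Λ x} → Many 2 Λ → ∀ i → NoThreeDisjoint (Reach Λ x (suc i))
    reach-noThree {Λ} {x} 2Λ zero = meeting² (G 1) 2Λ (reach₀-meeting {Λ} {x})
    reach-noThree 2Λ (suc i) = noThree³ (G (2 + i)) (many-≤ (3≤H i) (many-< _)) (reach-noThree 2Λ i)

  alive-one : ∀ {N : ℕ → ℕ → Set} {r} → NoThreeDisjoint N → ¬ ¬ (∃[ p ] N r p)
  alive-one {r = r} no3 absurd = no3 r r r empty empty empty
    where
    empty = λ p x _ → absurd (p , x)

  alive-two : ∀ {B N F} → NoThreeDisjoint N → Many 4 B → ¬ ¬ (∃[ q ] ∃[ q′ ] q ≢ q′ × Alive B N F q × Alive B N F q′)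
  alive-two {B} {N} {F} no3 many absurd = some many λ (q , x) →
    some (many-without q many) λ (q′ , alive (Bq′ , q′≢q) y z) →
    absurd (q , q′ , ≢-sym q′≢q , alive (Alive.color-ok x) (Alive.reached x) (Alive.wrong x) , alive Bq′ y z)
    where
    some : ∀ {j B′} → Many (3 + j) B′ → ¬ ¬ (∃[ q ] Alive B′ N F q)
    some (more Ba (more (Bb , a≢b) (more ((Bc , a≢c) , b≢c) _))) absurd =
      noThree⇒≤2-lost no3 Ba Bb Bc a≢b a≢c b≢c (absurd ∘ (_ ,_)) (absurd ∘ (_ ,_)) (absurd ∘ (_ ,_))

  module _ (K : ℕ) (K≤H : K ≤ H 1) {x : ℕ} (x<H : x < H 0) (3≤H : ∀ i → 3 ≤ H (2 + i)) where

    private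
      M : ℕ → ℕ → Set
      M = Missed K x
      pairwise : ∀ {u u′} → u < H (3 + k) → u′ < H (3 + k) → u ≢ u′ →
                 Disjoint (Reach (M u) x (2 + k) u) (Reach (M u′) x (2 + k) u′)
      pairwise = missed-disjoint {K} K≤H x<H

    triple-triple : ∀ {u u′} → u < H (3 + k) → u′ < H (3 + k) → u ≢ u′ → Many 3 (M u) → Many 3 (M u′) → ⊥
    triple-triple {u} {u′} u<H u′<H u≢u′ 3u 3u′ =
      meeting³-cross (G (2 + k)) (many-≤ (3≤H k) (many-< _)) (reach-meeting 3≤H 3u (suc k)) (reach-meeting 3≤H 3u′ (suc k))
        u u′ (pairwise u<H u′<H u≢u′)

    -- The walks for `u₂` and `u₃` each reach a color of the vertex before the last, and by
    -- disjointness two different ones; the walks for `u₁` lose at most one color there.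
    triple-pair-pair : ∀ {u₁ u₂ u₃} → u₁ < H (3 + k) → u₂ < H (3 + k) → u₃ < H (3 + k) → u₁ ≢ u₂ → u₁ ≢ u₃ → u₂ ≢ u₃ →
                       Many 3 (M u₁) → Many 2 (M u₂) → Many 2 (M u₃) → ⊥
    triple-pair-pair {u₁} {u₂} {u₃} l₁ l₂ l₃ 1≢2 1≢3 2≢3 3u₁ 2u₂ 2u₃ =
      alive-one (reach-noThree 3≤H 2u₂ (suc k)) λ (p , P) → alive-one (reach-noThree 3≤H 2u₃ (suc k)) λ (p′ , P′) →
      meeting⇒≤1-lost (reach-meeting 3≤H 3u₁ (suc k)) (Alive.color-ok P) (Alive.color-ok P′)
        (λ { refl → pairwise l₂ l₃ 2≢3 p P P′ })
        (λ y → pairwise l₁ l₂ 1≢2 p y P) (λ y → pairwise l₁ l₃ 1≢3 p′ y P′)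

    module _ (4≤H : 4 ≤ H (2 + k)) where

      -- Of four colors the walks for `u₂` keep two, and those for `u₁` lose at most one.
      triple-pair : ∀ {u₁ u₂} → u₁ < H (3 + k) → u₂ < H (3 + k) → u₁ ≢ u₂ → Many 3 (M u₁) → Many 2 (M u₂) → ⊥
      triple-pair {u₁} {u₂} l₁ l₂ 1≢2 3u₁ 2u₂ =
        alive-two (reach-noThree 3≤H 2u₂ k) (many-≤ 4≤H (many-< _)) λ (p , p′ , p≢p′ , P , P′) →
        meeting⇒≤1-lost (reach-meeting 3≤H 3u₁ (suc k)) (Alive.color-ok P) (Alive.color-ok P′) p≢p′
          (λ y → pairwise l₁ l₂ 1≢2 p y P) (λ y → pairwise l₁ l₂ 1≢2 p′ y P′)

      -- The walks for `u₁` keep two colors, those for `u₂` a third one, and those for `u₃` lose at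
      -- most two.
      pair-pair-pair : ∀ {u₁ u₂ u₃} → u₁ < H (3 + k) → u₂ < H (3 + k) → u₃ < H (3 + k) → u₁ ≢ u₂ → u₁ ≢ u₃ → u₂ ≢ u₃ →
                       Many 2 (M u₁) → Many 2 (M u₂) → Many 2 (M u₃) → ⊥
      pair-pair-pair {u₁} {u₂} {u₃} l₁ l₂ l₃ 1≢2 1≢3 2≢3 2u₁ 2u₂ 2u₃ =
        alive-two (reach-noThree 3≤H 2u₁ k) (many-≤ 4≤H (many-< _)) λ (p , p′ , p≢p′ , P , P′) →
        alive-one (reach-noThree 3≤H 2u₂ (suc k)) λ (r , R) →
        noThree⇒≤2-lost (reach-noThree 3≤H 2u₃ k) (Alive.color-ok P) (Alive.color-ok P′) (Alive.color-ok R) p≢p′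
          (λ { refl → pairwise l₁ l₂ 1≢2 p P R }) (λ { refl → pairwise l₁ l₂ 1≢2 p′ P′ R })
          (λ y → pairwise l₁ l₃ 1≢3 p P y) (λ y → pairwise l₁ l₃ 1≢3 p′ P′ y) (λ y → pairwise l₂ l₃ 2≢3 r R y)

    module _ (H≡3 : H (2 + k) ≡ 3) where

      pair⁴ : ∀ {u₁ u₂ u₃ u₄} → u₁ < H (3 + k) → u₂ < H (3 + k) → u₃ < H (3 + k) → u₄ < H (3 + k) →
              u₁ ≢ u₂ → u₁ ≢ u₃ → u₁ ≢ u₄ → u₂ ≢ u₃ → u₂ ≢ u₄ → u₃ ≢ u₄ →
              Many 2 (M u₁) → Many 2 (M u₂) → Many 2 (M u₃) → Many 2 (M u₄) → ⊥
      pair⁴ l₁ l₂ l₃ l₄ 1≢2 1≢3 1≢4 2≢3 2≢4 3≢4 2u₁ 2u₂ 2u₃ 2u₄ =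
        alive-one (reach-noThree 3≤H 2u₁ (suc k)) λ (p₁ , P₁) → alive-one (reach-noThree 3≤H 2u₂ (suc k)) λ (p₂ , P₂) →
        alive-one (reach-noThree 3≤H 2u₃ (suc k)) λ (p₃ , P₃) → alive-one (reach-noThree 3≤H 2u₄ (suc k)) λ (p₄ , P₄) →
        contradiction (subst (4 ≤_) H≡3 (many-<⇒≤
          (more (Alive.color-ok P₁)
          (more (Alive.color-ok P₂ , λ { refl → pairwise l₁ l₂ 1≢2 p₁ P₁ P₂ })
          (more ((Alive.color-ok P₃ , λ { refl → pairwise l₁ l₃ 1≢3 p₁ P₁ P₃ }) , λ { refl → pairwise l₂ l₃ 2≢3 p₂ P₂ P₃ })
          (more (((Alive.color-ok P₄ , λ { refl → pairwise l₁ l₄ 1≢4 p₁ P₁ P₄ }) , λ { refl → pairwise l₂ l₄ 2≢4 p₂ P₂ P₄ }) ,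
                   λ { refl → pairwise l₃ l₄ 3≢4 p₃ P₃ P₄ })
          done)))))) λ { (s≤s (s≤s (s≤s ()))) }

-- Losing cycles with a vertex of at least four colors

sum≤⇒≤⊎≤ : ∀ a b {x y} → a + b ≤ suc (x + y) → a ≤ x ⊎ b ≤ y
sum≤⇒≤⊎≤ a b {x} {y} a+b≤ with a ≤? x
... | yes a≤x = inj₁ a≤x
... | no  a≰x = inj₂ (+-cancelˡ-≤ (suc x) b y (≤-trans (+-monoˡ-≤ b (≰⇒> a≰x)) a+b≤))

-- For three labels, `a + j ≤ 3` is the form in which `many-missed` asks for `j` missed labels. A
-- total below three leaves two zeros, or one zero and two ones.
sum<3 : ∀ a b c → a + (b + c) < 3 →
        (a + 3 ≤ 3 × b + 3 ≤ 3) ⊎ (a + 3 ≤ 3 × c + 3 ≤ 3) ⊎ (b + 3 ≤ 3 × c + 3 ≤ 3) ⊎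
        (a + 3 ≤ 3 × b + 2 ≤ 3 × c + 2 ≤ 3) ⊎ (b + 3 ≤ 3 × a + 2 ≤ 3 × c + 2 ≤ 3) ⊎ (c + 3 ≤ 3 × a + 2 ≤ 3 × b + 2 ≤ 3)
sum<3 0 0 _ _ = inj₁ (≤-refl , ≤-refl)
sum<3 0 (suc _) 0 _ = inj₂ (inj₁ (≤-refl , ≤-refl))
sum<3 (suc _) 0 0 _ = inj₂ (inj₂ (inj₁ (≤-refl , ≤-refl)))
sum<3 0 1 1 _ = inj₂ (inj₂ (inj₂ (inj₁ (≤-refl , ≤-refl , ≤-refl))))
sum<3 1 0 1 _ = inj₂ (inj₂ (inj₂ (inj₂ (inj₁ (≤-refl , ≤-refl , ≤-refl)))))
sum<3 1 1 0 _ = inj₂ (inj₂ (inj₂ (inj₂ (inj₂ (≤-refl , ≤-refl , ≤-refl)))))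
sum<3 0 1 (suc (suc _)) (s≤s (s≤s (s≤s ())))
sum<3 0 (suc (suc b)) (suc c) (s≤s (s≤s (s≤s b+1+c≤0))) = contradiction b+1+c≤0 (subst (λ s → ¬ s ≤ 0) (sym (+-suc b c)) λ ())
sum<3 1 0 (suc (suc _)) (s≤s (s≤s (s≤s ())))
sum<3 1 (suc (suc _)) _ (s≤s (s≤s (s≤s ())))
sum<3 1 1 (suc _) (s≤s (s≤s (s≤s ())))
sum<3 (suc (suc a)) (suc b) c (s≤s (s≤s (s≤s a+1+b+c≤0))) = contradiction a+1+b+c≤0 (subst (λ s → ¬ s ≤ 0) (sym (+-suc a (b + c))) λ ())
sum<3 (suc (suc a)) 0 (suc c) (s≤s (s≤s (s≤s a+1+c≤0))) = contradiction a+1+c≤0 (subst (λ s → ¬ s ≤ 0) (sym (+-suc a c)) λ ())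

-- Cut at a vertex with four colors.  The guess at the cut assigns a color to each pair
-- of labels of its neighbours, and each of the four colors must be assigned to at least
-- three of the 3 × 3 pairs.
losing-4-≥3 : ∀ {k H} → 4 ≤ H 0 → (∀ i → 3 ≤ H (suc i)) → ¬ SequenceWin (3 + k) H
losing-4-≥3 {k} {H} 4≤H₀ 3≤H win = contradiction total≥12 (<⇒≱ (s≤s (≤-trans total≤9 (m≤n+m 9 2))))
  where
  open Cut win

  L : ℕ → ℕ → ℕ
  L x u = length (Guessed 3 x u)

  label : ∀ {u} → u < 3 → u < H (3 + k)
  label u<3 = <-≤-trans u<3 (3≤H (2 + k))

  0<3 : 0 < 3
  0<3 = s≤s z≤n
  1<3 : 1 < 3
  1<3 = s≤s (s≤s z≤n)
  2<3 : 2 < 3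
  2<3 = s≤s (s≤s (s≤s z≤n))

  three≤ : ∀ x → x < 4 → 3 ≤ L x 0 + (L x 1 + L x 2)
  three≤ x x<4 = ≮⇒≥ λ few → case sum<3 (L x 0) (L x 1) (L x 2) few of λ where
      (inj₁ (a , b)) → t³ 0<3 1<3 (λ ()) a b
      (inj₂ (inj₁ (a , c))) → t³ 0<3 2<3 (λ ()) a c
      (inj₂ (inj₂ (inj₁ (b , c)))) → t³ 1<3 2<3 (λ ()) b c
      (inj₂ (inj₂ (inj₂ (inj₁ (a , b , c))))) → t²² 0<3 1<3 2<3 (λ ()) (λ ()) (λ ()) a b c
      (inj₂ (inj₂ (inj₂ (inj₂ (inj₁ (b , a , c)))))) → t²² 1<3 0<3 2<3 (λ ()) (λ ()) (λ ()) b a c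
      (inj₂ (inj₂ (inj₂ (inj₂ (inj₂ (c , a , b)))))) → t²² 2<3 0<3 1<3 (λ ()) (λ ()) (λ ()) c a b
    where
    x<H = <-≤-trans x<4 4≤H₀
    t³ : ∀ {u u′} → u < 3 → u′ < 3 → u ≢ u′ → L x u + 3 ≤ 3 → L x u′ + 3 ≤ 3 → ⊥
    t³ {u} {u′} l l′ u≢u′ a b = triple-triple 3 (3≤H 0) x<H (3≤H ∘ suc) (label l) (label l′) u≢u′
      (many-missed 3 x u a) (many-missed 3 x u′ b)
    t²² : ∀ {u v w} → u < 3 → v < 3 → w < 3 → u ≢ v → u ≢ w → v ≢ w → L x u + 3 ≤ 3 → L x v + 2 ≤ 3 → L x w + 2 ≤ 3 → ⊥
    t²² {u} {v} {w} l l′ l″ uv uw vw a b c =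
      triple-pair-pair 3 (3≤H 0) x<H (3≤H ∘ suc) (label l) (label l′) (label l″) uv uw vw
        (many-missed 3 x u a) (many-missed 3 x v b) (many-missed 3 x w c)

  column : ℕ → ℕ
  column u = L 0 u + (L 1 u + (L 2 u + L 3 u))

  total≤9 : column 0 + (column 1 + column 2) ≤ 9
  total≤9 = +-mono-≤ (hits₄ (proj₁ win 0 0) 3) (+-mono-≤ (hits₄ (proj₁ win 0 1) 3) (hits₄ (proj₁ win 0 2) 3))

  total≥12 : 12 ≤ column 0 + (column 1 + column 2)
  total≥12 = subst (12 ≤_)
    (solve 12 (λ a₀ a₁ a₂ b₀ b₁ b₂ c₀ c₁ c₂ d₀ d₁ d₂ →
      (a₀ :+ (a₁ :+ a₂)) :+ ((b₀ :+ (b₁ :+ b₂)) :+ ((c₀ :+ (c₁ :+ c₂)) :+ (d₀ :+ (d₁ :+ d₂)))) :=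
      (a₀ :+ (b₀ :+ (c₀ :+ d₀))) :+ ((a₁ :+ (b₁ :+ (c₁ :+ d₁))) :+ (a₂ :+ (b₂ :+ (c₂ :+ d₂))))) refl
      (L 0 0) (L 0 1) (L 0 2) (L 1 0) (L 1 1) (L 1 2) (L 2 0) (L 2 1) (L 2 2) (L 3 0) (L 3 1) (L 3 2))
    (+-mono-≤ (three≤ 0 (s≤s z≤n)) (+-mono-≤ (three≤ 1 (s≤s (s≤s z≤n)))
      (+-mono-≤ (three≤ 2 (s≤s (s≤s (s≤s z≤n)))) (three≤ 3 (s≤s (s≤s (s≤s (s≤s z≤n))))))))
    where open +-*-Solver

module _ {k : ℕ} {H : ℕ → ℕ} (2≤H₀ : 2 ≤ H 0) (4≤H₁ : 4 ≤ H 1) (3≤H : ∀ i → 3 ≤ H (2 + i))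
         (win : SequenceWin (3 + k) H) where

  open Cut win

  private
    L : ℕ → ℕ → ℕ
    L x u = length (Guessed 4 x u)

    Pair Triple : ℕ → ℕ → Set₁
    Pair   x u = Many 2 (Missed 4 x u)
    Triple x u = Many 3 (Missed 4 x u)

    0<H : 0 < H 0
    0<H = <-≤-trans (s≤s z≤n) 2≤H₀
    1<H : 1 < H 0
    1<H = 2≤H₀

    -- Next to `u`, each of the four labels is guessed for at most one of the colors 0 and 1, so
    -- `L 0 u + L 1 u ≤ 4`: either `L 0 u ≤ 1` or `L 1 u ≤ 2`.
    pair₁⊎triple₀ : ∀ u → Pair 1 u ⊎ Triple 0 u
    pair₁⊎triple₀ u with sum≤⇒≤⊎≤ (L 0 u) (L 1 u) {1} {2} (hits₂ (λ ℓ → proj₁ win 0 u ℓ) 4)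
    ... | inj₁ L₀≤1 = inj₂ (many-missed 4 0 u (+-monoˡ-≤ 3 L₀≤1))
    ... | inj₂ L₁≤2 = inj₁ (many-missed 4 1 u (+-monoˡ-≤ 2 L₁≤2))

    pair₀⊎triple₁ : ∀ u → Pair 0 u ⊎ Triple 1 u
    pair₀⊎triple₁ u with sum≤⇒≤⊎≤ (L 0 u) (L 1 u) {2} {1} (hits₂ (λ ℓ → proj₁ win 0 u ℓ) 4)
    ... | inj₁ L₀≤2 = inj₁ (many-missed 4 0 u (+-monoˡ-≤ 2 L₀≤2))
    ... | inj₂ L₁≤1 = inj₂ (many-missed 4 1 u (+-monoˡ-≤ 3 L₁≤1))

  -- A triple for color 0 excludes pairs for color 0 at the other two `u`; both are then triples for
  -- color 1, which clash. Without triples for color 0, all three `u` are pairs for color 1.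
  losing-4…43 : 4 ≤ H (2 + k) → ⊥
  losing-4…43 4≤H = go (pair₁⊎triple₀ 0) (pair₁⊎triple₀ 1) (pair₁⊎triple₀ 2)
    where
    label : ∀ {u} → u < 3 → u < H (3 + k)
    label u<3 = <-≤-trans u<3 (3≤H (1 + k))
    l₀ = label (s≤s z≤n)
    l₁ = label (s≤s (s≤s z≤n))
    l₂ = label (s≤s (s≤s (s≤s z≤n)))

    star : ∀ {u v w} → u < H (3 + k) → v < H (3 + k) → w < H (3 + k) → u ≢ v → u ≢ w → v ≢ w → Triple 0 u → ⊥
    star {u} {v} {w} lu lv lw uv uw vw t with pair₀⊎triple₁ v | pair₀⊎triple₁ w
    ... | inj₁ p | _      = triple-pair 4 4≤H₁ 0<H 3≤H 4≤H lu lv uv t p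
    ... | inj₂ _ | inj₁ p = triple-pair 4 4≤H₁ 0<H 3≤H 4≤H lu lw uw t p
    ... | inj₂ t | inj₂ s = triple-triple 4 4≤H₁ 1<H 3≤H lv lw vw t s

    go : Pair 1 0 ⊎ Triple 0 0 → Pair 1 1 ⊎ Triple 0 1 → Pair 1 2 ⊎ Triple 0 2 → ⊥
    go (inj₂ t) _ _ = star l₀ l₁ l₂ (λ ()) (λ ()) (λ ()) t
    go _ (inj₂ t) _ = star l₁ l₀ l₂ (λ ()) (λ ()) (λ ()) t
    go _ _ (inj₂ t) = star l₂ l₀ l₁ (λ ()) (λ ()) (λ ()) t
    go (inj₁ p) (inj₁ q) (inj₁ r) = pair-pair-pair 4 4≤H₁ 1<H 3≤H 4≤H l₀ l₁ l₂ (λ ()) (λ ()) (λ ()) p q r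

  -- With only three colors before the last vertex, a triple clashes with two pairs rather than with
  -- one. The fourth `u` compensates: of the three others, two are pairs for color 0 or two are
  -- triples for color 1.
  losing-4…34 : H (2 + k) ≡ 3 → 4 ≤ H (3 + k) → ⊥
  losing-4…34 H≡3 4≤H = go (pair₁⊎triple₀ 0) (pair₁⊎triple₀ 1) (pair₁⊎triple₀ 2) (pair₁⊎triple₀ 3)
    where
    label : ∀ {u} → u < 4 → u < H (3 + k)
    label u<4 = <-≤-trans u<4 4≤H
    l₀ = label (s≤s z≤n)
    l₁ = label (s≤s (s≤s z≤n))
    l₂ = label (s≤s (s≤s (s≤s z≤n)))
    l₃ = label (s≤s (s≤s (s≤s (s≤s z≤n))))

    star : ∀ {u v w z} → u < H (3 + k) → v < H (3 + k) → w < H (3 + k) → z < H (3 + k) →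
           u ≢ v → u ≢ w → u ≢ z → v ≢ w → v ≢ z → w ≢ z → Triple 0 u → ⊥
    star {u} {v} {w} {z} lu lv lw lz uv uw uz vw vz wz t with pair₀⊎triple₁ v | pair₀⊎triple₁ w | pair₀⊎triple₁ z
    ... | inj₁ p | inj₁ q | _      = triple-pair-pair 4 4≤H₁ 0<H 3≤H lu lv lw uv uw vw t p q
    ... | inj₁ p | inj₂ _ | inj₁ q = triple-pair-pair 4 4≤H₁ 0<H 3≤H lu lv lz uv uz vz t p q
    ... | inj₂ _ | inj₁ p | inj₁ q = triple-pair-pair 4 4≤H₁ 0<H 3≤H lu lw lz uw uz wz t p q
    ... | inj₂ s | inj₂ r | _      = triple-triple 4 4≤H₁ 1<H 3≤H lv lw vw s r
    ... | inj₂ s | inj₁ _ | inj₂ r = triple-triple 4 4≤H₁ 1<H 3≤H lv lz vz s r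
    ... | inj₁ _ | inj₂ s | inj₂ r = triple-triple 4 4≤H₁ 1<H 3≤H lw lz wz s r

    go : Pair 1 0 ⊎ Triple 0 0 → Pair 1 1 ⊎ Triple 0 1 → Pair 1 2 ⊎ Triple 0 2 → Pair 1 3 ⊎ Triple 0 3 → ⊥
    go (inj₂ t) _ _ _ = star l₀ l₁ l₂ l₃ (λ ()) (λ ()) (λ ()) (λ ()) (λ ()) (λ ()) t
    go _ (inj₂ t) _ _ = star l₁ l₀ l₂ l₃ (λ ()) (λ ()) (λ ()) (λ ()) (λ ()) (λ ()) t
    go _ _ (inj₂ t) _ = star l₂ l₀ l₁ l₃ (λ ()) (λ ()) (λ ()) (λ ()) (λ ()) (λ ()) t
    go _ _ _ (inj₂ t) = star l₃ l₀ l₁ l₂ (λ ()) (λ ()) (λ ()) (λ ()) (λ ()) (λ ()) t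
    go (inj₁ p) (inj₁ q) (inj₁ r) (inj₁ s) =
      pair⁴ 4 4≤H₁ 1<H 3≤H H≡3 l₀ l₁ l₂ l₃ (λ ()) (λ ()) (λ ()) (λ ()) (λ ()) (λ ()) p q r s

losing-2-4 : ∀ {k H} → 2 ≤ H 0 → 4 ≤ H 1 → (∀ i → 3 ≤ H (2 + i)) → 4 ≤ H (2 + k) ⊎ 4 ≤ H (3 + k) → ¬ SequenceWin (3 + k) H
losing-2-4 2≤H₀ 4≤H₁ 3≤H (inj₁ 4≤H) win = losing-4…43 2≤H₀ 4≤H₁ 3≤H win 4≤H
losing-2-4 {k} {H} 2≤H₀ 4≤H₁ 3≤H (inj₂ 4≤H) win with m≤n⇒m<n∨m≡n (3≤H k)
... | inj₁ 4≤H′ = losing-4…43 2≤H₀ 4≤H₁ 3≤H win 4≤H′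
... | inj₂ 3≡H  = losing-4…34 2≤H₀ 4≤H₁ 3≤H win (sym 3≡H) 4≤H

-- Vertices with two colors separated by vertices with at least five

module _ {k : ℕ} {H : ℕ → ℕ} (2≤H : ∀ i → 2 ≤ H i) (win : SequenceWin (3 + k) H) where

  open Cut win

  private
    G = proj₁ win

    0<H : 0 < H 0
    0<H = <-≤-trans (s≤s z≤n) (2≤H 0)

  -- K is the number of labels in use, and j + (j - 1) = K, so that a color of the cut
  -- vertex is guessed for fewer than j of the labels or missed for at least j of them.
  module Labels (K j : ℕ) (2j≡1+K : j + j ≡ suc K) (K≤H : K ≤ H 1) where

    Strong Weak : ℕ → Set₁
    Strong i = ∀ {x Λ} → Many j Λ → Meeting (Reach Λ x i)
    Weak   i = ∀ {x Λ} → Many j Λ → NoThreeDisjoint (Reach Λ x i)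

    Crossing : ℕ → Set₁
    Crossing i = ∀ {x Λ Λ′} → Many j Λ → Many j Λ′ → ∀ r r′ → ¬ Disjoint (Reach Λ x i r) (Reach Λ′ x i r′)

    strong-crossing : ∀ {i} → Strong (suc i) → 3 ≤ H (2 + i) → Crossing (2 + i)
    strong-crossing {i} strong 3≤H jΛ jΛ′ = meeting³-cross (G (2 + i)) (many-≤ 3≤H (many-< _)) (strong jΛ) (strong jΛ′)

    weak-crossing : ∀ {i} → Weak (suc i) → 5 ≤ H (2 + i) → Crossing (2 + i)
    weak-crossing {i} weak 5≤H jΛ jΛ′ = noThree⁵-cross (G (2 + i)) (many-≤ 5≤H (many-< _)) (weak jΛ) (weak jΛ′)

    crossing⇒strong : ∀ {i} → Crossing i → Strong i
    crossing⇒strong crossing jΛ = crossing jΛ jΛ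

    strong-step : ∀ {i} → Strong (suc i) → Weak (2 + i)
    strong-step {i} strong jΛ = meeting² (G (2 + i)) (many-≤ (2≤H (2 + i)) (many-< _)) (strong jΛ)

    weak-step : ∀ {i} → Weak (suc i) → 3 ≤ H (2 + i) → Weak (2 + i)
    weak-step {i} weak 3≤H jΛ = noThree³ (G (2 + i)) (many-≤ 3≤H (many-< _)) (weak jΛ)

    Bad : ℕ → ℕ → Set
    Bad x u = length (Guessed K x u) + j ≤ K

    bad⇒many : ∀ {x u} → Bad x u → Many j (Missed K x u)
    bad⇒many {x} {u} = many-missed K x u

    -- Otherwise each of the two colors would be guessed for at least `j` labels, `K + 1` in all.
    bad₀⊎bad₁ : ∀ u → Bad 0 u ⊎ Bad 1 u
    bad₀⊎bad₁ u with length (Guessed K 0 u) + j ≤? K | length (Guessed K 1 u) + j ≤? K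
    ... | yes p | _     = inj₁ p
    ... | no  _ | yes q = inj₂ q
    ... | no  p | no  q = contradiction
      (≤-trans (+-mono-≤ (≰⇒> p) (≰⇒> q)) (≤-trans (≤-reflexive
        (trans (solve 3 (λ a b c → (a :+ c) :+ (b :+ c) := (a :+ b) :+ (c :+ c)) refl L₀ L₁ j) (cong (L₀ + L₁ +_) 2j≡1+K)))
        (+-monoˡ-≤ (suc K) (hits₂ (λ ℓ → G 0 u ℓ) K))))
      (<⇒≱ (+-monoˡ-< (suc K) ≤-refl))
      where
      open +-*-Solver
      L₀ = length (Guessed K 0 u)
      L₁ = length (Guessed K 1 u)

    -- Two of three `u` are bad for the same `x`, and their walks still meet at the vertex before
    -- the last.
    losing-crossing : Crossing (2 + k) → 3 ≤ H (3 + k) → ⊥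
    losing-crossing crossing 3≤H = go (bad₀⊎bad₁ 0) (bad₀⊎bad₁ 1) (bad₀⊎bad₁ 2)
      where
      label : ∀ {u} → u < 3 → u < H (3 + k)
      label u<3 = <-≤-trans u<3 3≤H
      l₀ = label (s≤s z≤n)
      l₁ = label (s≤s (s≤s z≤n))
      l₂ = label (s≤s (s≤s (s≤s z≤n)))
      clash : ∀ {x u u′} → x < H 0 → u < H (3 + k) → u′ < H (3 + k) → u ≢ u′ → Bad x u → Bad x u′ → ⊥
      clash {x} {u} {u′} x<H l l′ u≢u′ b b′ = crossing (bad⇒many b) (bad⇒many b′) u u′ (missed-disjoint {K} K≤H x<H l l′ u≢u′)
      go : Bad 0 0 ⊎ Bad 1 0 → Bad 0 1 ⊎ Bad 1 1 → Bad 0 2 ⊎ Bad 1 2 → ⊥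
      go (inj₁ b) (inj₁ c) _        = clash 0<H l₀ l₁ (λ ()) b c
      go (inj₂ b) (inj₂ c) _        = clash (2≤H 0) l₀ l₁ (λ ()) b c
      go (inj₁ b) (inj₂ _) (inj₁ c) = clash 0<H l₀ l₂ (λ ()) b c
      go (inj₂ b) (inj₁ _) (inj₂ c) = clash (2≤H 0) l₀ l₂ (λ ()) b c
      go (inj₁ _) (inj₂ b) (inj₂ c) = clash (2≤H 0) l₁ l₂ (λ ()) b c
      go (inj₂ _) (inj₁ b) (inj₁ c) = clash 0<H l₁ l₂ (λ ()) b c

    -- Three of five `u` are bad for the same `x`; their disjoint nonempty sets do not fit into two
    -- colors.
    losing-2-5 : Weak (2 + k) → H (2 + k) ≡ 2 → 5 ≤ H (3 + k) → ⊥
    losing-2-5 weak H≡2 5≤H = five-in-two {K₁ = Bad 0} {Bad 1} (many-< 5) (three-bad 0<H) (three-bad (2≤H 0))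
      (λ u _ ¬b₀ ¬b₁ → [ ¬b₀ , ¬b₁ ]′ (bad₀⊎bad₁ u))
      where
      three-bad : ∀ {x} → x < H 0 → AtMostTwo (_< 5) (Bad x)
      three-bad {x} x<H u₁<5 u₂<5 u₃<5 1≢2 1≢3 2≢3 (b₁ , b₂ , b₃) =
        alive-one (weak (bad⇒many b₁)) λ (p₁ , P₁) → alive-one (weak (bad⇒many b₂)) λ (p₂ , P₂) →
        alive-one (weak (bad⇒many b₃)) λ (p₃ , P₃) →
        contradiction (subst (3 ≤_) H≡2 (many-<⇒≤
          (more (Alive.color-ok P₁)
          (more (Alive.color-ok P₂ , λ { refl → missed-disjoint {K} K≤H x<H l₁ l₂ 1≢2 p₁ P₁ P₂ })
          (more ((Alive.color-ok P₃ , λ { refl → missed-disjoint {K} K≤H x<H l₁ l₃ 1≢3 p₁ P₁ P₃ }) ,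
                 λ { refl → missed-disjoint {K} K≤H x<H l₂ l₃ 2≢3 p₂ P₂ P₃ })
          done))))) λ { (s≤s (s≤s ())) }
        where
        l₁ = <-≤-trans u₁<5 5≤H
        l₂ = <-≤-trans u₂<5 5≤H
        l₃ = <-≤-trans u₃<5 5≤H

  -- The index `4 + k` is the cut vertex again, so both ends may be the same vertex.
  Separated : Set
  Separated = ∀ {i j} → i < j → j ≤ 4 + k → H i ≡ 2 → H j ≡ 2 → ∃[ l ] i < l × l < j × 5 ≤ H l

  2⊎≥3 : ∀ i → H i ≡ 2 ⊎ 3 ≤ H i
  2⊎≥3 i with m≤n⇒m<n∨m≡n (2≤H i)
  ... | inj₁ 3≤Hi = inj₂ 3≤Hi
  ... | inj₂ 2≡Hi = inj₁ (sym 2≡Hi)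

  -- Accompanies the weak state: separation then rules out another vertex with two colors before the
  -- strong state is restored.
  Since2 : ℕ → Set
  Since2 i = ∃[ j ] j ≤ i × H j ≡ 2 × (∀ {l} → j < l → l ≤ i → H l < 5)

  since2-step : ∀ {i} → Since2 i → H (suc i) < 5 → Since2 (suc i)
  since2-step {i} (j , j≤i , Hj≡2 , small) H<5 = j , m≤n⇒m≤1+n j≤i , Hj≡2 , small′
    where
    small′ : ∀ {l} → j < l → l ≤ suc i → H l < 5
    small′ j<l l≤1+i with m≤n⇒m<n∨m≡n l≤1+i
    ... | inj₁ (s≤s l≤i) = small j<l l≤i
    ... | inj₂ refl      = H<5

  since2⇒≢2 : Separated → ∀ {i} → suc i ≤ 4 + k → Since2 i → H (suc i) ≢ 2
  since2⇒≢2 separated 1+i≤n (j , j≤i , Hj≡2 , small) H≡2 with separated (s≤s j≤i) 1+i≤n Hj≡2 H≡2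
  ... | l , j<l , s≤s l≤i , 5≤H = <⇒≱ (small j<l l≤i) 5≤H

  since2-2 : ∀ {i} → H i ≡ 2 → Since2 i
  since2-2 {i} H≡2 = i , ≤-refl , H≡2 , λ i<l l≤i → contradiction l≤i (<⇒≱ i<l)

  start-meeting : ∀ {x : ℕ} → Meeting (λ (q : ℕ) p → p ≡ x)
  start-meeting q q′ disjoint = disjoint _ refl refl

  module _ (separated : Separated) (Hₙ≡2 : H (4 + k) ≡ 2) (3≤Hₘ : 3 ≤ H (3 + k)) (Hₘ<5 : H (3 + k) < 5)
           {K j : ℕ} (2j≡1+K : j + j ≡ suc K) (K≤H : K ≤ H 1) where

    open Labels K j 2j≡1+K K≤H

    Status : ℕ → Set₁
    Status i = Strong i ⊎ (Weak i × Since2 i)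

    status : Status 1 → ∀ i → suc i ≤ 3 + k → Status (suc i)
    status start zero    _ = start
    status start (suc i) 2+i≤m with status start i (<⇒≤ 2+i≤m) | 2⊎≥3 (2 + i)
    ... | inj₁ strong       | inj₁ H≡2 = inj₂ (strong-step strong , since2-2 H≡2)
    ... | inj₁ strong       | inj₂ 3≤H = inj₁ (crossing⇒strong (strong-crossing strong 3≤H))
    ... | inj₂ (weak , two) | inj₁ H≡2 = contradiction H≡2 (since2⇒≢2 separated (m≤n⇒m≤1+n 2+i≤m) two)
    ... | inj₂ (weak , two) | inj₂ 3≤H with H (2 + i) <? 5
    ...   | yes H<5 = inj₂ (weak-step weak 3≤H , since2-step two H<5)
    ...   | no  H≮5 = inj₁ (crossing⇒strong (weak-crossing weak (≮⇒≥ H≮5)))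

    losing-from-status : Status 1 → ⊥
    losing-from-status start = finish (status start k (s≤s (m≤n+m k 2))) (2⊎≥3 (2 + k))
      where
      finish : Status (suc k) → H (2 + k) ≡ 2 ⊎ 3 ≤ H (2 + k) → ⊥
      finish _                   (inj₁ H≡2) = since2⇒≢2 separated ≤-refl (since2-step (since2-2 H≡2) Hₘ<5) Hₙ≡2
      finish (inj₁ strong)       (inj₂ 3≤H) = losing-crossing (strong-crossing strong 3≤H) 3≤Hₘ
      finish (inj₂ (weak , two)) (inj₂ 3≤H) with H (2 + k) <? 5
      ... | yes H<5 = since2⇒≢2 separated ≤-refl (since2-step (since2-step two H<5) Hₘ<5) Hₙ≡2
      ... | no  H≮5 = losing-crossing (weak-crossing weak (≮⇒≥ H≮5)) 3≤Hₘ

  -- With at least five colors at vertex 1, three of five labels start in the strong state. With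
  -- fewer, two of three labels start in the weak state, and the cut itself is the vertex with two
  -- colors met last. Either way separation restores the state by the vertex before the last,
  -- because the last vertex cannot do it.
  losing-last-34 : Separated → H 0 ≡ 2 → H (4 + k) ≡ 2 → 3 ≤ H 1 → 3 ≤ H (3 + k) → H (3 + k) < 5 → ⊥
  losing-last-34 separated H₀≡2 Hₙ≡2 3≤H₁ 3≤Hₘ Hₘ<5 with H 1 <? 5
  ... | no  H₁≮5 = losing-from-status separated Hₙ≡2 3≤Hₘ Hₘ<5 {5} {3} refl (≮⇒≥ H₁≮5)
    (inj₁ λ 3Λ → meeting³-cross (G 1) 3Λ start-meeting start-meeting)
  ... | yes H₁<5 = losing-from-status separated Hₙ≡2 3≤Hₘ Hₘ<5 {3} {2} refl 3≤H₁
    (inj₂ ((λ 2Λ → meeting² (G 1) 2Λ start-meeting) , since2-step (since2-2 H₀≡2) H₁<5))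

  -- The state is weak only at vertices with two colors, since the next vertex repairs it at once.
  -- Vertex 1 follows the cut, so five labels are available.
  losing-2-between-5s : (∀ i → i < 3 + k → H i ≡ 2 → 5 ≤ H (suc i)) →
                        H 0 ≡ 2 → 5 ≤ H (3 + k) → ⊥
  losing-2-between-5s after H₀≡2 5≤Hₘ = finish (2⊎≥3 (2 + k))
    where
    5≤H₁ : 5 ≤ H 1
    5≤H₁ = after 0 (s≤s z≤n) H₀≡2
    open Labels 5 3 refl 5≤H₁

    parity : ∀ i → i ≤ 1 + k → (H (suc i) ≡ 2 × Weak (suc i)) ⊎ Strong (suc i)
    parity zero    _ = inj₂ λ 3Λ → meeting³-cross (G 1) 3Λ start-meeting start-meeting
    parity (suc i) i<1+k with parity i (<⇒≤ i<1+k) | 2⊎≥3 (2 + i)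
    ... | inj₁ (H≡2 , weak) | _        = inj₂ (crossing⇒strong (weak-crossing weak (after (suc i) (s≤s (m≤n⇒m≤1+n i<1+k)) H≡2)))
    ... | inj₂ strong       | inj₁ H≡2 = inj₁ (H≡2 , strong-step strong)
    ... | inj₂ strong       | inj₂ 3≤H = inj₂ (crossing⇒strong (strong-crossing strong 3≤H))

    finish : H (2 + k) ≡ 2 ⊎ 3 ≤ H (2 + k) → ⊥
    finish (inj₁ H≡2) with parity (suc k) ≤-refl
    ... | inj₁ (_ , weak) = losing-2-5 weak H≡2 5≤Hₘ
    ... | inj₂ strong     = losing-2-5 (λ {x} {Λ} 3Λ q₁ q₂ _ d _ _ → strong {x} {Λ} 3Λ q₁ q₂ d) H≡2 5≤Hₘ
    finish (inj₂ 3≤H) with parity k (n≤1+n k)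
    ... | inj₁ (H≡2 , weak) = losing-crossing (weak-crossing weak (after (suc k) (s≤s (n≤1+n (suc k))) H≡2)) (≤-trans (s≤s (s≤s (s≤s z≤n))) 5≤Hₘ)
    ... | inj₂ strong       = losing-crossing (strong-crossing strong 3≤H) (≤-trans (s≤s (s≤s (s≤s z≤n))) 5≤Hₘ)

-- Cycles with three colors at every vertex

0<3 : 0 < 3
0<3 = s≤s z≤n
1<3 : 1 < 3
1<3 = s≤s (s≤s z≤n)
2<3 : 2 < 3
2<3 = s≤s (s≤s (s≤s z≤n))

hits₃ : ∀ f k → length (hits f 0 k) + (length (hits f 1 k) + length (hits f 2 k)) ≤ k
hits₃ f zero    = z≤n
hits₃ f (suc k) with f k | hits₃ f k
... | 0 | ih = s≤s ih
... | 1 | ih = subst (_≤ suc k) (sym (+-suc (length (hits f 0 k)) _)) (s≤s ih)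
... | 2 | ih = subst (_≤ suc k) (sym (trans (cong (length (hits f 0 k) +_) (+-suc (length (hits f 1 k)) _))
                 (+-suc (length (hits f 0 k)) _))) (s≤s ih)
... | suc (suc (suc _)) | ih = m≤n⇒m≤1+n ih

module _ {f : ℕ → ℕ} {x : ℕ} where

  hits-≤ : ∀ k → length (hits f x k) ≤ k
  hits-≤ zero    = z≤n
  hits-≤ (suc k) with f k ≟ x
  ... | yes _ = s≤s (hits-≤ k)
  ... | no  _ = m≤n⇒m≤1+n (hits-≤ k)

  hit⇒1≤ : ∀ k {ℓ} → ℓ < k → f ℓ ≡ x → 1 ≤ length (hits f x k)
  hit⇒1≤ (suc k) ℓ<1+k fℓ≡x with f k ≟ x | m≤n⇒m<n∨m≡n ℓ<1+k
  ... | yes _    | _              = s≤s z≤n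
  ... | no  _    | inj₁ (s≤s ℓ<k) = hit⇒1≤ k ℓ<k fℓ≡x
  ... | no  fk≢x | inj₂ refl      = contradiction fℓ≡x fk≢x

  1≤⇒hit : ∀ k → 1 ≤ length (hits f x k) → ∃[ ℓ ] ℓ < k × f ℓ ≡ x
  1≤⇒hit (suc k) 1≤L with f k ≟ x
  ... | yes fk≡x = k , ≤-refl , fk≡x
  ... | no  _    = let ℓ , ℓ<k , fℓ≡x = 1≤⇒hit k 1≤L in ℓ , m<n⇒m<1+n ℓ<k , fℓ≡x

  miss⇒< : ∀ k {ℓ} → ℓ < k → f ℓ ≢ x → length (hits f x k) < k
  miss⇒< (suc k) ℓ<1+k fℓ≢x with f k ≟ x | m≤n⇒m<n∨m≡n ℓ<1+k
  ... | no  _    | _              = s≤s (hits-≤ k)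
  ... | yes _    | inj₁ (s≤s ℓ<k) = s≤s (miss⇒< k ℓ<k fℓ≢x)
  ... | yes fk≡x | inj₂ refl      = contradiction fk≡x fℓ≢x

  hit-hit⇒2≤ : ∀ k {ℓ ℓ′} → ℓ ≢ ℓ′ → ℓ < k → ℓ′ < k → f ℓ ≡ x → f ℓ′ ≡ x → 2 ≤ length (hits f x k)
  hit-hit⇒2≤ (suc k) {ℓ} {ℓ′} ℓ≢ℓ′ ℓ<1+k ℓ′<1+k fℓ≡x fℓ′≡x with f k ≟ x | m≤n⇒m<n∨m≡n ℓ<1+k | m≤n⇒m<n∨m≡n ℓ′<1+k
  ... | _        | inj₂ refl      | inj₂ refl       = contradiction refl ℓ≢ℓ′
  ... | yes _    | inj₁ (s≤s ℓ<k) | _               = s≤s (hit⇒1≤ k ℓ<k fℓ≡x)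
  ... | yes _    | inj₂ _         | inj₁ (s≤s ℓ′<k) = s≤s (hit⇒1≤ k ℓ′<k fℓ′≡x)
  ... | no  _    | inj₁ (s≤s ℓ<k) | inj₁ (s≤s ℓ′<k) = hit-hit⇒2≤ k ℓ≢ℓ′ ℓ<k ℓ′<k fℓ≡x fℓ′≡x
  ... | no  fk≢x | inj₂ refl      | inj₁ _          = contradiction fℓ≡x fk≢x
  ... | no  fk≢x | inj₁ _         | inj₂ refl       = contradiction fℓ′≡x fk≢x

  miss-miss⇒2+≤ : ∀ k {ℓ ℓ′} → ℓ ≢ ℓ′ → ℓ < k → ℓ′ < k → f ℓ ≢ x → f ℓ′ ≢ x → 2 + length (hits f x k) ≤ k
  miss-miss⇒2+≤ (suc k) {ℓ} {ℓ′} ℓ≢ℓ′ ℓ<1+k ℓ′<1+k fℓ≢x fℓ′≢x with f k ≟ x | m≤n⇒m<n∨m≡n ℓ<1+k | m≤n⇒m<n∨m≡n ℓ′<1+k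
  ... | _        | inj₂ refl      | inj₂ refl       = contradiction refl ℓ≢ℓ′
  ... | no  _    | inj₁ (s≤s ℓ<k) | _               = s≤s (miss⇒< k ℓ<k fℓ≢x)
  ... | no  _    | inj₂ _         | inj₁ (s≤s ℓ′<k) = s≤s (miss⇒< k ℓ′<k fℓ′≢x)
  ... | yes _    | inj₁ (s≤s ℓ<k) | inj₁ (s≤s ℓ′<k) = s≤s (miss-miss⇒2+≤ k ℓ≢ℓ′ ℓ<k ℓ′<k fℓ≢x fℓ′≢x)
  ... | yes fk≡x | inj₂ refl      | inj₁ _          = contradiction fk≡x fℓ≢x
  ... | yes fk≡x | inj₁ _         | inj₂ refl       = contradiction fk≡x fℓ′≢x

  0≡⇒miss : ∀ k {ℓ} → length (hits f x k) ≡ 0 → ℓ < k → f ℓ ≢ x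
  0≡⇒miss k L≡0 ℓ<k fℓ≡x = contradiction (subst (1 ≤_) L≡0 (hit⇒1≤ k ℓ<k fℓ≡x)) λ ()

Σ₃ : (ℕ → ℕ) → ℕ
Σ₃ f = f 0 + (f 1 + f 2)

∀<3 : ∀ {P : ℕ → Set} → P 0 → P 1 → P 2 → ∀ {i} → i < 3 → P i
∀<3 p₀ p₁ p₂ {0} _ = p₀
∀<3 p₀ p₁ p₂ {1} _ = p₁
∀<3 p₀ p₁ p₂ {2} _ = p₂
∀<3 p₀ p₁ p₂ {suc (suc (suc _))} (s≤s (s≤s (s≤s ())))

Σ₃-mono : ∀ {f g} → (∀ {i} → i < 3 → f i ≤ g i) → Σ₃ f ≤ Σ₃ g
Σ₃-mono f≤g = +-mono-≤ (f≤g 0<3) (+-mono-≤ (f≤g 1<3) (f≤g 2<3))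

tight : ∀ {a a′ b b′} → a ≤ a′ → b ≤ b′ → a′ + b′ ≤ a + b → a ≡ a′ × b ≡ b′
tight {a} {a′} {b} {b′} a≤a′ b≤b′ sum = ≤-antisym a≤a′ a′≤a , ≤-antisym b≤b′ b′≤b
  where
  a′≤a = +-cancelʳ-≤ b′ a′ a (≤-trans sum (+-monoʳ-≤ a b≤b′))
  b′≤b = +-cancelˡ-≤ a′ b′ b (≤-trans sum (+-monoˡ-≤ b a≤a′))

Σ₃-tight : ∀ {f g} → (∀ {i} → i < 3 → f i ≤ g i) → Σ₃ g ≤ Σ₃ f → ∀ {i} → i < 3 → f i ≡ g i
Σ₃-tight {f} {g} f≤g sum = ∀<3 {λ i → f i ≡ g i} (proj₁ t) (proj₁ t′) (proj₂ t′)
  where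
  t  = tight (f≤g 0<3) (+-mono-≤ (f≤g 1<3) (f≤g 2<3)) sum
  t′ = tight (f≤g 1<3) (f≤g 2<3) (≤-reflexive (sym (proj₂ t)))

Σ₃-swap : ∀ (f : ℕ → ℕ → ℕ) → Σ₃ (λ i → Σ₃ (λ j → f i j)) ≡ Σ₃ (λ j → Σ₃ (λ i → f i j))
Σ₃-swap f = solve 9 (λ a b c d e g h i j →
    (a :+ (b :+ c)) :+ ((d :+ (e :+ g)) :+ (h :+ (i :+ j))) :=
    (a :+ (d :+ h)) :+ ((b :+ (e :+ i)) :+ (c :+ (g :+ j)))) refl
  (f 0 0) (f 0 1) (f 0 2) (f 1 0) (f 1 1) (f 1 2) (f 2 0) (f 2 1) (f 2 2)
  where open +-*-Solver

Σ₃-+ : ∀ f g → Σ₃ (λ i → f i + g i) ≡ Σ₃ f + Σ₃ g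
Σ₃-+ f g = solve 6 (λ a b c d e h → (a :+ d) :+ ((b :+ e) :+ (c :+ h)) := (a :+ (b :+ c)) :+ (d :+ (e :+ h))) refl
  (f 0) (f 1) (f 2) (g 0) (g 1) (g 2)
  where open +-*-Solver

module _ {k : ℕ} (win : SequenceWin (3 + k) (λ _ → 3)) where

  private
    G    = proj₁ win
    wins = proj₂ win

  open Cut win

  -- The walk stops one vertex earlier than for a cut vertex: the guesses at both ends of the edge
  -- between the last vertex and vertex 0 are left open, and one of them must be right.
  edge-guessed : ∀ {Λ p q s} → (∀ {t} → Λ t → t < 3) → p < 3 → q < 3 → Reach Λ q (2 + k) p s →
                 ∃[ t ] Λ t × (G (3 + k) s q ≡ p ⊎ G 0 p t ≡ q)
  edge-guessed {Λ} {p} {q} {s} Λ<3 p<3 q<3 reach = conclude (wins c in-range (trans new (sym (trans (old z≤n) start))))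
    where
    open Trail (trail (2 + k) reach)
    c : ℕ → ℕ
    c j with j ≤? 3 + k
    ... | yes _ = color j
    ... | no  _ = q
    old : ∀ {j} → j ≤ 3 + k → c j ≡ color j
    old {j} j≤m with j ≤? 3 + k
    ... | yes _   = refl
    ... | no  j≰m = contradiction j≤m j≰m
    new : c (4 + k) ≡ q
    new with 4 + k ≤? 3 + k
    ... | yes n≤m = contradiction n≤m (<⇒≱ ≤-refl)
    ... | no  _   = refl
    color<3 : ∀ i → i ≤ 3 + k → color i < 3
    color<3 zero          _ = subst (_< 3) (sym start) q<3
    color<3 (suc zero)    _ = Λ<3 (bounded 0 (s≤s z≤n))
    color<3 (suc (suc i)) i≤m with m≤n⇒m<n∨m≡n i≤m
    ... | inj₁ (s≤s i<m) = bounded (suc i) i<m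
    ... | inj₂ refl      = subst (_< 3) (sym look) p<3
    in-range : ∀ i → i < 4 + k → c i < 3
    in-range i (s≤s i≤m) = subst (_< 3) (sym (old i≤m)) (color<3 i i≤m)
    conclude : (∃[ i ] i < 4 + k × G i (predecessor (3 + k) c i) (c (suc i)) ≡ c i) →
               ∃[ t ] Λ t × (G (3 + k) s q ≡ p ⊎ G 0 p t ≡ q)
    conclude (zero , _ , eq) = color 1 , bounded 0 (s≤s z≤n) , inj₂
      (trans (cong₂ (G 0) (sym (trans (old ≤-refl) look)) (sym (old (s≤s z≤n)))) (trans eq (trans (old z≤n) start)))
    conclude (suc i , s≤s i<m , eq) with m≤n⇒m<n∨m≡n i<m
    ... | inj₁ 1+i<m = contradiction
      (trans (sym (cong₂ (G (suc i)) (old (<⇒≤ i<m)) (old 1+i<m))) (trans eq (old i<m)))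
      (mistaken i (s≤s⁻¹ 1+i<m))
    ... | inj₂ refl  = color 1 , bounded 0 (s≤s z≤n) , inj₁
      (trans (cong₂ (G (3 + k)) (sym (trans (old (n≤1+n (2 + k))) end)) (sym new)) (trans eq (trans (old ≤-refl) look)))

  three≤3 : ℕ → 3 ≤ 3
  three≤3 _ = ≤-refl

  -- Let the total be at most one. If the last vertex never guesses `p`, two labels keep vertex 0
  -- wrong, and the weak state still reaches some `s`. If vertex 0 never guesses `q`, all three
  -- labels may be used, and the strong state loses at most one of the two `s` that keep the last
  -- vertex wrong.
  edge-≥2 : ∀ {p q} → p < 3 → q < 3 →
            2 ≤ length (hits (λ s → G (3 + k) s q) p 3) + length (hits (λ t → G 0 p t) q 3)
  edge-≥2 {p} {q} p<3 q<3 = ≮⇒≥ λ sum<2 → go left right refl refl (s≤s⁻¹ sum<2)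
    where
    left  = hits (λ s → G (3 + k) s q) p 3
    right = hits (λ t → G 0 p t) q 3

    go : ∀ l r → l ≡ left → r ≡ right → length l + length r ≤ 1 → ⊥
    go [] r l≡ r≡ r≤1 =
      alive-one (reach-noThree three≤3 {Λ} (many-Without r (many-≤ (+-monoˡ-≤ 2 r≤1) (many-< 3))) (suc k)) λ (s , reach) →
      case edge-guessed (Without-⊆ r) p<3 q<3 reach of λ where
        (t , _ , inj₁ eq) → 0≡⇒miss {f = λ s → G (3 + k) s q} 3 (cong length (sym l≡)) (Alive.color-ok reach) eq
        (t , Λt , inj₂ eq) → without-hits {f = λ t → G 0 p t} 3 3 (Without-⊆ r Λt) (subst (λ es → Without (_< 3) es t) r≡ Λt) eq
      where
      Λ = Without (_< 3) r
    go (e ∷ []) [] l≡ r≡ _ with many-Without {2} {_< 3} (e ∷ []) (many-< 3)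
    ... | more Bs (more (Bs′ , s≢s′) done) =
      meeting⇒≤1-lost (reach-meeting three≤3 (many-< 3) (suc k)) (proj₁ Bs) (proj₁ Bs′) s≢s′ (lost Bs) (lost Bs′)
      where
      lost : ∀ {s} → Without (_< 3) (e ∷ []) s → ¬ Reach (_< 3) q (2 + k) p s
      lost {s} Bs reach with edge-guessed id p<3 q<3 reach
      ... | t , _ , inj₁ eq   = without-hits {f = λ s → G (3 + k) s q} 3 3 (proj₁ Bs) (subst (λ es → Without (_< 3) es s) l≡ Bs) eq
      ... | t , t<3 , inj₂ eq = 0≡⇒miss {f = λ t → G 0 p t} 3 (cong length (sym r≡)) t<3 eq
    go (e ∷ []) (_ ∷ _) l≡ r≡ (s≤s ())
    go (e ∷ _ ∷ _) r l≡ r≡ (s≤s ())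

  -- If the guess after x is a bijection, every single label survives to the end; so a
  -- color y which the last vertex never guesses next to x would give three walks
  -- differing only in the label.
  bijective-label : ∀ {x y} → x < 3 → y < 3 →
                    (∀ {ℓ} → ℓ < 3 → length (hits (λ r → G 1 x r) ℓ 3) ≡ 1) →
                    (∀ {p} → p < 3 → G (3 + k) p x ≢ y) → ∀ {ℓ} → ℓ < 3 → ¬ ¬ (G 0 y ℓ ≡ x)
  bijective-label {x} {y} x<3 y<3 ones never {ℓ} ℓ<3 wrong =
    alive-one (noThree k) λ (p , P) →
    case closed-trail-guessed (λ { refl → ℓ<3 }) x<3 (alive y<3 P (never (Alive.color-ok P))) of λ where
      (_ , refl , eq) → wrong eq
    where
    -- The two colors of vertex 2 next to which vertex 1 does not guess its color `ℓ`; they take the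
    -- part of two labels.
    B : ℕ → Set
    B = Without (_< 3) (hits (λ r → G 1 x r) ℓ 3)
    many-B : Many 2 B
    many-B = many-Without (hits (λ r → G 1 x r) ℓ 3) (subst (λ j → Many (j + 2) (_< 3)) (sym (ones ℓ<3)) (many-< 3))
    widen : ∀ {r q} → Alive B (λ _ p → p ≡ ℓ) (λ p → G 2 p r) q → Reach (_≡ ℓ) x 2 r q
    widen (alive Bq refl wrong) =
      alive (Without-⊆ (hits (λ r → G 1 x r) ℓ 3) Bq)
        (alive refl refl (without-hits {f = λ r → G 1 x r} 3 3 (Without-⊆ (hits (λ r → G 1 x r) ℓ 3) Bq) Bq)) wrong
    noThree : ∀ i → NoThreeDisjoint (Reach (_≡ ℓ) x (2 + i))
    noThree zero r₁ r₂ r₃ d₁₂ d₁₃ d₂₃ =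
      meeting² (G 2) many-B (λ _ _ disjoint → disjoint ℓ refl refl) r₁ r₂ r₃
        (λ q x y → d₁₂ q (widen x) (widen y)) (λ q x y → d₁₃ q (widen x) (widen y)) (λ q x y → d₂₃ q (widen x) (widen y))
    noThree (suc i) = noThree³ (G (3 + i)) (many-< 3) (noThree i)

-- Arithmetic modulo three and Latin squares

rot : Fin 3 → Fin 3
rot zero             = suc zero
rot (suc zero)       = suc (suc zero)
rot (suc (suc zero)) = zero

infixl 6 _⊕_ _⊝_

_⊕_ : Fin 3 → Fin 3 → Fin 3
zero           ⊕ j = j
suc zero       ⊕ j = rot j
suc (suc zero) ⊕ j = rot (rot j)

⊖_ : Fin 3 → Fin 3
⊖ zero           = zero
⊖ suc zero       = suc (suc zero)
⊖ suc (suc zero) = suc zero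

_⊝_ : Fin 3 → Fin 3 → Fin 3
i ⊝ j = i ⊕ (⊖ j)

abstract

  ⊕-identityʳ : ∀ i → i ⊕ zero ≡ i
  ⊕-identityʳ = from-yes (all? λ i → i ⊕ zero Fin.≟ i)

  ⊖-involutive : ∀ i → ⊖ (⊖ i) ≡ i
  ⊖-involutive = from-yes (all? λ i → ⊖ (⊖ i) Fin.≟ i)

  i⊝[i⊝j]≡j : ∀ i j → i ⊝ (i ⊝ j) ≡ j
  i⊝[i⊝j]≡j = from-yes (all? λ i → all? λ j → i ⊝ (i ⊝ j) Fin.≟ j)

  ⊖i⊕i≡0 : ∀ i → (⊖ i) ⊕ i ≡ zero
  ⊖i⊕i≡0 = from-yes (all? λ i → (⊖ i) ⊕ i Fin.≟ zero)

  i⊕[j⊝k]⊕k≡i⊕j : ∀ i j k → i ⊕ (j ⊝ k) ⊕ k ≡ i ⊕ j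
  i⊕[j⊝k]⊕k≡i⊕j = from-yes (all? λ i → all? λ j → all? λ k → i ⊕ (j ⊝ k) ⊕ k Fin.≟ i ⊕ j)

  i⊝j⊝j⊝j≡i : ∀ i j → i ⊝ j ⊝ j ⊝ j ≡ i
  i⊝j⊝j⊝j≡i = from-yes (all? λ i → all? λ j → i ⊝ j ⊝ j ⊝ j Fin.≟ i)

  two-steps : ∀ j → zero ⊝ j ⊝ j ≡ j
  two-steps = from-yes (all? λ j → zero ⊝ j ⊝ j Fin.≟ j)

Distinct : Fin 3 → Fin 3 → Fin 3 → Set
Distinct a b c = ¬ a ≡ b × ¬ a ≡ c × ¬ b ≡ c

distinct? : ∀ a b c → Dec (Distinct a b c)
distinct? a b c = ¬? (a Fin.≟ b) ×-dec ¬? (a Fin.≟ c) ×-dec ¬? (b Fin.≟ c)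

abstract

  distinct-covers : ∀ a b c → Distinct a b c → ∀ i → a ≡ i ⊎ b ≡ i ⊎ c ≡ i
  distinct-covers = from-yes (all? λ a → all? λ b → all? λ c →
    distinct? a b c →-dec all? λ i → (a Fin.≟ i) ⊎-dec (b Fin.≟ i) ⊎-dec (c Fin.≟ i))

  -- The six permutations of the residues are `i ↦ i + a` and `i ↦ a - i`.
  translation-or-reflection : ∀ a b c → Distinct a b c →
    (b ≡ suc zero ⊕ a × c ≡ suc (suc zero) ⊕ a) ⊎ (b ≡ a ⊝ suc zero × c ≡ a ⊝ suc (suc zero))
  translation-or-reflection = from-yes (all? λ a → all? λ b → all? λ c → distinct? a b c →-dec
    (((b Fin.≟ suc zero ⊕ a) ×-dec (c Fin.≟ suc (suc zero) ⊕ a)) ⊎-dec ((b Fin.≟ a ⊝ suc zero) ×-dec (c Fin.≟ a ⊝ suc (suc zero)))))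

-- The reflection `i ↦ a - i` fixes `2 a` modulo 3.
derangement⇒translation : ∀ a b c → Distinct a b c → ¬ zero ≡ a → ¬ suc zero ≡ b → ¬ suc (suc zero) ≡ c →
  b ≡ suc zero ⊕ a × c ≡ suc (suc zero) ⊕ a
derangement⇒translation a b c distinct a≢0 b≢1 c≢2 with translation-or-reflection a b c distinct
... | inj₁ translation = translation
derangement⇒translation zero             b c _ a≢0 b≢1 c≢2 | inj₂ _         = contradiction refl a≢0
derangement⇒translation (suc zero)       b c _ a≢0 b≢1 c≢2 | inj₂ (_ , eq)  = contradiction (sym eq) c≢2
derangement⇒translation (suc (suc zero)) b c _ a≢0 b≢1 c≢2 | inj₂ (eq , _)  = contradiction (sym eq) b≢1

private
  0₃ 1₃ 2₃ : Fin 3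
  0₃ = zero
  1₃ = suc zero
  2₃ = suc (suc zero)

∀₃ : ∀ {P : Fin 3 → Set} → P 0₃ → P 1₃ → P 2₃ → ∀ i → P i
∀₃ p₀ p₁ p₂ zero             = p₀
∀₃ p₀ p₁ p₂ (suc zero)       = p₁
∀₃ p₀ p₁ p₂ (suc (suc zero)) = p₂

Injective₃ : (Fin 3 → Fin 3) → Set
Injective₃ f = ∀ {i j} → f i ≡ f j → i ≡ j

injective⇒distinct : ∀ {f} → Injective₃ f → Distinct (f 0₃) (f 1₃) (f 2₃)
injective⇒distinct inj = (λ eq → contradiction (inj eq) λ ()) , (λ eq → contradiction (inj eq) λ ()) ,
                         (λ eq → contradiction (inj eq) λ ())

abstract

  injective⇒surjective : ∀ f → Injective₃ f → ∀ i → ∃[ j ] f j ≡ i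
  injective⇒surjective f inj i with distinct-covers (f 0₃) (f 1₃) (f 2₃) (injective⇒distinct inj) i
  ... | inj₁ eq        = 0₃ , eq
  ... | inj₂ (inj₁ eq) = 1₃ , eq
  ... | inj₂ (inj₂ eq) = 2₃ , eq

retreat : Fin 3 → Fin 3 → ℕ → Fin 3
retreat i k zero    = i
retreat i k (suc l) = retreat i k l ⊝ k

retreat-periodic : ∀ i k q → retreat i k (q * 3) ≡ i
retreat-periodic i k zero    = refl
retreat-periodic i k (suc q) = trans (i⊝j⊝j⊝j≡i (retreat i k (q * 3)) k) (retreat-periodic i k q)

retreat-surjective : ∀ n → ¬ 3 ∣ n → ∀ t → ∃[ k ] retreat zero k n ≡ t
retreat-surjective 0 3∤n t = contradiction (3 ∣0) 3∤n
retreat-surjective 1 3∤n t = ⊖ t , ⊖-involutive t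
retreat-surjective 2 3∤n t = t , two-steps t
retreat-surjective (suc (suc (suc n))) 3∤n t with retreat-surjective n (λ 3∣n → 3∤n (∣m∣n⇒∣m+n ∣-refl 3∣n)) t
... | k , eq = k , trans (i⊝j⊝j⊝j≡i (retreat zero k n) k) eq

-- Suitable coordinates on the colors of every vertex turn all the squares ρ l into
-- (i , j) ↦ i - j.  The coordinates at the two ends of the cycle differ by a translation,
-- which a constant difference k can compensate when 3 ∤ n.
module _ (ρ : ℕ → Fin 3 → Fin 3 → Fin 3)
         (row-injective    : ∀ l x → Injective₃ (ρ l x))
         (column-injective : ∀ l z → Injective₃ (λ x → ρ l x z))
         (no-coincidence   : ∀ l y w → ¬ (∀ x → ρ l y x ≡ ρ (suc l) x w)) where

  Frame : ℕ → (Fin 3 → Fin 3) → Set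
  Frame l b = ∀ z → ∃[ d ] (∀ i → ρ l (b i) z ≡ i ⊕ d)

  first-frame : ∃[ b ] Frame 0 b
  first-frame = b , frame
    where
    b : Fin 3 → Fin 3
    b i = proj₁ (injective⇒surjective (λ x → ρ 0 x 0₃) (column-injective 0 0₃) i)
    b-correct : ∀ i → ρ 0 (b i) 0₃ ≡ i
    b-correct i = proj₂ (injective⇒surjective (λ x → ρ 0 x 0₃) (column-injective 0 0₃) i)
    b-injective : Injective₃ b
    b-injective {i} {j} eq = trans (sym (b-correct i)) (trans (cong (λ x → ρ 0 x 0₃) eq) (b-correct j))
    frame : Frame 0 b
    -- Column 0 is the identity in these coordinates. Rows are injective, so any other column
    -- differs from it everywhere and is a derangement.
    frame z with z Fin.≟ 0₃
    ... | yes refl = 0₃ , λ i → trans (b-correct i) (sym (⊕-identityʳ i))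
    ... | no  z≢0 with derangement⇒translation
                         (ρ 0 (b 0₃) z) (ρ 0 (b 1₃) z) (ρ 0 (b 2₃) z)
                         (injective⇒distinct {λ i → ρ 0 (b i) z} (λ eq → b-injective (column-injective 0 z eq)))
                         (other 0₃) (other 1₃) (other 2₃)
      where
      other : ∀ i → ¬ i ≡ ρ 0 (b i) z
      other i eq = z≢0 (sym (row-injective 0 (b i) (trans (b-correct i) eq)))
    ...   | e₁ , e₂ = ρ 0 (b 0₃) z , ∀₃ {λ i → ρ 0 (b i) z ≡ i ⊕ ρ 0 (b 0₃) z} refl e₁ e₂

  module NextFrame {l : ℕ} {b : Fin 3 → Fin 3} (frame : Frame l b) where

    b′ : Fin 3 → Fin 3
    b′ j = proj₁ (injective⇒surjective (ρ l (b 0₃)) (row-injective l (b 0₃)) (⊖ j))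

    b′-correct : ∀ j → ρ l (b 0₃) (b′ j) ≡ ⊖ j
    b′-correct j = proj₂ (injective⇒surjective (ρ l (b 0₃)) (row-injective l (b 0₃)) (⊖ j))

    difference : ∀ i j → ρ l (b i) (b′ j) ≡ i ⊝ j
    difference i j with frame (b′ j)
    ... | d , eq = trans (eq i) (cong (i ⊕_) (trans (sym (eq 0₃)) (b′-correct j)))

    b′-injective : Injective₃ b′
    b′-injective {i} {j} eq = trans (sym (⊖-involutive i)) (trans (cong ⊖_
      (trans (sym (b′-correct i)) (trans (cong (ρ l (b 0₃)) eq) (b′-correct j)))) (⊖-involutive j))

    -- A column that is a reflection `j ↦ i - j` would, by `difference`, coincide with the row `b i`
    -- of the previous square.
    next-frame : Frame (suc l) b′
    next-frame w with translation-or-reflection (f 0₃) (f 1₃) (f 2₃)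
                        (injective⇒distinct {f} (λ eq → b′-injective (column-injective (suc l) w eq)))
      where
      f : Fin 3 → Fin 3
      f j = ρ (suc l) (b′ j) w
    ... | inj₁ (e₁ , e₂) = f₀ , ∀₃ {λ j → ρ (suc l) (b′ j) w ≡ j ⊕ f₀} refl e₁ e₂
      where f₀ = ρ (suc l) (b′ 0₃) w
    ... | inj₂ (e₁ , e₂) = ⊥-elim (no-coincidence l (b i) w λ x →
        let j , b′j≡x = injective⇒surjective b′ b′-injective x in
        subst (λ x → ρ l (b i) x ≡ ρ (suc l) x w) b′j≡x
          (trans (difference i j) (∀₃ {λ j → i ⊝ j ≡ ρ (suc l) (b′ j) w} (⊕-identityʳ i) (sym e₁) (sym e₂) j)))
      where i = ρ (suc l) (b′ 0₃) w

  frames : ∀ l → ∃[ b ] Frame l b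
  frames zero    = first-frame
  frames (suc l) = NextFrame.b′ {l} (proj₂ (frames l)) , NextFrame.next-frame {l} (proj₂ (frames l))

  constant-walk : ∀ n → ¬ 3 ∣ n → (∀ x z → ρ n x z ≡ ρ 0 x z) →
                  ∃[ k ] Σ[ c ∈ (ℕ → Fin 3) ] (c n ≡ c 0 × (∀ l → ρ l (c l) (c (suc l)) ≡ k))
  constant-walk n 3∤n ρₙ≡ρ₀ = k , c , closed , constant
    where
    b : ℕ → Fin 3 → Fin 3
    b l = proj₁ (frames l)
    d₀ = proj₁ (proj₂ (frames 0) 0₃)
    dₙ = proj₁ (proj₂ (frames n) 0₃)
    s = dₙ ⊝ d₀
    monodromy : ∀ i → b n i ≡ b 0 (i ⊕ s)
    monodromy i = column-injective 0 0₃ (begin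
      ρ 0 (b n i) 0₃         ≡⟨ ρₙ≡ρ₀ (b n i) 0₃ ⟨
      ρ n (b n i) 0₃         ≡⟨ proj₂ (proj₂ (frames n) 0₃) i ⟩
      i ⊕ dₙ                 ≡⟨ i⊕[j⊝k]⊕k≡i⊕j i dₙ d₀ ⟨
      i ⊕ s ⊕ d₀             ≡⟨ proj₂ (proj₂ (frames 0) 0₃) (i ⊕ s) ⟨
      ρ 0 (b 0 (i ⊕ s)) 0₃   ∎)
      where open ≡-Reasoning
    k = proj₁ (retreat-surjective n 3∤n (⊖ s))
    c : ℕ → Fin 3
    c l = b l (retreat zero k l)
    closed : c n ≡ c 0
    closed = trans (monodromy (retreat zero k n)) (cong (b 0)
      (trans (cong (_⊕ s) (proj₂ (retreat-surjective n 3∤n (⊖ s)))) (⊖i⊕i≡0 s)))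
    constant : ∀ l → ρ l (c l) (c (suc l)) ≡ k
    constant l = trans (NextFrame.difference {l} (proj₂ (frames l)) (retreat zero k l) (retreat zero k (suc l)))
                       (i⊝[i⊝j]≡j (retreat zero k l) k)

-- Counting right guesses at the two ends of an edge

hits₃-< : ∀ f k {j} → j < k → 3 ≤ f j → length (hits f 0 k) + (length (hits f 1 k) + length (hits f 2 k)) < k
hits₃-< f (suc k) j<1+k 3≤fj with m≤n⇒m<n∨m≡n j<1+k
... | inj₁ (s≤s j<k) = grow (hits₃-< f k j<k 3≤fj)
  where
  a = length (hits f 0 k)
  b = length (hits f 1 k)
  grow : a + (b + length (hits f 2 k)) < k →
         length (hits f 0 (suc k)) + (length (hits f 1 (suc k)) + length (hits f 2 (suc k))) < suc k
  grow ih with f k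
  ... | 0 = s≤s ih
  ... | 1 = subst (_< suc k) (sym (+-suc a _)) (s≤s ih)
  ... | 2 = subst (_< suc k) (sym (trans (cong (a +_) (+-suc b _)) (+-suc a _))) (s≤s ih)
  ... | suc (suc (suc _)) = m<n⇒m<1+n ih
... | inj₂ refl = grow 3≤fj
  where
  grow : 3 ≤ f k → length (hits f 0 (suc k)) + (length (hits f 1 (suc k)) + length (hits f 2 (suc k))) < suc k
  grow 3≤fk with f k
  grow (s≤s (s≤s (s≤s _))) | suc (suc (suc _)) = s≤s (hits₃ f k)

all-hit : ∀ {f x} k → (∀ {ℓ} → ℓ < k → f ℓ ≡ x) → length (hits f x k) ≡ k
all-hit         zero    hit = refl
all-hit {f} {x} (suc k) hit with f k ≟ x
... | yes _    = cong suc (all-hit k (hit ∘ m<n⇒m<1+n))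
... | no  fk≢x = contradiction (hit ≤-refl) fk≢x

abstract

  -- Abstract, because type checking would otherwise unfold it everywhere.
  count : (ℕ → ℕ) → ℕ → ℕ
  count f x = length (hits f x 3)

  count≡ : ∀ f x → count f x ≡ length (hits f x 3)
  count≡ f x = refl

  count₃ : ∀ f → Σ₃ (count f) ≤ 3
  count₃ f = hits₃ f 3

  count₃-< : ∀ f {j} → j < 3 → 3 ≤ f j → Σ₃ (count f) < 3
  count₃-< f = hits₃-< f 3

  count-all : ∀ f {x} → (∀ {ℓ} → ℓ < 3 → f ℓ ≡ x) → count f x ≡ 3
  count-all f = all-hit {f} 3

  count-0 : ∀ f {x ℓ} → count f x ≡ 0 → ℓ < 3 → f ℓ ≢ x
  count-0 f = 0≡⇒miss {f} 3

  count-1≤ : ∀ f {x ℓ} → ℓ < 3 → f ℓ ≡ x → 1 ≤ count f x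
  count-1≤ f = hit⇒1≤ {f} 3

  count-2≤ : ∀ f {x ℓ ℓ′} → ℓ ≢ ℓ′ → ℓ < 3 → ℓ′ < 3 → f ℓ ≡ x → f ℓ′ ≡ x → 2 ≤ count f x
  count-2≤ f = hit-hit⇒2≤ {f} 3

  count-≤1 : ∀ f {x ℓ ℓ′} → ℓ ≢ ℓ′ → ℓ < 3 → ℓ′ < 3 → f ℓ ≢ x → f ℓ′ ≢ x → 2 + count f x ≤ 3
  count-≤1 f = miss-miss⇒2+≤ {f} 3

  count-hit : ∀ f {x} → 1 ≤ count f x → ∃[ ℓ ] ℓ < 3 × f ℓ ≡ x
  count-hit f = 1≤⇒hit {f} 3

Ones Permutation : ℕ → ℕ → ℕ → Set
Ones a b c        = a ≡ 1 × b ≡ 1 × c ≡ 1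
Permutation a b c = a ≢ b × a ≢ c × b ≢ c × (a ≡ 0 ⊎ b ≡ 0 ⊎ c ≡ 0) × (a ≡ 1 ⊎ b ≡ 1 ⊎ c ≡ 1)

permutation-or-ones : ∀ a b c → a ≤ 2 → b ≤ 2 → c ≤ 2 → a + (b + c) ≡ 3 → Ones a b c ⊎ Permutation a b c
permutation-or-ones 1 1 1 _ _ _ _ = inj₁ (refl , refl , refl)
permutation-or-ones 0 1 2 _ _ _ _ = inj₂ ((λ ()) , (λ ()) , (λ ()) , inj₁ refl , inj₂ (inj₁ refl))
permutation-or-ones 0 2 1 _ _ _ _ = inj₂ ((λ ()) , (λ ()) , (λ ()) , inj₁ refl , inj₂ (inj₂ refl))
permutation-or-ones 1 0 2 _ _ _ _ = inj₂ ((λ ()) , (λ ()) , (λ ()) , inj₂ (inj₁ refl) , inj₁ refl)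
permutation-or-ones 1 2 0 _ _ _ _ = inj₂ ((λ ()) , (λ ()) , (λ ()) , inj₂ (inj₂ refl) , inj₁ refl)
permutation-or-ones 2 0 1 _ _ _ _ = inj₂ ((λ ()) , (λ ()) , (λ ()) , inj₂ (inj₁ refl) , inj₂ (inj₂ refl))
permutation-or-ones 2 1 0 _ _ _ _ = inj₂ ((λ ()) , (λ ()) , (λ ()) , inj₂ (inj₂ refl) , inj₂ (inj₁ refl))
permutation-or-ones 0 0 _ _ _ (s≤s (s≤s ())) refl
permutation-or-ones 0 (suc (suc (suc _))) _ _ (s≤s (s≤s ())) _ _
permutation-or-ones 1 (suc (suc (suc _))) _ _ (s≤s (s≤s ())) _ _
permutation-or-ones (suc (suc (suc _))) _ _ (s≤s (s≤s ())) _ _ _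

pick₂ : ∀ a b → ∃[ t ] t < 3 × t ≢ a × t ≢ b
pick₂ a b with many-Without {1} {_< 3} (a ∷ b ∷ []) (many-< 3)
... | more ((t<3 , t≢b) , t≢a) done = _ , t<3 , t≢a , t≢b

module AllThree {k : ℕ} (g : Fin (5 + k) → ℕ → ℕ → ℕ)
                (wins : ∀ a → Unbeaten (4 + k) (λ _ → 3) (g ∘ walk forward a)) where

  private
    win : ∀ a → SequenceWin (4 + k) (λ _ → 3)
    win a = g ∘ walk forward a , wins a

  next-last : ∀ a → next (walk forward a (4 + k)) ≡ a
  next-last a = walk-n {4 + k} forward a

  last-next : ∀ v → walk forward (next v) (4 + k) ≡ v
  last-next v = after-injective {4 + k} forward (next-last (next v))

  -- For the colors x and z of the edge from v to next v: the number of colors of the other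
  -- neighbour of v, respectively of next v, for which that end guesses right.
  R T : Fin (5 + k) → ℕ → ℕ → ℕ
  R v x z = count (λ y → g v y z) x
  T v x z = count (λ t → g (next v) x t) z

  private
    2≤R+T : ∀ v {x z} → x < 3 → z < 3 → 2 ≤ R v x z + T v x z
    2≤R+T v {x} {z} x<3 z<3 = subst (λ w → 2 ≤ R w x z + T v x z) (last-next v)
      (subst (2 ≤_) (sym (cong₂ _+_ (count≡ (λ s → g (walk forward (next v) (4 + k)) s z) x) (count≡ (λ t → g (next v) x t) z))) (edge-≥2 (win (next v)) x<3 z<3))

    R-column : ∀ v z → Σ₃ (λ x → R v x z) ≤ 3
    R-column v z = count₃ (λ y → g v y z)

    T-row : ∀ v x → Σ₃ (λ z → T v x z) ≤ 3
    T-row v x = count₃ (λ t → g (next v) x t)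

    ΣR≤9 : ∀ v → Σ₃ (λ x → Σ₃ (λ z → R v x z)) ≤ 9
    ΣR≤9 v = subst (_≤ 9) (sym (Σ₃-swap (R v))) (Σ₃-mono {g = λ _ → 3} (λ {z} _ → R-column v z))

    ΣT≤9 : ∀ v → Σ₃ (λ x → Σ₃ (λ z → T v x z)) ≤ 9
    ΣT≤9 v = Σ₃-mono {g = λ _ → 3} (λ {x} _ → T-row v x)

    Σ[R+T] : ∀ v → Σ₃ (λ x → Σ₃ (λ z → R v x z + T v x z)) ≡ Σ₃ (λ x → Σ₃ (λ z → R v x z)) + Σ₃ (λ x → Σ₃ (λ z → T v x z))
    Σ[R+T] v = trans
      (cong₂ _+_ (Σ₃-+ (R v 0) (T v 0)) (cong₂ _+_ (Σ₃-+ (R v 1) (T v 1)) (Σ₃-+ (R v 2) (T v 2))))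
      (Σ₃-+ (λ x → Σ₃ (λ z → R v x z)) (λ x → Σ₃ (λ z → T v x z)))

    Σ[R+T]≤18 : ∀ v → Σ₃ (λ x → Σ₃ (λ z → R v x z + T v x z)) ≤ 18
    Σ[R+T]≤18 v = ≤-trans (≤-reflexive (Σ[R+T] v)) (+-mono-≤ (ΣR≤9 v) (ΣT≤9 v))

    R+T-row : ∀ v {x} → x < 3 → 6 ≡ Σ₃ (λ z → R v x z + T v x z)
    R+T-row v = Σ₃-tight {λ _ → 6} {λ x → Σ₃ (λ z → R v x z + T v x z)}
      (λ x<3 → Σ₃-mono {λ _ → 2} (2≤R+T v x<3)) (Σ[R+T]≤18 v)

    ΣR≡9 : ∀ v → Σ₃ (λ x → Σ₃ (λ z → R v x z)) ≡ 9 × Σ₃ (λ x → Σ₃ (λ z → T v x z)) ≡ 9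
    ΣR≡9 v = tight (ΣR≤9 v) (ΣT≤9 v) (≤-reflexive (trans
      (cong₂ _+_ (R+T-row v 0<3) (cong₂ _+_ (R+T-row v 1<3) (R+T-row v 2<3))) (Σ[R+T] v)))

  -- Nine pairs of colors need at least 2 each, while `R` and `T` sum to at most 9 each, because a
  -- vertex makes a single guess for given colors of its neighbours. So 18 ≤ 18 leaves no slack in
  -- the entries or in the line sums.
  R+T≡2 : ∀ v {x z} → x < 3 → z < 3 → R v x z + T v x z ≡ 2
  R+T≡2 v {x} x<3 z<3 = sym (Σ₃-tight {λ _ → 2} {λ z → R v x z + T v x z} (2≤R+T v x<3)
    (≤-reflexive (sym (R+T-row v x<3))) z<3)

  R-column≡3 : ∀ v {z} → z < 3 → Σ₃ (λ x → R v x z) ≡ 3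
  R-column≡3 v = Σ₃-tight {λ z → Σ₃ (λ x → R v x z)} {λ _ → 3} (λ {z} _ → R-column v z)
    (≤-reflexive (trans (sym (proj₁ (ΣR≡9 v))) (Σ₃-swap (R v))))

  T-row≡3 : ∀ v {x} → x < 3 → Σ₃ (λ z → T v x z) ≡ 3
  T-row≡3 v = Σ₃-tight {λ x → Σ₃ (λ z → T v x z)} {λ _ → 3} (λ {x} _ → T-row v x)
    (≤-reflexive (sym (proj₂ (ΣR≡9 v))))

  R-row≡3 : ∀ v {x} → x < 3 → Σ₃ (λ z → R v x z) ≡ 3
  R-row≡3 v {x} x<3 = +-cancelʳ-≡ 3 (Σ₃ (λ z → R v x z)) 3
    (trans (cong (Σ₃ (R v x) +_) (sym (T-row≡3 v x<3))) (trans (sym (Σ₃-+ (R v x) (T v x))) (sym (R+T-row v x<3))))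

  R≤2 : ∀ v {x z} → x < 3 → z < 3 → R v x z ≤ 2
  R≤2 v {x} {z} x<3 z<3 = subst (R v x z ≤_) (R+T≡2 v x<3 z<3) (m≤m+n _ _)

  -- Guesses are bare natural numbers here; one outside the three colors would count for no `x` and
  -- spoil a column sum.
  guess<3 : ∀ v {y z} → y < 3 → z < 3 → g v y z < 3
  guess<3 v {y} {z} y<3 z<3 = ≰⇒> λ 3≤g →
    <⇒≢ (count₃-< (λ y → g v y z) y<3 3≤g) (R-column≡3 v z<3)

  T≡1 : ∀ v {x z} → x < 3 → z < 3 → R v x z ≡ 1 → T v x z ≡ 1
  T≡1 v x<3 z<3 R≡1 = suc-injective (trans (cong (_+ T v _ _) (sym R≡1)) (R+T≡2 v x<3 z<3))

  OnesRow OnesColumn : Fin (5 + k) → ℕ → Set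
  OnesRow    v x = ∀ {z} → z < 3 → R v x z ≡ 1
  OnesColumn v z = ∀ {x} → x < 3 → R v x z ≡ 1

  -- If `R v y x` were 0, then `T v y x` would be 2; but `bijective-label` makes `next v` guess `x`
  -- after `y` whatever follows, which counts 3. So the column has positive entries and sum 3.
  onesRow⇒onesColumn : ∀ v {x} → x < 3 → OnesRow (next v) x → OnesColumn v x
  onesRow⇒onesColumn v {x} x<3 ones {y} y<3 = sym (Σ₃-tight {λ _ → 1} {λ y → R v y x} (λ y<3 → n≢0⇒n>0 (positive y<3))
      (≤-reflexive (R-column≡3 v x<3)) y<3)
    where
    last≡v = last-next v
    positive : ∀ {y} → y < 3 → R v y x ≢ 0
    positive {y} y<3 R≡0 = contradiction (trans (sym (count-all (λ t → g (next v) y t) always)) T≡2) λ ()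
      where
      T≡2 : T v y x ≡ 2
      T≡2 = trans (cong (_+ T v y x) (sym R≡0)) (R+T≡2 v y<3 x<3)
      always : ∀ {ℓ} → ℓ < 3 → g (next v) y ℓ ≡ x
      always {ℓ} ℓ<3 = decidable-stable (g (next v) y ℓ ≟ x)
        (bijective-label (win (next v)) x<3 y<3 (λ {z} z<3 → trans (sym (count≡ _ z)) (T≡1 (next v) x<3 z<3 (ones z<3)))
          (λ {p} p<3 → subst (λ w → g w p x ≢ y) (sym last≡v) (count-0 (λ p → g v p x) R≡0 p<3)) ℓ<3)

  ones-next-to : ∀ v (a b : ℕ) → a < 3 → b < 3 → (∀ {y} → y < 3 → R v y a + R v y b ≡ 2) →
                 ∃[ y ] y < 3 × R v y a ≡ 1 × R v y b ≡ 1
  ones-next-to v a b a<3 b<3 sum = find (permutation-or-ones (R v 0 a) (R v 1 a) (R v 2 a)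
      (R≤2 v 0<3 a<3) (R≤2 v 1<3 a<3) (R≤2 v 2<3 a<3) (R-column≡3 v a<3))
    where
    at : ∀ {y} → y < 3 → R v y a ≡ 1 → ∃[ y ] y < 3 × R v y a ≡ 1 × R v y b ≡ 1
    at {y} y<3 R≡1 = y , y<3 , R≡1 , suc-injective (trans (cong (_+ R v y b) (sym R≡1)) (sum y<3))
    find : Ones (R v 0 a) (R v 1 a) (R v 2 a) ⊎ Permutation (R v 0 a) (R v 1 a) (R v 2 a) → ∃[ y ] y < 3 × R v y a ≡ 1 × R v y b ≡ 1
    find (inj₁ (e , _))                               = at 0<3 e
    find (inj₂ (_ , _ , _ , _ , inj₁ e))              = at 0<3 e
    find (inj₂ (_ , _ , _ , _ , inj₂ (inj₁ e)))       = at 1<3 e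
    find (inj₂ (_ , _ , _ , _ , inj₂ (inj₂ e)))       = at 2<3 e

  -- In the other two columns the entries of each row add up to 2. A column with sum 3 and entries
  -- at most 2 contains a 1, which completes a row of ones.
  onesColumn⇒onesRow : ∀ v {z} → z < 3 → OnesColumn v z → ∃[ y ] y < 3 × OnesRow v y
  onesColumn⇒onesRow v {z} z<3 ones = ∀<3 {λ z → OnesColumn v z → ∃[ y ] y < 3 × OnesRow v y} zeroth first second z<3 ones
    where
    f : ℕ → ℕ → ℕ
    f = R v

    zeroth : OnesColumn v 0 → ∃[ y ] y < 3 × OnesRow v y
    zeroth ones =
      let y , y<3 , e₁ , e₂ = ones-next-to v 1 2 1<3 2<3 sum in
      y , y<3 , ∀<3 {λ z → f y z ≡ 1} (ones y<3) e₁ e₂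
      where
      sum : ∀ {y} → y < 3 → f y 1 + f y 2 ≡ 2
      sum {y} y<3 = +-cancelˡ-≡ 1 (f y 1 + f y 2) 2 (trans (cong (_+ (f y 1 + f y 2)) (sym (ones y<3))) (R-row≡3 v y<3))

    first : OnesColumn v 1 → ∃[ y ] y < 3 × OnesRow v y
    first ones =
      let y , y<3 , e₁ , e₂ = ones-next-to v 0 2 0<3 2<3 sum in
      y , y<3 , ∀<3 {λ z → f y z ≡ 1} e₁ (ones y<3) e₂
      where
      sum : ∀ {y} → y < 3 → f y 0 + f y 2 ≡ 2
      sum {y} y<3 = +-cancelˡ-≡ 1 (f y 0 + f y 2) 2 (trans (sym (+-suc (f y 0) (f y 2)))
        (trans (cong (λ r → f y 0 + (r + f y 2)) (sym (ones y<3))) (R-row≡3 v y<3)))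

    second : OnesColumn v 2 → ∃[ y ] y < 3 × OnesRow v y
    second ones =
      let y , y<3 , e₁ , e₂ = ones-next-to v 0 1 0<3 1<3 sum in
      y , y<3 , ∀<3 {λ z → f y z ≡ 1} e₁ e₂ (ones y<3)
      where
      sum : ∀ {y} → y < 3 → f y 0 + f y 1 ≡ 2
      sum {y} y<3 = +-cancelʳ-≡ 1 (f y 0 + f y 1) 2 (trans (+-assoc (f y 0) (f y 1) 1)
        (trans (cong (λ r → f y 0 + (f y 1 + r)) (sym (ones y<3))) (R-row≡3 v y<3)))

  module WithOnes {v₀ : Fin (5 + k)} {x₀ : ℕ} (x₀<3 : x₀ < 3) (ones₀ : OnesRow v₀ x₀) where

    ones-backward : ∀ i → ∃[ x ] x < 3 × OnesRow (walk backward v₀ i) x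
    ones-backward zero    = x₀ , x₀<3 , ones₀
    ones-backward (suc i) =
      let x , x<3 , ones = ones-backward i in
      onesColumn⇒onesRow (walk backward v₀ (suc i)) x<3
        (onesRow⇒onesColumn (walk backward v₀ (suc i)) x<3
          (subst (λ w → OnesRow w x) (sym (next-prev (walk backward v₀ i))) ones))

    ones-everywhere : ∀ v → ∃[ x ] x < 3 × OnesRow v x
    ones-everywhere v = subst (λ w → ∃[ x ] x < 3 × OnesRow w x) (walk-position backward v₀ v)
      (ones-backward (position backward v₀ v))

    private
      a = v₀
      w : ℕ → Fin (5 + k)
      w = walk forward a
      m = 4 + k
      G : ℕ → ℕ → ℕ → ℕ
      G i = g (w i)
      X : ℕ → ℕ
      X i = proj₁ (ones-everywhere (w i))
      X<3 : ∀ i → X i < 3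
      X<3 i = proj₁ (proj₂ (ones-everywhere (w i)))
      row : ∀ i → OnesRow (w i) (X i)
      row i = proj₂ (proj₂ (ones-everywhere (w i)))
      column : ∀ i → OnesColumn (w i) (X (suc i))
      column i = onesRow⇒onesColumn (w i) (X<3 (suc i)) (row (suc i))

      closing-column : OnesColumn (w m) (X 0)
      closing-column = onesRow⇒onesColumn (w m) (X<3 0)
        (subst (λ u → OnesRow u (X 0)) (sym (next-last a)) (row 0))

    open Cut (win a)

    private
      Λ : ℕ → Set
      Λ t = t < 3 × G 0 (X m) t ≢ X 0

    unique : ∀ {f x ℓ ℓ′} → count f x ≡ 1 → ℓ < 3 → ℓ′ < 3 → f ℓ ≡ x → f ℓ′ ≡ x → ℓ ≡ ℓ′
    unique {f} {x} {ℓ} {ℓ′} L≡1 ℓ<3 ℓ′<3 e e′ = decidable-stable (ℓ ≟ ℓ′) λ ℓ≢ℓ′ →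
      contradiction (subst (2 ≤_) L≡1 (count-2≤ f ℓ≢ℓ′ ℓ<3 ℓ′<3 e e′)) λ { (s≤s ()) }

    exists : ∀ {f x} → count f x ≡ 1 → ∃[ ℓ ] ℓ < 3 × f ℓ ≡ x
    exists {f} {x} L≡1 = count-hit f (≤-reflexive (sym L≡1))

    -- Walks are led from one color X i to a later one; each time the next color is free up
    -- to one exception.
    Free : ℕ → Set
    Free i = ∃[ t₀ ] t₀ < 3 × (∀ {t} → t < 3 → t ≢ t₀ → Reach Λ (X 0) i t (X i) × Palette Λ (λ _ → 3) (suc i) t)

    free-0 : Free 0
    free-0 =
      let t₀ , t₀<3 , e = exists {λ t → g (next (w m)) (X m) t} (T≡1 (w m) (X<3 m) (X<3 0) (closing-column (X<3 m))) in
      t₀ , t₀<3 , λ {t} t<3 t≢t₀ → refl , t<3 , λ e′ →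
        t≢t₀ (unique {λ t → g (next (w m)) (X m) t} (T≡1 (w m) (X<3 m) (X<3 0) (closing-column (X<3 m))) t<3 t₀<3
          (subst (λ u → g u (X m) t ≡ X 0) (sym (next-last a)) e′) e)

    arrive : ∀ i {t} → t < 3 → Reach Λ (X 0) (suc i) (X (2 + i)) t → Free (2 + i)
    arrive i {t} t<3 reach =
      -- By the column of ones, exactly one color `u₀` after `X (2 + i)` makes its vertex guess
      -- right.
      let T≡1′ = T≡1 (w (suc i)) t<3 (X<3 (2 + i)) (column (suc i) t<3)
          u₀ , u₀<3 , e = exists {λ u → G (2 + i) t u} T≡1′ in
      u₀ , u₀<3 , λ u<3 u≢u₀ →
        alive (X<3 (2 + i)) reach (λ e′ → u≢u₀ (unique {λ u → G (2 + i) t u} T≡1′ u<3 u₀<3 e′ e)) , u<3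

    free-2+ : ∀ i → Free i → Free (2 + i)
    free-2+ i (t₀ , _ , free) =
      let t , t<3 , t≢t₀ , t≢g = pick₂ t₀ (G (suc i) (X i) (X (2 + i)))
          reach , palette = free t<3 t≢t₀ in
      arrive i t<3 (alive palette reach (≢-sym t≢g))

    free-3+ : ∀ i → Free i → Free (3 + i)
    free-3+ i (t₀ , _ , free) =
      let t , t<3 , t≢t₀ , _ = pick₂ t₀ t₀
          reach , palette = free t<3 t≢t₀
          T≡1′ = T≡1 (w i) (X<3 i) t<3 (row i t<3)
          r₀ , r₀<3 , e = exists {λ r → G (suc i) (X i) r} T≡1′
          r , r<3 , r≢r₀ , r≢g = pick₂ r₀ (G (2 + i) t (X (3 + i))) in
      arrive (suc i) r<3 (alive r<3
        (alive palette reach (λ e′ → r≢r₀ (unique {λ r → G (suc i) (X i) r} T≡1′ r<3 r₀<3 e′ e))) (≢-sym r≢g))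

    -- Every number except 1 is a sum of twos and threes.
    free : ∀ i → i ≢ 1 → Free i
    free 0 _ = free-0
    free 1 1≢1 = contradiction refl 1≢1
    free 2 _ = free-2+ 0 free-0
    free 3 _ = free-3+ 0 free-0
    free (suc (suc (suc (suc i)))) _ = free-2+ (suc (suc i)) (free (suc (suc i)) λ ())

    -- The colors t and s around r* are chosen as the guesses next to r*, so that any
    -- r ≠ r* makes both of them wrong.
    contradictory : k ≢ 1 → ⊥
    contradictory k≢1 = from-free (free k k≢1)
      where
      φ ψ : ℕ → ℕ
      φ r = G (1 + k) (X k) r
      ψ r = G (3 + k) r (X m)

      φ≡1 : ∀ {t} → t < 3 → count φ t ≡ 1
      φ≡1 t<3 = T≡1 (w k) (X<3 k) t<3 (row k t<3)

      ψ≡1 : ∀ {s} → s < 3 → count ψ s ≡ 1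
      ψ≡1 = column (3 + k)

      last≡1 : count (λ s → g (w m) s (X 0)) (X m) ≡ 1
      last≡1 = closing-column (X<3 m)

      from-free : Free k → ⊥
      from-free (t₀ , t₀<3 , free-k) = from-s₀ (exists {φ} (φ≡1 t₀<3)) (exists {λ s → g (w m) s (X 0)} last≡1)
        where
        from-s₀ : (∃[ r ] r < 3 × φ r ≡ t₀) → (∃[ s ] s < 3 × g (w m) s (X 0) ≡ X m) → ⊥
        from-s₀ (r₀ , r₀<3 , φr₀) (s₀ , s₀<3 , gs₀) = from-r₁ (exists {ψ} (ψ≡1 s₀<3))
          where
          from-r₁ : (∃[ r ] r < 3 × ψ r ≡ s₀) → ⊥
          -- Avoiding `r₀` keeps `φ r*` off the exception `t₀`; avoiding `r₁` keeps `ψ r*` off `s₀`,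
          -- the only color that makes the last vertex guess `X m` before `X 0`.
          from-r₁ (r₁ , r₁<3 , ψr₁) = from-r* (pick₂ r₀ r₁)
            where
            from-r* : (∃[ r ] r < 3 × r ≢ r₀ × r ≢ r₁) → ⊥
            from-r* (r* , r*<3 , r*≢r₀ , r*≢r₁) = from-r (pick₂ r* (G (2 + k) (φ r*) (ψ r*)))
              where
              t<3 = guess<3 (w (1 + k)) (X<3 k) r*<3
              s<3 = guess<3 (w (3 + k)) r*<3 (X<3 m)

              from-r : (∃[ r ] r < 3 × r ≢ r* × r ≢ G (2 + k) (φ r*) (ψ r*)) → ⊥
              from-r (r , r<3 , r≢r* , r≢g) = from-reach (free-k t<3 λ e → r*≢r₀ (unique {φ} (φ≡1 t₀<3) r*<3 r₀<3 e φr₀))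
                where
                conclude : (∃[ t ] Λ t × (G m (ψ r*) (X 0) ≡ X m ⊎ G 0 (X m) t ≡ X 0)) → ⊥
                conclude (_ , _ , inj₁ e) = r*≢r₁ (unique {ψ} (ψ≡1 s₀<3) r*<3 r₁<3
                  (unique {λ s → g (w m) s (X 0)} last≡1 s<3 s₀<3 e gs₀) ψr₁)
                conclude (_ , (_ , wrong) , inj₂ e) = wrong e

                from-reach : Reach Λ (X 0) k (φ r*) (X k) × Palette Λ (λ _ → 3) (suc k) (φ r*) → ⊥
                from-reach (reach , palette) = conclude (edge-guessed (win a) proj₁ (X<3 m) (X<3 0)
                  (alive s<3
                    (alive r<3
                      (alive palette reach (λ e → r≢r* (unique {φ} (φ≡1 t<3) r<3 r*<3 e refl)))
                      (≢-sym r≢g))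
                    (λ e → r≢r* (unique {ψ} (ψ≡1 s<3) r<3 r*<3 e refl))))

  module WithoutOnes (no-ones : ∀ v {x} → x < 3 → ¬ OnesRow v x) where

    private
      Triple : (ℕ → ℕ) → Set
      Triple f = Permutation (f 0) (f 1) (f 2)

      row-triple : ∀ v {x} → x < 3 → Triple (λ z → R v x z)
      row-triple v {x} x<3 =
        [ (λ (e₀ , e₁ , e₂) → ⊥-elim (no-ones v x<3 (∀<3 {λ z → R v x z ≡ 1} e₀ e₁ e₂))) , id ]′
          (permutation-or-ones (R v x 0) (R v x 1) (R v x 2) (R≤2 v x<3 0<3) (R≤2 v x<3 1<3) (R≤2 v x<3 2<3) (R-row≡3 v x<3))

      column-triple : ∀ v {z} → z < 3 → Triple (λ x → R v x z)
      column-triple v {z} z<3 =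
        [ (λ (e₀ , e₁ , e₂) → ⊥-elim (no-row (onesColumn⇒onesRow v z<3 (∀<3 {λ x → R v x z ≡ 1} e₀ e₁ e₂)))) , id ]′
          (permutation-or-ones (R v 0 z) (R v 1 z) (R v 2 z) (R≤2 v 0<3 z<3) (R≤2 v 1<3 z<3) (R≤2 v 2<3 z<3) (R-column≡3 v z<3))
        where
        no-row : (∃[ y ] y < 3 × OnesRow v y) → ⊥
        no-row (_ , y<3 , ones) = no-ones v y<3 ones

      zero-of : ∀ {f} → Triple f → ∃[ i ] i < 3 × f i ≡ 0
      zero-of (_ , _ , _ , inj₁ e , _)        = 0 , 0<3 , e
      zero-of (_ , _ , _ , inj₂ (inj₁ e) , _) = 1 , 1<3 , e
      zero-of (_ , _ , _ , inj₂ (inj₂ e) , _) = 2 , 2<3 , e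

      triple-injective : ∀ {f : ℕ → ℕ} → Triple f → ∀ {i j : Fin 3} → f (toℕ i) ≡ f (toℕ j) → i ≡ j
      triple-injective t {zero} {zero} _ = refl
      triple-injective (a , b , c , _) {zero} {suc zero} e = contradiction e a
      triple-injective (a , b , c , _) {zero} {suc (suc zero)} e = contradiction e b
      triple-injective (a , b , c , _) {suc zero} {zero} e = contradiction (sym e) a
      triple-injective t {suc zero} {suc zero} _ = refl
      triple-injective (a , b , c , _) {suc zero} {suc (suc zero)} e = contradiction e c
      triple-injective (a , b , c , _) {suc (suc zero)} {zero} e = contradiction (sym e) b
      triple-injective (a , b , c , _) {suc (suc zero)} {suc zero} e = contradiction (sym e) c
      triple-injective t {suc (suc zero)} {suc (suc zero)} _ = refl

    -- The guess counts in `T v y x`, so `R v y x ≤ 1`, and in `R (next v) x z`, which is at least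
    -- 1; without increase both are 1. Take `y₂` with `R v y₂ x` = 0, hence `T v y₂ x` = 2, and `z₀`
    -- with `R (next v) x z₀` = 0. After `y₂`, the guess `x` occurs neither before `z₀` nor before
    -- `z`, where only `y` produces it; so `T v y₂ x` is at most 1.
    guess⇒increase : ∀ v {x y z} → x < 3 → y < 3 → z < 3 → g (next v) y z ≡ x → R v y x < R (next v) x z
    guess⇒increase v {x} {y} {z} x<3 y<3 z<3 guessed = ≰⇒> λ R′≤R →
      contradict (≤-antisym R≤1 (≤-trans 1≤R′ R′≤R)) (≤-antisym (≤-trans R′≤R R≤1) 1≤R′)
        (zero-of (column-triple v x<3)) (zero-of (row-triple (next v) x<3))
      where
      contradict : R v y x ≡ 1 → R (next v) x z ≡ 1 → (∃[ y₂ ] y₂ < 3 × R v y₂ x ≡ 0) → (∃[ z₀ ] z₀ < 3 × R (next v) x z₀ ≡ 0) → ⊥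
      contradict R≡1 R′≡1 (y₂ , y₂<3 , e₂) (z₀ , z₀<3 , e₀) =
        contradiction (subst (λ t → 2 + t ≤ 3) T≡2 (count-≤1 (λ t → g (next v) y₂ t) z₀≢z z₀<3 z<3 miss₀ miss))
          λ { (s≤s (s≤s (s≤s ()))) }
        where
        y₂≢y : y₂ ≢ y
        y₂≢y y₂≡y = contradiction (trans (sym e₂) (trans (cong (λ y → R v y x) y₂≡y) R≡1)) λ ()
        z₀≢z : z₀ ≢ z
        z₀≢z z₀≡z = contradiction (trans (sym e₀) (trans (cong (R (next v) x) z₀≡z) R′≡1)) λ ()
        miss₀ : g (next v) y₂ z₀ ≢ x
        miss₀ = count-0 (λ y → g (next v) y z₀) e₀ y₂<3
        miss : g (next v) y₂ z ≢ x
        miss hit = contradiction (subst (2 ≤_) R′≡1 (count-2≤ (λ y → g (next v) y z) y₂≢y y₂<3 y<3 hit guessed)) λ { (s≤s ()) }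
        T≡2 : T v y₂ x ≡ 2
        T≡2 = trans (cong (_+ T v y₂ x) (sym e₂)) (R+T≡2 v y₂<3 x<3)

      1≤R′ : 1 ≤ R (next v) x z
      1≤R′ = count-1≤ (λ y → g (next v) y z) y<3 guessed
      R≤1 : R v y x ≤ 1
      R≤1 = s≤s⁻¹ (subst (suc (R v y x) ≤_) (R+T≡2 v y<3 x<3)
        (subst (_≤ R v y x + T v y x) (+-comm (R v y x) 1)
          (+-monoʳ-≤ (R v y x) (count-1≤ (λ t → g (next v) y t) z<3 guessed))))

    private
      w : ℕ → Fin (5 + k)
      w = walk forward zero
      ρ<3 : ∀ l (x z : Fin 3) → R (w l) (toℕ x) (toℕ z) < 3
      ρ<3 l x z = s≤s (R≤2 (w l) (toℕ<n x) (toℕ<n z))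
      ρ : ℕ → Fin 3 → Fin 3 → Fin 3
      ρ l x z = fromℕ< (ρ<3 l x z)
      toℕ-ρ : ∀ l x z → toℕ (ρ l x z) ≡ R (w l) (toℕ x) (toℕ z)
      toℕ-ρ l x z = toℕ-fromℕ< (ρ<3 l x z)
      ρ≡ : ∀ {l x z l′ x′ z′} → ρ l x z ≡ ρ l′ x′ z′ → R (w l) (toℕ x) (toℕ z) ≡ R (w l′) (toℕ x′) (toℕ z′)
      ρ≡ {l} {x} {z} {l′} {x′} {z′} e = trans (sym (toℕ-ρ l x z)) (trans (cong toℕ e) (toℕ-ρ l′ x′ z′))

      -- Take for `x` the guess made between `y` and `z`: there the square must increase.
      no-coincidence : ∀ l y z → ¬ (∀ x → ρ l y x ≡ ρ (suc l) x z)
      no-coincidence l y z same = <⇒≢ (guess⇒increase (w l) g<3 (toℕ<n y) (toℕ<n z) refl)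
          (subst (λ x → R (w l) (toℕ y) x ≡ R (w (suc l)) x (toℕ z)) (toℕ-fromℕ< g<3) (ρ≡ {l} {y} {_} {suc l} (same (fromℕ< g<3))))
        where g<3 = guess<3 (w (suc l)) (toℕ<n y) (toℕ<n z)

    contradictory : ¬ 3 ∣ 5 + k → ⊥
    contradictory 3∤n = from-walk (constant-walk ρ
      (λ l x {i} {j} e → triple-injective {λ z → R (w l) (toℕ x) z} (row-triple (w l) (toℕ<n x)) {i} {j} (ρ≡ {l} {x} {i} {l} {x} {j} e))
      (λ l z {i} {j} e → triple-injective {λ x → R (w l) x (toℕ z)} (column-triple (w l) (toℕ<n z)) {i} {j} (ρ≡ {l} {i} {z} {l} {j} {z} e))
      no-coincidence (5 + k) 3∤n
      (λ x z → toℕ-injective (trans (toℕ-ρ (5 + k) x z)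
        (trans (cong (λ u → R u (toℕ x) (toℕ z)) (walk-n {4 + k} forward zero)) (sym (toℕ-ρ 0 x z))))))
      where
      from-walk : (∃[ κ ] Σ[ c ∈ (ℕ → Fin 3) ] (c (5 + k) ≡ c 0 × (∀ l → ρ l (c l) (c (suc l)) ≡ κ))) → ⊥
      from-walk (κ , c , closed , constant) = conclude (wins zero (toℕ ∘ c) (λ i _ → toℕ<n (c i)) (cong toℕ closed))
        where
        last≡first : R (w (4 + k)) (toℕ (c (4 + k))) (toℕ (c 0)) ≡ R (next (w (4 + k))) (toℕ (c 0)) (toℕ (c 1))
        last≡first = begin
          R (w (4 + k)) (toℕ (c (4 + k))) (toℕ (c 0))          ≡⟨ cong (λ x → R (w (4 + k)) (toℕ (c (4 + k))) (toℕ x)) closed ⟨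
          R (w (4 + k)) (toℕ (c (4 + k))) (toℕ (c (5 + k)))    ≡⟨ ρ≡ {4 + k} {c (4 + k)} {c (5 + k)} {0} {c 0} {c 1} (trans (constant (4 + k)) (sym (constant 0))) ⟩
          R zero (toℕ (c 0)) (toℕ (c 1))                       ≡⟨ cong (λ u → R u (toℕ (c 0)) (toℕ (c 1))) (next-last zero) ⟨
          R (next (w (4 + k))) (toℕ (c 0)) (toℕ (c 1))         ∎
          where open ≡-Reasoning

        conclude : (∃[ i ] i < 5 + k × g (w i) (predecessor (4 + k) (toℕ ∘ c) i) (toℕ (c (suc i))) ≡ toℕ (c i)) → ⊥
        conclude (suc i , _ , e) = <⇒≢ (guess⇒increase (w i) (toℕ<n (c (suc i))) (toℕ<n (c i)) (toℕ<n (c (2 + i))) e)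
          (ρ≡ {i} {c i} {c (suc i)} {suc i} {c (suc i)} {c (2 + i)} (trans (constant i) (sym (constant (suc i)))))
        conclude (zero , _ , e) = <⇒≢
          (guess⇒increase (w (4 + k)) (toℕ<n (c 0)) (toℕ<n (c (4 + k))) (toℕ<n (c 1))
            (subst (λ u → g u (toℕ (c (4 + k))) (toℕ (c 1)) ≡ toℕ (c 0)) (sym (next-last zero)) e))
          last≡first

  losing : ¬ 3 ∣ 5 + k → ⊥
  losing 3∤n = ¬¬-excluded-middle decide
    where
    decide : Dec (∃[ v ] ∃[ x ] Σ[ x<3 ∈ x < 3 ] OnesRow v x) → ⊥
    -- The excluded `k` = 1 is the cycle of length 6, which is divisible by 3.
    decide (yes (v , x , x<3 , ones)) = WithOnes.contradictory x<3 ones λ { refl → 3∤n (∣m∣n⇒∣m+n ∣-refl ∣-refl) }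
    decide (no  ¬ones)                = WithoutOnes.contradictory (λ v {x} x<3 ones → ¬ones (v , x , x<3 , ones)) 3∤n

-- Winning strategies

nth : {A : Set} → A → List A → ℕ → A
nth d []       _       = d
nth d (x ∷ xs) zero    = x
nth d (x ∷ xs) (suc i) = nth d xs i

unbeaten : ∀ {m H G} → (∀ c → (∀ i → i < suc m → c i < H i) → c (suc m) ≡ c 0 →
           ¬ (∀ i → i < suc m → G i (predecessor m c i) (c (suc i)) ≢ c i)) → Unbeaten m H G
unbeaten {m} {H} {G} no-escape c c<H closed
  with anyUpTo? (λ i → G i (predecessor m c i) (c (suc i)) ≟ c i) (suc m)
... | yes guessed = guessed
... | no  ¬any    = contradiction (λ i i<n e → ¬any (i , i<n , e)) (no-escape c c<H closed)

to₃ : ℕ → Fin 3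
to₃ 0             = zero
to₃ 1             = suc zero
to₃ (suc (suc _)) = suc (suc zero)

toℕ-to₃ : ∀ {i} → i < 3 → toℕ (to₃ i) ≡ i
toℕ-to₃ {0} _ = refl
toℕ-to₃ {1} _ = refl
toℕ-to₃ {2} _ = refl
toℕ-to₃ {suc (suc (suc _))} (s≤s (s≤s (s≤s ())))

-- The only x whose difference x - z is smaller than the difference y - x.
drop : Fin 3 → Fin 3 → Fin 3
drop y z = y ⊝ jump (y ⊝ z)
  where
  jump : Fin 3 → Fin 3
  jump zero             = suc (suc zero)
  jump (suc zero)       = suc zero
  jump (suc (suc zero)) = suc (suc zero)

abstract

  drop-unique : ∀ y x z → toℕ (x ⊝ z) < toℕ (y ⊝ x) → drop y z ≡ x
  drop-unique = from-yes (all? λ y → all? λ x → all? λ z → (toℕ (x ⊝ z) <? toℕ (y ⊝ x)) →-dec (drop y z Fin.≟ x))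

  rot-⊝ : ∀ i j → rot i ⊝ j ≡ i ⊝ (j ⊝ 1₃)
  rot-⊝ = from-yes (all? λ i → all? λ j → rot i ⊝ j Fin.≟ i ⊝ (j ⊝ 1₃))

  ⊝1≢ : ∀ i → i ⊝ 1₃ ≢ i
  ⊝1≢ = from-yes (all? λ i → ¬? (i ⊝ 1₃ Fin.≟ i))

-- Nobody guesses right only if the successive differences never decrease around the
-- cycle, so that they are constant; the twist on one edge excludes this when 3 ∣ n.
threes-winning : ∀ {m} → 1 ≤ m → 3 ∣ suc m → SequenceWin m (λ _ → 3)
threes-winning {m} 1≤m (divides q n≡3q) = G , unbeaten {H = λ _ → 3} {G} no-escape
  where
  inner : ∀ {i} → Dec (i ≡ m) → Fin 3 → Fin 3 → Fin 3
  inner (yes _) y z = drop y (z ⊝ 1₃)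
  inner (no  _) y z = drop y z

  G : ℕ → ℕ → ℕ → ℕ
  -- The twist: vertex 0 reads the color before it as one more, vertex `m` the color after it as one
  -- less; by `rot-⊝` both see the same difference.
  G zero    y z = toℕ (drop (rot (to₃ y)) (to₃ z))
  G (suc i) y z = toℕ (inner (suc i ≟ m) (to₃ y) (to₃ z))

  no-escape : ∀ c → (∀ i → i < suc m → c i < 3) → c (suc m) ≡ c 0 →
              ¬ (∀ i → i < suc m → G i (predecessor m c i) (c (suc i)) ≢ c i)
  no-escape c c<3 closed wrong = ⊝1≢ (C 0) (begin
      C 0 ⊝ 1₃                          ≡⟨ next-color ⟩
      C m ⊝ Δ 0                         ≡⟨ cong (_⊝ Δ 0) (retreats m ≤-refl) ⟩
      retreat (C 0) (Δ 0) (suc m)       ≡⟨ cong (retreat (C 0) (Δ 0)) n≡3q ⟩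
      retreat (C 0) (Δ 0) (q * 3)       ≡⟨ retreat-periodic (C 0) (Δ 0) q ⟩
      C 0                               ∎)
    where
    open ≡-Reasoning
    C : ℕ → Fin 3
    C i = to₃ (c i)

    next-C : ∀ i → Dec (i ≡ m) → Fin 3
    next-C i (yes _) = C 0 ⊝ 1₃
    next-C i (no  _) = C (suc i)

    Δ : ℕ → Fin 3
    Δ i = C i ⊝ next-C i (i ≟ m)

    drop-inner : ∀ i (d : Dec (suc i ≡ m)) → drop (C i) (next-C (suc i) d) ≡ inner d (C i) (C (suc (suc i)))
    drop-inner i (no  _)    = refl
    drop-inner i (yes refl) = cong (λ x → drop (C i) (to₃ x ⊝ 1₃)) (sym closed)

    rising : ∀ i → i < m → toℕ (Δ i) ≤ toℕ (Δ (suc i))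
    rising i i<m with i ≟ m
    ... | yes refl = contradiction i<m (<-irrefl refl)
    ... | no  _    = ≮⇒≥ λ falls → wrong (suc i) (s≤s i<m) (begin
      toℕ (inner (suc i ≟ m) (C i) (C (suc (suc i))))     ≡⟨ cong toℕ (drop-inner i (suc i ≟ m)) ⟨
      toℕ (drop (C i) (next-C (suc i) (suc i ≟ m)))       ≡⟨ cong toℕ (drop-unique (C i) (C (suc i)) _ falls) ⟩
      toℕ (C (suc i))                                     ≡⟨ toℕ-to₃ (c<3 (suc i) (s≤s i<m)) ⟩
      c (suc i)                                           ∎)

    wrapping : toℕ (Δ m) ≤ toℕ (Δ 0)
    wrapping with m ≟ m | 0 ≟ m
    ... | no m≢m | _        = contradiction refl m≢m
    ... | yes _  | yes refl = contradiction 1≤m λ ()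
    ... | yes _  | no  _    = ≮⇒≥ λ falls → wrong 0 (s≤s z≤n) (trans
      (cong toℕ (drop-unique (rot (C m)) (C 0) (C 1) (subst (λ d → toℕ (C 0 ⊝ C 1) < toℕ d) (sym (rot-⊝ (C m) (C 0))) falls)))
      (toℕ-to₃ (c<3 0 (s≤s z≤n))))

    up-from-0 : ∀ i → i ≤ m → toℕ (Δ 0) ≤ toℕ (Δ i)
    up-from-0 zero    _   = ≤-refl
    up-from-0 (suc i) i<m = ≤-trans (up-from-0 i (<⇒≤ i<m)) (rising i i<m)

    up-to-m : ∀ l i → l + i ≡ m → toℕ (Δ i) ≤ toℕ (Δ m)
    up-to-m zero    i refl = ≤-refl
    up-to-m (suc l) i l+i≡m = ≤-trans (rising i (subst (suc i ≤_) l+i≡m (s≤s (m≤n+m i l))))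
      (up-to-m l (suc i) (trans (+-suc l i) l+i≡m))

    constant : ∀ i → i ≤ m → Δ i ≡ Δ 0
    constant i i≤m = toℕ-injective (≤-antisym
      (≤-trans (up-to-m (m ∸ i) i (m∸n+n≡m i≤m)) wrapping) (up-from-0 i i≤m))

    next≡ : ∀ i → i ≤ m → next-C i (i ≟ m) ≡ C i ⊝ Δ 0
    next≡ i i≤m = trans (sym (i⊝[i⊝j]≡j (C i) (next-C i (i ≟ m)))) (cong (C i ⊝_) (constant i i≤m))

    retreats : ∀ i → i ≤ m → C i ≡ retreat (C 0) (Δ 0) i
    retreats zero    _   = refl
    retreats (suc i) i<m with next≡ i (<⇒≤ i<m) | retreats i (<⇒≤ i<m)
    ... | eq | ih with i ≟ m
    ...   | yes refl = contradiction i<m (<-irrefl refl)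
    ...   | no  _    = trans eq (cong (_⊝ Δ 0) ih)

    next-color : C 0 ⊝ 1₃ ≡ C m ⊝ Δ 0
    next-color with next≡ m ≤-refl
    ... | eq with m ≟ m
    ...   | yes _   = eq
    ...   | no  m≢m = contradiction refl m≢m

table : List (List ℕ) → ℕ → ℕ → ℕ
table rows y z = nth 0 (nth [] rows y) z

-- Table `i` has the color before vertex `i` as row and the color after it as column; all 81
-- colorings are checked in `by-cases`.
SquareTables : List (List (List ℕ))
SquareTables =
  ((2 ∷ 0 ∷ 0 ∷ []) ∷ (1 ∷ 2 ∷ 0 ∷ []) ∷ (1 ∷ 1 ∷ 2 ∷ []) ∷ []) ∷
  ((0 ∷ 1 ∷ 0 ∷ []) ∷ (2 ∷ 2 ∷ 1 ∷ []) ∷ (1 ∷ 2 ∷ 0 ∷ []) ∷ []) ∷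
  ((1 ∷ 1 ∷ 0 ∷ []) ∷ (1 ∷ 0 ∷ 2 ∷ []) ∷ (0 ∷ 2 ∷ 2 ∷ []) ∷ []) ∷
  ((2 ∷ 0 ∷ 1 ∷ []) ∷ (2 ∷ 1 ∷ 2 ∷ []) ∷ (1 ∷ 0 ∷ 0 ∷ []) ∷ []) ∷ []

square-winning : SequenceWin 3 (λ _ → 3)
square-winning = G , unbeaten {H = λ _ → 3} {G} λ c c<3 closed wrong →
  let c₀<3 = c<3 0 (s≤s z≤n)
      c₁<3 = c<3 1 (s≤s (s≤s z≤n))
      c₂<3 = c<3 2 (s≤s (s≤s (s≤s z≤n)))
      c₃<3 = c<3 3 (s≤s (s≤s (s≤s (s≤s z≤n)))) in
  case guessed c₀<3 c₁<3 c₂<3 c₃<3 of λ where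
    (inj₁ e)               → wrong 0 (s≤s z≤n) e
    (inj₂ (inj₁ e))        → wrong 1 (s≤s (s≤s z≤n)) e
    (inj₂ (inj₂ (inj₁ e))) → wrong 2 (s≤s (s≤s (s≤s z≤n))) e
    (inj₂ (inj₂ (inj₂ e))) → wrong 3 (s≤s (s≤s (s≤s (s≤s z≤n)))) (trans (cong (G 3 (c 2)) closed) e)
  where
  G : ℕ → ℕ → ℕ → ℕ
  G i = table (nth [] SquareTables i)

  Guessed : ℕ → ℕ → ℕ → ℕ → Set
  Guessed x y z t = G 0 t y ≡ x ⊎ G 1 x z ≡ y ⊎ G 2 y t ≡ z ⊎ G 3 z x ≡ t

  guessed : ∀ {x y z t} → x < 3 → y < 3 → z < 3 → t < 3 → Guessed x y z t
  guessed {x} {y} {z} {t} x<3 y<3 z<3 t<3 = by-cases x<3 y<3 z<3 t<3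
    where
    abstract
      by-cases : ∀ {x} → x < 3 → ∀ {y} → y < 3 → ∀ {z} → z < 3 → ∀ {t} → t < 3 → Guessed x y z t
      by-cases = from-yes (allUpTo? (λ x → allUpTo? (λ y → allUpTo? (λ z → allUpTo? (λ t →
        (G 0 t y ≟ x) ⊎-dec (G 1 x z ≟ y) ⊎-dec (G 2 y t ≟ z) ⊎-dec (G 3 z x ≟ t)) 3) 3) 3) 3)


-- Triangles: bets on a residue

turn : ∀ a .{{_ : NonZero a}} → ℕ → ℕ
turn a q = (a ∸ q % a) % a

turn-unique : ∀ a .{{_ : NonZero a}} {x} q → x < a → (x + q) % a ≡ 0 → x ≡ turn a q
turn-unique a {x} q x<a x+q≡0 with x + q % a <? a
... | yes small = trans x≡0 (sym (trans (cong (λ r → (a ∸ r) % a) r≡0) (n%n≡0 a)))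
  where
  sum≡0 : x + q % a ≡ 0
  sum≡0 = trans (sym (m<n⇒m%n≡m small)) (trans (trans (%-distribˡ-+ x (q % a) a)
    (trans (cong (λ r → (x % a + r) % a) (m%n%n≡m%n q a)) (sym (%-distribˡ-+ x q a)))) x+q≡0)
  x≡0 : x ≡ 0
  x≡0 = m+n≡0⇒m≡0 x sum≡0
  r≡0 : q % a ≡ 0
  r≡0 = m+n≡0⇒n≡0 x sum≡0
... | no large = trans (sym (m<n⇒m%n≡m x<a)) (cong (_% a) x≡a∸r)
  where
  r = q % a
  a≤x+r : a ≤ x + r
  a≤x+r = ≮⇒≥ large
  rest≡0 : x + r ∸ a ≡ 0
  rest≡0 = trans (sym (m<n⇒m%n≡m (+-cancelʳ-< a (x + r ∸ a) a (subst (_< a + a) (sym (m∸n+n≡m a≤x+r)) (+-mono-< x<a (m%n<n q a))))))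
    (trans (m≤n⇒[n∸m]%m≡n%m a≤x+r) (trans (%-distribˡ-+ x r a)
      (trans (cong (λ r → (x % a + r) % a) (m%n%n≡m%n q a)) (trans (sym (%-distribˡ-+ x q a)) x+q≡0))))
  x≡a∸r : x ≡ a ∸ r
  x≡a∸r = trans (sym (m+n∸n≡m x r)) (cong (_∸ r) (≤-antisym (m∸n≡0⇒m≤n rest≡0) a≤x+r))

-- A unit step of `x` moves the residue by `M`, so only one `x` brings it into a window of length
-- `M`; division by `M` turns this into a congruence modulo `a`.
interval-unique : ∀ a M .{{_ : NonZero a}} .{{_ : NonZero M}} .{{_ : NonZero (a * M)}} {x} t →
                  x < a → (M * x + t) % (a * M) < M → x ≡ turn a (t / M)
interval-unique a M {x} t x<a small = turn-unique a (t / M) x<a (begin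
  (x + t / M) % a                 ≡⟨ cong (λ q → (q + t / M) % a) (trans (sym (m*n/n≡m x M)) (cong (_/ M) (*-comm x M))) ⟩
  (M * x / M + t / M) % a         ≡⟨ cong (_% a) (+-distrib-/-∣ˡ t (divides x (*-comm M x))) ⟨
  (M * x + t) / M % a             ≡⟨ m%[n*o]/o≡m/o%n (M * x + t) a M {{it}} {{it}} {{m*n≢0 a M}} ⟨
  (M * x + t) % (a * M) / M       ≡⟨ m<n⇒m/n≡0 small ⟩
  0                               ∎)
  where open ≡-Reasoning

shift-% : ∀ N .{{_ : NonZero N}} {K} s → K ≤ N → K ≤ s % N → (s + (N ∸ K)) % N ≡ s % N ∸ K
shift-% N {K} s K≤N K≤r = begin
  (s + (N ∸ K)) % N                   ≡⟨ %-distribˡ-+ s (N ∸ K) N ⟩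
  (s % N + (N ∸ K) % N) % N           ≡⟨ cong (λ r → (r + (N ∸ K) % N) % N) (m%n%n≡m%n s N) ⟨
  (s % N % N + (N ∸ K) % N) % N       ≡⟨ %-distribˡ-+ (s % N) (N ∸ K) N ⟨
  (s % N + (N ∸ K)) % N               ≡⟨ cong (_% N) rearrange ⟩
  (s % N ∸ K + N) % N                 ≡⟨ [m+n]%n≡m%n (s % N ∸ K) N ⟩
  (s % N ∸ K) % N                     ≡⟨ m<n⇒m%n≡m (≤-<-trans (m∸n≤m (s % N) K) (m%n<n s N)) ⟩
  s % N ∸ K                           ∎
  where
  open ≡-Reasoning
  rearrange : s % N + (N ∸ K) ≡ s % N ∸ K + N
  rearrange = trans (cong (_+ (N ∸ K)) (sym (m∸n+n≡m K≤r))) (trans (+-assoc (s % N ∸ K) K (N ∸ K))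
    (cong (s % N ∸ K +_) (m+[n∸m]≡n K≤N)))

-- With weights M₀ = bc, M₁ = ca, M₂ = ab, the three players bet that the residue of
-- M₀ x + M₁ y + M₂ z modulo abc lies in the first M₀, the next M₁ or the last M₂ residues;
-- each can guess accordingly, since the own color moves the sum in steps of the own weight.
triangle-winning : ∀ a b c .{{_ : NonZero a}} .{{_ : NonZero b}} .{{_ : NonZero c}} →
                   a * (b * c) ≤ b * c + (c * a + a * b) → SequenceWin 2 (nth 0 (a ∷ b ∷ c ∷ []))
triangle-winning a b c N≤ΣM = G , unbeaten {H = nth 0 (a ∷ b ∷ c ∷ [])} {G} no-escape
  where
  M₀ = b * c
  M₁ = c * a
  M₂ = a * b
  N  = a * (b * c)

  instance
    M₀≢0 : NonZero M₀
    M₀≢0 = m*n≢0 b c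
    M₁≢0 : NonZero M₁
    M₁≢0 = m*n≢0 c a
    M₂≢0 : NonZero M₂
    M₂≢0 = m*n≢0 a b
    N≢0 : NonZero N
    N≢0 = m*n≢0 a M₀

  -- Adding `N ∸ K` subtracts `K` modulo `N` and moves the window of the player to the residues from
  -- 0 on. Each bet is evaluated only when the residue is at least `K`, so the subtraction is not
  -- truncated there.
  t₀ t₁ t₂ : ℕ → ℕ → ℕ
  t₀ y z = M₁ * y + M₂ * z
  t₁ x z = M₀ * x + M₂ * z + (N ∸ M₀)
  t₂ x y = M₀ * x + M₁ * y + (N ∸ (M₀ + M₁))

  G : ℕ → ℕ → ℕ → ℕ
  G 0 z y = turn a (t₀ y z / M₀)
  G 1 x z = turn b (t₁ x z / M₁)
  G 2 y x = turn c (t₂ x y / M₂)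
  G (suc (suc (suc _))) _ _ = 0

  N≡bM₁ : N ≡ b * M₁
  N≡bM₁ = trans (*-comm a (b * c)) (*-assoc b c a)

  N≡cM₂ : N ≡ c * M₂
  N≡cM₂ = trans (sym (*-assoc a b c)) (*-comm (a * b) c)

  unique : ∀ e M .{{_ : NonZero e}} .{{_ : NonZero M}} {x} t → N ≡ e * M → x < e → (M * x + t) % N < M → x ≡ turn e (t / M)
  unique e M {x} t N≡eM x<e small = interval-unique e M t x<e (subst (_< M) (%-congʳ N≡eM) small)
    where instance _ = m*n≢0 e M

  no-escape : ∀ c′ → (∀ i → i < 3 → c′ i < nth 0 (a ∷ b ∷ c ∷ []) i) → c′ 3 ≡ c′ 0 →
              ¬ (∀ i → i < 3 → G i (predecessor 2 c′ i) (c′ (suc i)) ≢ c′ i)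
  no-escape color color< closed wrong = split (r <? M₀)
    where
    x = color 0
    y = color 1
    z = color 2
    s = M₀ * x + (M₁ * y + M₂ * z)
    r = s % N

    last : M₀ + M₁ ≤ r → ⊥
    last M₀+M₁≤r = wrong 2 (s≤s (s≤s (s≤s z≤n))) (sym (trans
      (unique c M₂ (t₂ x y) N≡cM₂ (color< 2 (s≤s (s≤s (s≤s z≤n)))) (subst (_< M₂) (trans (sym (shift-% N s K≤N M₀+M₁≤r)) (cong (_% N) rearrange)) small))
      (cong (λ x → G 2 y x) (sym closed))))
      where
      K≤N : M₀ + M₁ ≤ N
      K≤N = ≤-trans M₀+M₁≤r (<⇒≤ (m%n<n s N))
      small : r ∸ (M₀ + M₁) < M₂
      small = +-cancelʳ-< (M₀ + M₁) (r ∸ (M₀ + M₁)) M₂ (subst₂ _<_ (sym (m∸n+n≡m M₀+M₁≤r)) (+-comm (M₀ + M₁) M₂)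
        (<-≤-trans (m%n<n s N) (≤-trans N≤ΣM (≤-reflexive (sym (+-assoc M₀ M₁ M₂))))))
      rearrange : s + (N ∸ (M₀ + M₁)) ≡ M₂ * z + t₂ x y
      rearrange = solve 4 (λ p q r k → (p :+ (q :+ r)) :+ k := r :+ ((p :+ q) :+ k)) refl (M₀ * x) (M₁ * y) (M₂ * z) _
        where open +-*-Solver

    middle : M₀ ≤ r → r ∸ M₀ < M₁ → ⊥
    middle M₀≤r small = wrong 1 (s≤s (s≤s z≤n)) (sym
      (unique b M₁ (t₁ x z) N≡bM₁ (color< 1 (s≤s (s≤s z≤n)))
        (subst (_< M₁) (trans (sym (shift-% N s M₀≤N M₀≤r)) (cong (_% N) rearrange)) small)))
      where
      M₀≤N : M₀ ≤ N
      M₀≤N = ≤-trans M₀≤r (<⇒≤ (m%n<n s N))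
      rearrange : s + (N ∸ M₀) ≡ M₁ * y + t₁ x z
      rearrange = solve 4 (λ p q r k → (p :+ (q :+ r)) :+ k := q :+ ((p :+ r) :+ k)) refl (M₀ * x) (M₁ * y) (M₂ * z) _
        where open +-*-Solver

    split : Dec (r < M₀) → ⊥
    split (yes small) = wrong 0 (s≤s z≤n) (sym (unique a M₀ (t₀ y z) refl (color< 0 (s≤s z≤n)) small))
    split (no  large) with r ∸ M₀ <? M₁
    ... | yes small  = middle (≮⇒≥ large) small
    ... | no  large′ = last (subst (M₀ + M₁ ≤_) (m+[n∸m]≡n (≮⇒≥ large)) (+-monoʳ-≤ M₀ (≮⇒≥ large′)))

-- Transmitting a bit through vertices with four colors

lo hi : ℕ → Bool
lo 1 = true
lo 3 = true
lo _ = false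
hi 2 = true
hi 3 = true
hi _ = false

pair : Bool → Bool → ℕ
pair false false = 0
pair true  false = 1
pair false true  = 2
pair true  true  = 3

pair-lo-hi : ∀ {c} → c < 4 → pair (lo c) (hi c) ≡ c
pair-lo-hi {0} _ = refl
pair-lo-hi {1} _ = refl
pair-lo-hi {2} _ = refl
pair-lo-hi {3} _ = refl
pair-lo-hi {suc (suc (suc (suc _)))} (s≤s (s≤s (s≤s (s≤s ()))))

-- A player with four colors who guesses (¬ b , b′) and is wrong transmits the implication
-- "the low bit is ¬ b ⇒ the high bit is ¬ b′".
transmit : ∀ {c b b′} → c < 4 → lo c ≡ not b → pair (not b) b′ ≢ c → b′ ≡ not (hi c)
transmit {c} {b} {b′} c<4 lo≡ wrong = Bool.¬-not λ b′≡hi →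
  wrong (trans (cong₂ pair (sym lo≡) b′≡hi) (pair-lo-hi c<4))

climb : ∀ {E : ℕ → Set} k → (∀ {i} → i < k → E i → E (suc i)) → E 0 → E k
climb zero    step E₀ = E₀
climb (suc k) step E₀ = step ≤-refl (climb k (step ∘ m<n⇒m<1+n) E₀)

-- The three special vertices of the pattern. Vertex 2 sees the bit `a` on its far side, vertex 0
-- the bit `b`; the premise of `sound` is the implication that a chain of wrong guesses between them
-- establishes. If the two are adjacent, `a` is `β x` and `b` is `α z`, and the premise is trivial.
record Kernel (h₀ h₁ h₂ : ℕ) : Set where
  field
    α β  : ℕ → Bool
    g₀   : Bool → ℕ → ℕ
    g₁   : ℕ → ℕ → ℕ
    g₂   : ℕ → Bool → ℕ
    sound : ∀ a b {x} → x < h₀ → ∀ {y} → y < h₁ → ∀ {z} → z < h₂ → (a ≡ not (α z) → β x ≡ not b) →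
            g₀ b y ≡ x ⊎ g₁ x z ≡ y ⊎ g₂ y a ≡ z

-- The vertices 3, …, 2 + j with four colors transmit the bit α of vertex 2 to the bit β of
-- vertex 0, as if these two vertices were adjacent.
kernel-winning : ∀ {h₀ h₁ h₂} → Kernel h₀ h₁ h₂ → ∀ j → SequenceWin (2 + j) (nth 4 (h₀ ∷ h₁ ∷ h₂ ∷ []))
kernel-winning {h₀} {h₁} {h₂} kernel j = G , unbeaten {H = H} {G} no-escape
  where
  open Kernel kernel

  H : ℕ → ℕ
  H = nth 4 (h₀ ∷ h₁ ∷ h₂ ∷ [])

  High : ℕ → ℕ → Bool
  High 2 = α
  High _ = hi

  low-at : ∀ {i} → Dec (i ≡ 3 + j) → ℕ → Bool
  low-at (yes _) = β
  low-at (no  _) = lo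

  Low : ℕ → ℕ → Bool
  Low i = low-at (i ≟ 3 + j)

  G : ℕ → ℕ → ℕ → ℕ
  G 0 y z = g₀ (High (2 + j) y) z
  G 1 y z = g₁ y z
  G 2 y z = g₂ y (Low 3 z)
  G (suc (suc (suc i))) y z = pair (not (High (2 + i) y)) (Low (4 + i) z)

  no-escape : ∀ c → (∀ i → i < 3 + j → c i < H i) → c (3 + j) ≡ c 0 →
              ¬ (∀ i → i < 3 + j → G i (predecessor (2 + j) c i) (c (suc i)) ≢ c i)
  no-escape c c<H closed wrong =
    case sound (Low 3 (c 3)) (High (2 + j) (c (2 + j))) (c<H 0 (s≤s z≤n)) (c<H 1 (s≤s (s≤s z≤n)))
           (c<H 2 (s≤s (s≤s (s≤s z≤n)))) (λ first → trans (sym last-low) (climb {E} j step first)) of λ where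
      (inj₁ e)        → wrong 0 (s≤s z≤n) e
      (inj₂ (inj₁ e)) → wrong 1 (s≤s (s≤s z≤n)) e
      (inj₂ (inj₂ e)) → wrong 2 (s≤s (s≤s (s≤s z≤n))) e
    where
    E : ℕ → Set
    E i = Low (3 + i) (c (3 + i)) ≡ not (High (2 + i) (c (2 + i)))

    step : ∀ {i} → i < j → E i → E (suc i)
    step {i} i<j Eᵢ with 3 + i ≟ 3 + j
    ... | yes eq = contradiction i<j (<-irrefl (+-cancelˡ-≡ 3 i j eq))
    ... | no  _  = transmit (c<H (3 + i) 3+i<n) Eᵢ (wrong (3 + i) 3+i<n)
      where
      3+i<n : 3 + i < 3 + j
      3+i<n = s≤s (s≤s (s≤s i<j))

    last-low : Low (3 + j) (c (3 + j)) ≡ β (c 0)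
    last-low with 3 + j ≟ 3 + j
    ... | yes _  = cong β closed
    ... | no  ≢n = contradiction refl ≢n

bit : ℕ → Bool
bit 0 = false
bit _ = true

index : Bool → ℕ
index false = 0
index true  = 1

decide-kernel : ∀ {h₀ h₁ h₂} (α β : ℕ → Bool) (g₀ : Bool → ℕ → ℕ) (g₁ : ℕ → ℕ → ℕ) (g₂ : ℕ → Bool → ℕ) → ∀ a b →
  Dec (∀ {x} → x < h₀ → ∀ {y} → y < h₁ → ∀ {z} → z < h₂ → (a ≡ not (α z) → β x ≡ not b) →
       g₀ b y ≡ x ⊎ g₁ x z ≡ y ⊎ g₂ y a ≡ z)
decide-kernel {h₀} {h₁} {h₂} α β g₀ g₁ g₂ a b =
  allUpTo? (λ x → allUpTo? (λ y → allUpTo? (λ z → ((a Bool.≟ not (α z)) →-dec (β x Bool.≟ not b)) →-dec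
    ((g₀ b y ≟ x) ⊎-dec (g₁ x z ≟ y) ⊎-dec (g₂ y a ≟ z))) h₂) h₁) h₀

two : ℕ → Bool
two 2 = true
two _ = false

kernel-233 : Kernel 2 3 3
kernel-233 = record
  { α = α ; β = β ; g₀ = g₀ ; g₁ = g₁ ; g₂ = g₂
  ; sound = λ where
      false false → from-yes (decide-kernel {2} {3} {3} α β g₀ g₁ g₂ false false)
      false true  → from-yes (decide-kernel {2} {3} {3} α β g₀ g₁ g₂ false true)
      true  false → from-yes (decide-kernel {2} {3} {3} α β g₀ g₁ g₂ true  false)
      true  true  → from-yes (decide-kernel {2} {3} {3} α β g₀ g₁ g₂ true  true)
  }
  where
  α β : ℕ → Bool
  α = two
  β = bit
  g₀ : Bool → ℕ → ℕ
  g₀ b y = nth 0 (nth [] ((0 ∷ 0 ∷ []) ∷ (1 ∷ 1 ∷ []) ∷ (1 ∷ 0 ∷ []) ∷ []) y) (index b)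
  g₁ : ℕ → ℕ → ℕ
  g₁ = table ((2 ∷ 1 ∷ 1 ∷ []) ∷ (2 ∷ 0 ∷ 0 ∷ []) ∷ [])
  g₂ : ℕ → Bool → ℕ
  g₂ y a = nth 0 (nth [] ((0 ∷ 0 ∷ []) ∷ (0 ∷ 0 ∷ []) ∷ (1 ∷ 2 ∷ []) ∷ []) y) (index a)

kernel-323 : Kernel 3 2 3
kernel-323 = record
  { α = α ; β = β ; g₀ = g₀ ; g₁ = g₁ ; g₂ = g₂
  ; sound = λ where
      false false → from-yes (decide-kernel {3} {2} {3} α β g₀ g₁ g₂ false false)
      false true  → from-yes (decide-kernel {3} {2} {3} α β g₀ g₁ g₂ false true)
      true  false → from-yes (decide-kernel {3} {2} {3} α β g₀ g₁ g₂ true  false)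
      true  true  → from-yes (decide-kernel {3} {2} {3} α β g₀ g₁ g₂ true  true)
  }
  where
  α β : ℕ → Bool
  α = two
  β = two
  g₀ : Bool → ℕ → ℕ
  g₀ b y = nth 0 (nth [] ((0 ∷ 0 ∷ []) ∷ (2 ∷ 1 ∷ []) ∷ []) y) (index b)
  g₁ : ℕ → ℕ → ℕ
  g₁ = table ((1 ∷ 1 ∷ 1 ∷ []) ∷ (1 ∷ 0 ∷ 0 ∷ []) ∷ (1 ∷ 0 ∷ 0 ∷ []) ∷ [])
  g₂ : ℕ → Bool → ℕ
  g₂ y a = nth 0 (nth [] ((0 ∷ 0 ∷ []) ∷ (1 ∷ 2 ∷ []) ∷ []) y) (index a)

-- Paths between two vertices with two colors

module _ {m : ℕ} (3≤n : 3 ≤ suc m) (p q : Fin (suc m)) where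

  private
    n = suc m

  Deleted : Fin n → Fin n → Set
  Deleted v u = (v ≡ p × u ≡ q) ⊎ (v ≡ q × u ≡ p)

  Kept : Fin n → Fin n → Set
  Kept v u = CycleAdjacent v u × ¬ Deleted v u

  kept? : ∀ v u → Dec (Kept v u)
  kept? v u = cycleAdjacent? v u ×-dec ¬? (((v Fin.≟ p) ×-dec (u Fin.≟ q)) ⊎-dec ((v Fin.≟ q) ×-dec (u Fin.≟ p)))

  keptNeighbours : Fin n → Subset n
  keptNeighbours v = tabulate (λ u → does (kept? v u))

  ∈-kept⁺ : ∀ {v u} → Kept v u → u ∈ keptNeighbours v
  ∈-kept⁺ {v} {u} kept = lookup⇒[]= u _ (trans (lookup∘tabulate (λ u → does (kept? v u)) u) (dec-true (kept? v u) kept))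

  ∈-kept⁻ : ∀ {v u} → u ∈ keptNeighbours v → Kept v u
  ∈-kept⁻ {v} {u} u∈N with kept? v u in eq
  ... | yes kept = kept
  ... | no  _    = contradiction (trans (sym (trans (lookup∘tabulate (λ u → does (kept? v u)) u) (cong does eq))) ([]=⇒lookup u∈N)) λ ()

  cycleWithoutEdge : Graph n
  cycleWithoutEdge = record
    { vertices            = ⊤
    ; neighbours          = keptNeighbours
    ; neighbours⊆vertices = λ _ _ → ∈⊤
    ; symmetric           = λ u∈N → let adjacent , kept = ∈-kept⁻ u∈N in
        ∈-kept⁺ ([ inj₂ , inj₁ ]′ adjacent , λ { (inj₁ (e , e′)) → kept (inj₂ (e′ , e)) ; (inj₂ (e , e′)) → kept (inj₁ (e′ , e)) })
    ; irreflexive         = λ v v∈N → irreflexive (cycle n 3≤n) v (∈-cycleNeighbours⁺ (proj₁ (∈-kept⁻ v∈N)))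
    }

  cycleWithoutEdge⊂ : q ∈ cycleNeighbours p → cycleWithoutEdge ⊂ᴳ cycle n 3≤n
  cycleWithoutEdge⊂ q∈N = (id , λ v u∈N → ∈-cycleNeighbours⁺ (proj₁ (∈-kept⁻ u∈N))) ,
    λ (_ , ⊆N) → proj₂ (∈-kept⁻ (⊆N p q∈N)) (inj₁ (refl , refl))

module _ {m : ℕ} (3≤n : 3 ≤ suc m) {h : Fin (suc m) → ℕ} (1≤h : ∀ v → 1 ≤ h v) (d : Direction) (a : Fin (suc m)) where

  private
    e : ℕ → Fin (suc m)
    e = walk d a

  e-injective : ∀ {i j} → i ≤ m → j ≤ m → e i ≡ e j → i ≡ j
  e-injective i≤m j≤m eq = trans (sym (position-walk d a (s≤s i≤m))) (trans (cong (position d a) eq) (position-walk d a (s≤s j≤m)))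

  e-kept : ∀ {i} → suc i ≤ m → Kept 3≤n a (e m) (e i) (e (suc i)) × Kept 3≤n a (e m) (e (suc i)) (e i)
  e-kept {i} i<m = (∈-cycleNeighbours⁻ (after∈N d (e i)) , λ where
      (inj₁ (e₁ , e₂)) → impossible (e-injective {0} {i} z≤n (<⇒≤ i<m) (sym e₁)) (e-injective i<m ≤-refl e₂)
      (inj₂ (e₁ , e₂)) → contradiction (e-injective (<⇒≤ i<m) ≤-refl e₁) (<⇒≢ i<m)) ,
    (∈-cycleNeighbours⁻ (subst (_∈ cycleNeighbours (e (suc i))) (before-after d (e i)) (before∈N d (e (suc i)))) , λ where
      (inj₁ (e₁ , e₂)) → contradiction (e-injective {suc i} {0} i<m z≤n e₁) λ ()
      (inj₂ (e₁ , e₂)) → impossible (sym (e-injective {i} {0} (<⇒≤ i<m) z≤n e₂)) (e-injective i<m ≤-refl e₁))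
    where
    impossible : 0 ≡ i → suc i ≡ m → ⊥
    impossible 0≡i 1+i≡m = contradiction (s≤s⁻¹ 3≤n) (<⇒≱ (subst (_< 2) 1+i≡m (subst (λ i → suc i < 2) 0≡i ≤-refl)))

  -- The bits α, β of kernel-winning are here the colors of the two ends.
  path-winning : ∀ j → suc j ≤ m → h a ≡ 2 → h (e (suc j)) ≡ 2 → (∀ i → 0 < i → i < suc j → h (e i) ≤ 4) →
                 Winning (cycleWithoutEdge 3≤n a (e m)) h
  path-winning j j<m h₀≡2 hⱼ≡2 h≤4 = winning⁺ (cycleWithoutEdge 3≤n a (e m)) 1≤h F
    (λ v eq → cong₂ (G (position d a v)) (eq (before d v)) (eq (after d v))) won
    where
    High : ℕ → ℕ → Bool
    High 0 = bit
    High _ = hi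

    low-at : ∀ {i} → Dec (i ≡ suc j) → ℕ → Bool
    low-at (yes _) = bit
    low-at (no  _) = lo

    Low : ℕ → ℕ → Bool
    Low i = low-at (i ≟ suc j)

    inner : ∀ {i} → Dec (i ≡ suc j) → ℕ → ℕ → ℕ → ℕ
    inner     (yes _) i y z = index (not (High i y))
    inner     (no  _) i y z = pair (not (High i y)) (Low (2 + i) z)

    -- The first end guesses the bit it sees, so its mistake is `E 0`. The far end guesses the bit
    -- that `E j` predicts for it, so it is right once the implications have been passed along the
    -- path.
    G : ℕ → ℕ → ℕ → ℕ
    G zero    y z = index (Low 1 z)
    G (suc i) y z = inner (suc i ≟ suc j) i y z

    F : Fin (suc m) → (Fin (suc m) → ℕ) → ℕ
    F v C = G (position d a v) (C (before d v)) (C (after d v))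

    N : Fin (suc m) → Subset (suc m)
    N = keptNeighbours 3≤n a (e m)

    seen-before : ∀ C {i} → suc i ≤ m → mask (N (e (suc i))) C (before d (e (suc i))) ≡ C (e i)
    seen-before C {i} i<m = trans (cong (mask (N (e (suc i))) C) (before-after d (e i)))
      (mask-∈ C (∈-kept⁺ 3≤n a (e m) (proj₂ (e-kept i<m))))

    seen-after : ∀ C {i} → suc i ≤ m → mask (N (e i)) C (e (suc i)) ≡ C (e (suc i))
    seen-after C i<m = mask-∈ C (∈-kept⁺ 3≤n a (e m) (proj₁ (e-kept i<m)))

    index-bit : ∀ {x} → x < 2 → index (bit x) ≡ x
    index-bit {0} _ = refl
    index-bit {1} _ = refl
    index-bit {suc (suc _)} (s≤s (s≤s ()))

    won : ∀ C → (∀ v → C v < h v) → ∃[ v ] v ∈ ⊤ × F v (mask (N v) C) ≡ C v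
    won C C<h with any? (λ v → F v (mask (N v) C) ≟ C v)
    ... | yes (v , eq) = v , ∈⊤ , eq
    ... | no  nobody   = contradiction (climb {E} j step first) last
      where
      c : ℕ → ℕ
      c i = C (e i)

      E : ℕ → Set
      E i = Low (suc i) (c (suc i)) ≡ not (High i (c i))

      wrong : ∀ {i} → i ≤ m → G i (mask (N (e i)) C (before d (e i))) (mask (N (e i)) C (e (suc i))) ≢ c i
      wrong {i} i≤m eq = nobody (e i , trans (cong (λ l → G l (mask (N (e i)) C (before d (e i))) (mask (N (e i)) C (e (suc i)))) (position-walk d a (s≤s i≤m))) eq)

      first : E 0
      first = Bool.¬-not λ eq → wrong {0} z≤n (trans (cong (λ z → index (Low 1 z)) (seen-after C (≤-trans (s≤s z≤n) j<m)))
        (trans (cong index eq) (index-bit (subst (c 0 <_) h₀≡2 (C<h a)))))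

      wrong′ : ∀ {i} → suc i ≤ m → inner (suc i ≟ suc j) i (c i) (mask (N (e (suc i))) C (e (2 + i))) ≢ c (suc i)
      wrong′ {i} i<m eq = wrong i<m (trans (cong (λ y → inner (suc i ≟ suc j) i y (mask (N (e (suc i))) C (e (2 + i)))) (seen-before C i<m)) eq)

      step : ∀ {i} → i < j → E i → E (suc i)
      step {i} i<j Eᵢ with suc i ≟ suc j | wrong′ (≤-trans (s≤s (<⇒≤ i<j)) j<m)
      ... | yes eq | _      = contradiction i<j (<-irrefl (suc-injective eq))
      ... | no  _  | wrongᵢ = transmit (<-≤-trans (C<h (e (suc i))) (h≤4 (suc i) (s≤s z≤n) (s≤s i<j))) Eᵢ
        λ eq → wrongᵢ (trans (cong (λ z → pair (not (High i (c i))) (Low (2 + i) z)) (seen-after C (≤-trans (s≤s i<j) j<m))) eq)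

      last : ¬ E j
      last Eⱼ with suc j ≟ suc j | wrong′ {j} j<m
      ... | no  ≢j | _      = contradiction refl ≢j
      ... | yes _  | wrongⱼ = wrongⱼ (trans (cong index (sym Eⱼ)) (index-bit (subst (c (suc j) <_) hⱼ≡2 (C<h (e (suc j))))))

  -- The path stops before it returns to `a`, so it avoids the edge that closes the walk; deleting
  -- this edge makes the subgame proper.
  path-subgame : ∀ j → suc j ≤ m → h a ≡ 2 → h (e (suc j)) ≡ 2 → (∀ i → 0 < i → i < suc j → h (e i) ≤ 4) →
                 HasWinningProperSubgame (cycle (suc m) 3≤n) h
  path-subgame j j<m h₀≡2 hⱼ≡2 h≤4 = cycleWithoutEdge 3≤n a (e m) ,
    cycleWithoutEdge⊂ 3≤n a (e m) (subst (_∈ cycleNeighbours a) (sym (trans (walk-predecessor 3≤n 1≤h d a 0) refl)) (before∈N d a)) ,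
    path-winning j j<m h₀≡2 hⱼ≡2 h≤4

-- A coloring is determined by a player who guesses right and the colors of the others.
triangle-counting : ∀ {H} → SequenceWin 2 H → H 0 * (H 1 * H 2) ≤ H 1 * H 2 + (H 2 * H 0 + H 0 * H 1)
triangle-counting {H} (G , wins) = injective⇒≤ {f = f} f-injective
  where
  a = H 0
  b = H 1
  c = H 2

  Colors₃ : Set
  Colors₃ = Fin a × (Fin b × Fin c)

  Guessed : Colors₃ → Set
  Guessed (x , y , z) = G 0 (toℕ z) (toℕ y) ≡ toℕ x ⊎ G 1 (toℕ x) (toℕ z) ≡ toℕ y ⊎ G 2 (toℕ y) (toℕ x) ≡ toℕ z

  guessed : ∀ t → Guessed t
  guessed (x , y , z) = conclude (wins color color<H refl)
    where
    color : ℕ → ℕ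
    color 1 = toℕ y
    color 2 = toℕ z
    color _ = toℕ x
    color<H : ∀ i → i < 3 → color i < H i
    color<H 0 _ = toℕ<n x
    color<H 1 _ = toℕ<n y
    color<H 2 _ = toℕ<n z
    color<H (suc (suc (suc _))) (s≤s (s≤s (s≤s ())))
    conclude : (∃[ i ] i < 3 × G i (predecessor 2 color i) (color (suc i)) ≡ color i) → Guessed (x , y , z)
    conclude (0 , _ , e) = inj₁ e
    conclude (1 , _ , e) = inj₂ (inj₁ e)
    conclude (2 , _ , e) = inj₂ (inj₂ e)
    conclude (suc (suc (suc _)) , s≤s (s≤s (s≤s ())) , _)

  encode : ∀ t → Guessed t → Fin (b * c) ⊎ (Fin (c * a) ⊎ Fin (a * b))
  encode (x , y , z) (inj₁ _)        = inj₁ (combine y z)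
  encode (x , y , z) (inj₂ (inj₁ _)) = inj₂ (inj₁ (combine z x))
  encode (x , y , z) (inj₂ (inj₂ _)) = inj₂ (inj₂ (combine x y))

  encode-injective : ∀ t t′ (p : Guessed t) (p′ : Guessed t′) → encode t p ≡ encode t′ p′ → t ≡ t′
  encode-injective (x , y , z) (x′ , y′ , z′) (inj₁ p) (inj₁ p′) eq
    with combine-injective y z y′ z′ (inj₁-injective eq)
  ... | refl , refl = cong (_, (y , z)) (toℕ-injective (trans (sym p) p′))
  encode-injective (x , y , z) (x′ , y′ , z′) (inj₂ (inj₁ p)) (inj₂ (inj₁ p′)) eq
    with combine-injective z x z′ x′ (inj₁-injective (inj₂-injective eq))
  ... | refl , refl = cong (λ y → x , y , z) (toℕ-injective (trans (sym p) p′))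
  encode-injective (x , y , z) (x′ , y′ , z′) (inj₂ (inj₂ p)) (inj₂ (inj₂ p′)) eq
    with combine-injective x y x′ y′ (inj₂-injective (inj₂-injective eq))
  ... | refl , refl = cong (λ z → x , y , z) (toℕ-injective (trans (sym p) p′))
  encode-injective _ _ (inj₁ _)        (inj₂ (inj₁ _)) ()
  encode-injective _ _ (inj₁ _)        (inj₂ (inj₂ _)) ()
  encode-injective _ _ (inj₂ (inj₁ _)) (inj₁ _)        ()
  encode-injective _ _ (inj₂ (inj₂ _)) (inj₁ _)        ()
  encode-injective _ _ (inj₂ (inj₁ _)) (inj₂ (inj₂ _)) ()
  encode-injective _ _ (inj₂ (inj₂ _)) (inj₂ (inj₁ _)) ()

  merge : ∀ k m n → Fin k ⊎ (Fin m ⊎ Fin n) → Fin (k + (m + n))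
  merge k m n = join k (m + n) ∘ map₂ (join m n)

  merge-injective : ∀ k m n {s t} → merge k m n s ≡ merge k m n t → s ≡ t
  merge-injective k m n {s} {t} eq = trans (sym (undo s)) (trans (cong (map₂ (splitAt m) ∘ splitAt k) eq) (undo t))
    where
    undo : ∀ s → map₂ (splitAt m) (splitAt k (merge k m n s)) ≡ s
    undo s = trans (cong (map₂ (splitAt m)) (splitAt-join k (m + n) (map₂ (join m n) s))) (inner s)
      where
      inner : ∀ s → map₂ (splitAt m) (map₂ (join m n) s) ≡ s
      inner (inj₁ _) = refl
      inner (inj₂ s) = cong inj₂ (splitAt-join m n s)

  decode : Fin (a * (b * c)) → Colors₃
  decode i = let x , yz = remQuot {a} (b * c) i in x , remQuot {b} c yz

  decode-injective : ∀ {i j} → decode i ≡ decode j → i ≡ j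
  decode-injective {i} {j} eq = trans (sym (undo i)) (trans (cong (λ (x , y , z) → combine x (combine y z)) eq) (undo j))
    where
    undo : ∀ i → (let x , y , z = decode i in combine x (combine y z)) ≡ i
    undo i = trans (cong (combine (proj₁ (remQuot {a} (b * c) i))) (combine-remQuot {b} c (proj₂ (remQuot {a} (b * c) i))))
      (combine-remQuot {a} (b * c) i)

  f : Fin (a * (b * c)) → Fin (b * c + (c * a + a * b))
  f i = merge (b * c) (c * a) (a * b) (encode (decode i) (guessed (decode i)))

  f-injective : ∀ {i j} → f i ≡ f j → i ≡ j
  f-injective {i} {j} eq = decode-injective (encode-injective (decode i) (decode j) (guessed (decode i)) (guessed (decode j))
    (merge-injective (b * c) (c * a) (a * b) eq))

-- Unnormalised rationals give the sum the explicit numerator `S` and denominator `N`, free of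
-- common divisors to cancel.
module Reciprocals (a′ b′ c′ : ℕ) where

  private
    a = suc a′
    b = suc b′
    c = suc c′
    N = a * (b * c)
    S = b * c + (c * a + a * b)

    u : ℚᵘ
    u = mkℚᵘ (pos 1) a′ ℚᵘ.+ (mkℚᵘ (pos 1) b′ ℚᵘ.+ (mkℚᵘ (pos 1) c′ ℚᵘ.+ ℚᵘ.0ℚᵘ))

    q : ℚ
    q = (pos 1 ℚ./ a) ℚ.+ ((pos 1 ℚ./ b) ℚ.+ ((pos 1 ℚ./ c) ℚ.+ 0ℚ))

    toℚᵘ-q : toℚᵘ q ℚᵘ.≃ u
    toℚᵘ-q = ℚᵘ.≃-trans (ℚ.toℚᵘ-homo-+ (pos 1 ℚ./ a) _) (ℚᵘ.+-cong (ℚ.toℚᵘ-fromℚᵘ (mkℚᵘ (pos 1) a′))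
      (ℚᵘ.≃-trans (ℚ.toℚᵘ-homo-+ (pos 1 ℚ./ b) _) (ℚᵘ.+-cong (ℚ.toℚᵘ-fromℚᵘ (mkℚᵘ (pos 1) b′))
        (ℚᵘ.≃-trans (ℚ.toℚᵘ-homo-+ (pos 1 ℚ./ c) 0ℚ) (ℚᵘ.+-cong (ℚ.toℚᵘ-fromℚᵘ (mkℚᵘ (pos 1) c′)) ℚᵘ.≃-refl)))))

    numerator : ℚᵘ.↥ u ≡ pos S
    numerator = begin
      pos 1 ℤ.* pos (b * (c * 1)) ℤ.+ (pos 1 ℤ.* pos (c * 1) ℤ.+ (pos 1 ℤ.* pos 1 ℤ.+ pos 0 ℤ.* pos c) ℤ.* pos b) ℤ.* pos a
        ≡⟨ cong₂ (λ s t → s ℤ.+ (t ℤ.+ pos 1 ℤ.* pos b) ℤ.* pos a) (ℤ.*-identityˡ (pos (b * (c * 1)))) (ℤ.*-identityˡ (pos (c * 1))) ⟩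
      pos (b * (c * 1)) ℤ.+ (pos (c * 1) ℤ.+ pos 1 ℤ.* pos b) ℤ.* pos a
        ≡⟨ cong (λ t → pos (b * (c * 1)) ℤ.+ (pos (c * 1) ℤ.+ t) ℤ.* pos a) (ℤ.*-identityˡ (pos b)) ⟩
      pos (b * (c * 1)) ℤ.+ pos (c * 1 + b) ℤ.* pos a
        ≡⟨ cong (λ t → pos (b * (c * 1)) ℤ.+ t) (sym (ℤ.pos-* (c * 1 + b) a)) ⟩
      pos (b * (c * 1) + (c * 1 + b) * a)
        ≡⟨ cong pos (solve 3 (λ a b c → b :* (c :* con 1) :+ (c :* con 1 :+ b) :* a := b :* c :+ (c :* a :+ a :* b)) refl a b c) ⟩
      pos S ∎
      where
      open ≡-Reasoning
      open +-*-Solver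

    denominator : ℚᵘ.↧ u ≡ pos N
    denominator = cong (λ t → pos (a * (b * t))) (*-identityʳ c)

  reciprocals⁻ : 1ℚ ≤ℚ q → N ≤ S
  reciprocals⁻ 1≤q = ℤ.drop‿+≤+ (subst₂ ℤ._≤_ (trans (ℤ.*-identityˡ (ℚᵘ.↧ u)) denominator) (trans (ℤ.*-identityʳ (ℚᵘ.↥ u)) numerator)
    (ℚᵘ.drop-*≤* (ℚᵘ.≤-respʳ-≃ toℚᵘ-q (ℚ.toℚᵘ-mono-≤ 1≤q))))

  reciprocals⁺ : N ≤ S → 1ℚ ≤ℚ q
  reciprocals⁺ N≤S = ℚ.toℚᵘ-cancel-≤ (ℚᵘ.≤-respʳ-≃ (ℚᵘ.≃-sym toℚᵘ-q)
    (*≤* (subst₂ ℤ._≤_ (sym (trans (ℤ.*-identityˡ (ℚᵘ.↧ u)) denominator)) (sym (trans (ℤ.*-identityʳ (ℚᵘ.↥ u)) numerator)) (ℤ.+≤+ N≤S))))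

-- The shape to which `reciprocalSum` unfolds on three vertices, with the hatnesses abstracted so
-- that they can be matched as successors.
sum₃ : (a b c : ℕ) → .(NonZero a) → .(NonZero b) → .(NonZero c) → ℚ
sum₃ a b c a≢0 b≢0 c≢0 = ℚ._/_ (pos 1) a {{a≢0}} ℚ.+ (ℚ._/_ (pos 1) b {{b≢0}} ℚ.+ (ℚ._/_ (pos 1) c {{c≢0}} ℚ.+ 0ℚ))

sum₃⁻ : ∀ a b c .(a≢0 : NonZero a) .(b≢0 : NonZero b) .(c≢0 : NonZero c) →
        1ℚ ≤ℚ sum₃ a b c a≢0 b≢0 c≢0 → a * (b * c) ≤ b * c + (c * a + a * b)
sum₃⁻ (suc a) (suc b) (suc c) _ _ _ = Reciprocals.reciprocals⁻ a b c

sum₃⁺ : ∀ a b c .(a≢0 : NonZero a) .(b≢0 : NonZero b) .(c≢0 : NonZero c) →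
        a * (b * c) ≤ b * c + (c * a + a * b) → 1ℚ ≤ℚ sum₃ a b c a≢0 b≢0 c≢0
sum₃⁺ (suc a) (suc b) (suc c) _ _ _ = Reciprocals.reciprocals⁺ a b c

-- The classification

ThreeColors TriangleSum Pattern : (n : ℕ) (h : Fin n → ℕ) → (∀ v → 2 ≤ h v) → Set
ThreeColors n h 2≤h = (n ≡ 4 ⊎ 3 ∣ n) × (∀ v → h v ≤ 3)
TriangleSum n h 2≤h = n ≡ 3 × 1ℚ ≤ℚ reciprocalSum h (λ v → ≥2⇒nonZero (2≤h v))
Pattern     n h 2≤h = (∃[ a ] ∃[ b ] ∃[ c ] (Consecutive a b c ×
    ((h a ≡ 2 × h b ≡ 3 × h c ≡ 3) ⊎ (h a ≡ 3 × h b ≡ 2 × h c ≡ 3))))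
    × (∀ v → h v ≤ 4)

module _ {k : ℕ} (3≤n : 3 ≤ 3 + k) {h : Fin (3 + k) → ℕ} (2≤h : ∀ v → 2 ≤ h v) where

  private
    1≤h : ∀ v → 1 ≤ h v
    1≤h v = ≤-trans (s≤s z≤n) (2≤h v)

  threeColors⇒winning : ThreeColors (3 + k) h 2≤h → Winning (cycle (3 + k) 3≤n) h
  threeColors⇒winning (inj₁ refl , h≤3) =
    cycle-winning⁺ 3≤n 1≤h forward zero (sequenceWin-≤ (λ i _ → h≤3 (walk forward zero i)) square-winning)
  threeColors⇒winning (inj₂ 3∣n , h≤3) =
    cycle-winning⁺ 3≤n 1≤h forward zero (sequenceWin-≤ (λ i _ → h≤3 (walk forward zero i)) (threes-winning (s≤s z≤n) 3∣n))

  pattern⇒winning : Pattern (3 + k) h 2≤h → Winning (cycle (3 + k) 3≤n) h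
  pattern⇒winning ((a , b , c , consecutive , colors) , h≤4) = by-direction consecutive colors
    where
    module _ (d : Direction) (b≡ : b ≡ after d a) (c≡ : c ≡ after d b) where
      bounded : ∀ {x y z} → h a ≡ x → h b ≡ y → h c ≡ z → ∀ i → i < 3 + k → h (walk d a i) ≤ nth 4 (x ∷ y ∷ z ∷ []) i
      bounded ha≡ hb≡ hc≡ 0 _ = ≤-reflexive ha≡
      bounded ha≡ hb≡ hc≡ 1 _ = ≤-reflexive (trans (cong h (sym b≡)) hb≡)
      bounded ha≡ hb≡ hc≡ 2 _ = ≤-reflexive (trans (cong h (sym (trans c≡ (cong (after d) b≡)))) hc≡)
      bounded ha≡ hb≡ hc≡ (suc (suc (suc i))) _ = h≤4 (walk d a (3 + i))

      by-pattern : (h a ≡ 2 × h b ≡ 3 × h c ≡ 3) ⊎ (h a ≡ 3 × h b ≡ 2 × h c ≡ 3) → Winning (cycle (3 + k) 3≤n) h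
      by-pattern (inj₁ (ha≡ , hb≡ , hc≡)) =
        cycle-winning⁺ 3≤n 1≤h d a (sequenceWin-≤ (bounded ha≡ hb≡ hc≡) (kernel-winning kernel-233 k))
      by-pattern (inj₂ (ha≡ , hb≡ , hc≡)) =
        cycle-winning⁺ 3≤n 1≤h d a (sequenceWin-≤ (bounded ha≡ hb≡ hc≡) (kernel-winning kernel-323 k))

    by-direction : Consecutive a b c → (h a ≡ 2 × h b ≡ 3 × h c ≡ 3) ⊎ (h a ≡ 3 × h b ≡ 2 × h c ≡ 3) → Winning (cycle (3 + k) 3≤n) h
    by-direction (inj₁ (b≡ , c≡)) = by-pattern forward b≡ c≡
    by-direction (inj₂ (b≡ , a≡)) = by-pattern backward
      (sym (trans (cong prev a≡) (prev-next b))) (sym (trans (cong prev b≡) (prev-next c)))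

triangleSum⇒winning : ∀ (3≤3 : 3 ≤ 3) {h : Fin 3 → ℕ} (2≤h : ∀ v → 2 ≤ h v) →
                      1ℚ ≤ℚ reciprocalSum h (λ v → ≥2⇒nonZero (2≤h v)) → Winning (cycle 3 3≤3) h
triangleSum⇒winning 3≤3 {h} 2≤h 1≤sum = cycle-winning⁺ 3≤3 (λ v → ≤-trans (s≤s z≤n) (2≤h v)) forward zero
  (sequenceWin-≤ bounded (triangle-winning (h zero) (h (suc zero)) (h (suc (suc zero))) {{nz zero}} {{nz (suc zero)}} {{nz (suc (suc zero))}}
    (sum₃⁻ (h zero) (h (suc zero)) (h (suc (suc zero))) (nz zero) (nz (suc zero)) (nz (suc (suc zero))) 1≤sum)))
  where
  nz : ∀ v → NonZero (h v)
  nz v = ≥2⇒nonZero (2≤h v)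
  bounded : ∀ i → i < 3 → h (walk forward zero i) ≤ nth 0 (h zero ∷ h (suc zero) ∷ h (suc (suc zero)) ∷ []) i
  bounded 0 _ = ≤-refl
  bounded 1 _ = ≤-refl
  bounded 2 _ = ≤-refl
  bounded (suc (suc (suc _))) (s≤s (s≤s (s≤s ())))

winning⇒triangleSum : ∀ (3≤3 : 3 ≤ 3) {h : Fin 3 → ℕ} (2≤h : ∀ v → 2 ≤ h v) →
                      Winning (cycle 3 3≤3) h → 1ℚ ≤ℚ reciprocalSum h (λ v → ≥2⇒nonZero (2≤h v))
winning⇒triangleSum 3≤3 {h} 2≤h won = sum₃⁺ (h zero) (h (suc zero)) (h (suc (suc zero)))
  (≥2⇒nonZero (2≤h zero)) (≥2⇒nonZero (2≤h (suc zero))) (≥2⇒nonZero (2≤h (suc (suc zero))))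
  (triangle-counting (cycle-winning⁻ 3≤3 (λ v → ≤-trans (s≤s z≤n) (2≤h v)) forward zero won))

module _ {k : ℕ} (3≤n : 3 ≤ 4 + k) {h : Fin (4 + k) → ℕ} (2≤h : ∀ v → 2 ≤ h v) (won : Winning (cycle (4 + k) 3≤n) h) where

  private
    n m : ℕ
    n = 4 + k
    m = 3 + k

    1≤h : ∀ v → 1 ≤ h v
    1≤h v = ≤-trans (s≤s z≤n) (2≤h v)

    Conclusion : Set
    Conclusion = ThreeColors n h 2≤h ⊎ TriangleSum n h 2≤h ⊎ HasWinningProperSubgame (cycle n 3≤n) h ⊎ Pattern n h 2≤h

    ≢2⇒≥3 : ∀ v → h v ≢ 2 → 3 ≤ h v
    ≢2⇒≥3 v h≢2 = ≤∧≢⇒< (2≤h v) (≢-sym h≢2)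

    win : ∀ d a → SequenceWin m (h ∘ walk d a)
    win d a = cycle-winning⁻ 3≤n 1≤h d a won

    walk-m : ∀ d a → walk d a m ≡ before d a
    walk-m d a = walk-predecessor 3≤n 1≤h d a 0

  all-≥3 : (∀ v → 3 ≤ h v) → Conclusion
  all-≥3 3≤h = by-≥4 (any? λ v → 4 ≤? h v)
    where
    all-3 : (∀ v → h v ≡ 3) → Dec (3 ∣ n) → Conclusion
    all-3 h≡3 (yes 3∣n) = inj₁ (inj₂ 3∣n , λ v → ≤-reflexive (h≡3 v))
    all-3 h≡3 (no  3∤n) = by-length k refl
      where
      by-length : ∀ l → l ≡ k → Conclusion
      by-length zero    refl = inj₁ (inj₁ refl , λ v → ≤-reflexive (h≡3 v))
      by-length (suc l) refl = let g , wins = cycle-guesses 3≤n 1≤h forward won in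
        ⊥-elim (AllThree.losing g (λ a c c<3 → wins a c (λ i i<n → subst (c i <_) (sym (h≡3 _)) (c<3 i i<n))) 3∤n)

    by-≥4 : Dec (∃[ v ] 4 ≤ h v) → Conclusion
    by-≥4 (yes (a , 4≤ha)) = ⊥-elim (losing-4-≥3 4≤ha (λ i → 3≤h (walk forward a (suc i))) (win forward a))
    by-≥4 (no  ¬4≤)        = all-3 (λ v → ≤-antisym (s≤s⁻¹ (≰⇒> λ 4≤h → ¬4≤ (v , 4≤h))) (3≤h v)) (3 ∣? n)

  -- The bound `j < m` keeps the second end from being `a` itself.
  TwosJoined : Direction → Fin n → Set
  TwosJoined d a = ∃[ j ] j < m × h a ≡ 2 × h (walk d a (suc j)) ≡ 2 × (∀ {i} → i < suc j → 0 < i → h (walk d a i) ≤ 4)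

  joined? : ∀ d a → Dec (TwosJoined d a)
  joined? d a = anyUpTo? (λ j → (h a ≟ 2) ×-dec (h (walk d a (suc j)) ≟ 2) ×-dec
    allUpTo? (λ i → (0 <? i) →-dec (h (walk d a i) ≤? 4)) (suc j)) m

  joined⇒subgame : ∀ d a → TwosJoined d a → HasWinningProperSubgame (cycle n 3≤n) h
  joined⇒subgame d a (j , j<m , ha≡2 , hj≡2 , h≤4) =
    path-subgame 3≤n 1≤h d a j j<m ha≡2 hj≡2 (λ i 0<i i≤j → h≤4 i≤j 0<i)

  module NotJoined (¬joined : ∀ d a → ¬ TwosJoined d a) where

    after≥3 : ∀ d {a} → h a ≡ 2 → 3 ≤ h (after d a)
    after≥3 d {a} ha≡2 = ≢2⇒≥3 (after d a) λ h≡2 →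
      ¬joined d a (0 , s≤s z≤n , ha≡2 , h≡2 , λ { (s≤s z≤n) () })

    before≥3 : ∀ d {a} → h a ≡ 2 → 3 ≤ h (before d a)
    before≥3 forward  = after≥3 backward
    before≥3 backward = after≥3 forward

    -- If a vertex with two colors has a neighbour with fewer than five, it becomes the cut, and the
    -- direction makes that neighbour the last vertex. Otherwise all neighbours of vertices with two
    -- colors have at least five.
    with-≥5 : ∀ {v b} → h v ≡ 2 → 5 ≤ h b → ⊥
    with-≥5 {v} {b} hv≡2 5≤hb = by-last (any? (ends? forward)) (any? (ends? backward))
      where
      Ends : Direction → Fin n → Set
      Ends d a = h a ≡ 2 × h (before d a) < 5

      ends? : ∀ d a → Dec (Ends d a)
      ends? d a = (h a ≟ 2) ×-dec (h (before d a) <? 5)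

      last-34 : ∀ d a → Ends d a → ⊥
      last-34 d a (ha≡2 , h<5) = losing-last-34 (λ i → 2≤h (walk d a i)) (win d a) separated ha≡2 (trans (cong h (walk-n d a)) ha≡2)
          (after≥3 d ha≡2) (subst (λ u → 3 ≤ h u) (sym (walk-m d a)) (before≥3 d ha≡2)) (subst (λ u → h u < 5) (sym (walk-m d a)) h<5)
        where
        H : ℕ → ℕ
        H i = h (walk d a i)

        position>0 : ∀ p → p ≡ position d a b → 0 < p
        position>0 zero    p≡ = contradiction (subst (λ u → 5 ≤ h u) (trans (sym (walk-position d a b)) (cong (walk d a) (sym p≡))) 5≤hb)
          (<⇒≱ (subst (_< 5) (sym ha≡2) (s≤s (s≤s (s≤s z≤n)))))
        position>0 (suc _) _  = s≤s z≤n

        separated : ∀ {i j} → i < j → j ≤ 4 + k → H i ≡ 2 → H j ≡ 2 → ∃[ l ] i < l × l < j × 5 ≤ H l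
        separated {i} {j} i<j j≤n Hi≡2 Hj≡2 = search (anyUpTo? (λ l → (i <? l) ×-dec (5 ≤? H l)) j)
          where
          o = j ∸ suc i
          i+1+o≡j : i + suc o ≡ j
          i+1+o≡j = trans (+-suc i o) (m+[n∸m]≡n i<j)

          search : Dec (∃[ l ] l < j × i < l × 5 ≤ H l) → ∃[ l ] i < l × l < j × 5 ≤ H l
          search (yes (l , l<j , i<l , 5≤H)) = l , i<l , l<j , 5≤H
          search (no  ¬any) = ⊥-elim (by-distance (o <? m))
            where
            small : ∀ {l} → i < l → l < j → H l ≤ 4
            small i<l l<j = s≤s⁻¹ (≰⇒> λ 5≤H → ¬any (_ , l<j , i<l , 5≤H))

            by-distance : Dec (o < m) → ⊥
            by-distance (yes o<m) = ¬joined d (walk d a i)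
              (o , o<m , Hi≡2 , trans (cong h (trans (walk-+ d a i (suc o)) (cong (walk d a) i+1+o≡j))) Hj≡2 ,
               λ {l} l≤o 0<l → subst (λ u → h u ≤ 4) (sym (walk-+ d a i l))
                 (small (m<m+n i 0<l) (subst (i + l <_) i+1+o≡j (+-monoʳ-< i l≤o))))
            -- Here the walk has led from a vertex with two colors all around back to itself, and
            -- `b` lies in between.
            by-distance (no  o≮m) = ¬any (position d a b , subst (position d a b <_) n≡j (position<n d a b) ,
              subst (_< position d a b) (sym i≡0) (position>0 (position d a b) refl) , subst (λ u → 5 ≤ h u) (sym (walk-position d a b)) 5≤hb)
              where
              n≤1+o : n ≤ suc o
              n≤1+o = s≤s (≮⇒≥ o≮m)
              n≡j : n ≡ j
              n≡j = ≤-antisym (≤-trans n≤1+o (subst (suc o ≤_) i+1+o≡j (m≤n+m (suc o) i))) j≤n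
              i≡0 : i ≡ 0
              i≡0 = n≤0⇒n≡0 (+-cancelʳ-≤ (suc o) i 0 (subst (_≤ suc o) (sym i+1+o≡j) (≤-trans j≤n n≤1+o)))

      by-last : Dec (∃[ a ] Ends forward a) → Dec (∃[ a ] Ends backward a) → ⊥
      by-last (yes (a , ends)) _                  = last-34 forward a ends
      by-last (no  _)          (yes (a , ends))   = last-34 backward a ends
      by-last (no  ¬forward)   (no  ¬backward)    =
        losing-2-between-5s (λ i → 2≤h (walk forward v i)) (win forward v)
          (λ i _ Hi≡2 → ≮⇒≥ λ h<5 → ¬backward (walk forward v i , Hi≡2 , h<5)) hv≡2
          (subst (λ u → 5 ≤ h u) (sym (walk-m forward v)) (≮⇒≥ λ h<5 → ¬forward (v , hv≡2 , h<5)))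

    module AllSmall (h≤4 : ∀ v → h v ≤ 4) {v : Fin n} (hv≡2 : h v ≡ 2) where

      other≥3 : ∀ u → u ≢ v → 3 ≤ h u
      other≥3 u u≢v = ≢2⇒≥3 u λ hu≡2 → at (position forward v u) refl hu≡2
        where
        at : ∀ p → p ≡ position forward v u → h u ≢ 2
        at zero    p≡ _ = u≢v (trans (sym (walk-position forward v u)) (cong (walk forward v) (sym p≡)))
        at (suc j) p≡ hu≡2 = ¬joined forward v
          (j , s≤s⁻¹ (subst (_< n) (sym p≡) (position<n forward v u)) , hv≡2 ,
           trans (cong h (trans (cong (walk forward v) p≡) (walk-position forward v u))) hu≡2 , λ _ _ → h≤4 _)

      -- `losing-2-4` asks for three colors at every later index, but the walk keeps returning to
      -- `v`; the maximum with 3 changes only indices beyond the first round.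
      capped : Direction → ℕ → ℕ
      capped d zero    = h v
      capped d (suc i) = h (walk d v (suc i)) ⊔ 3

      capped-win : ∀ d → SequenceWin m (capped d)
      capped-win d = sequenceWin-≤ capped≤ (win d v)
        where
        capped≤ : ∀ i → i < n → capped d i ≤ h (walk d v i)
        capped≤ zero    _   = ≤-refl
        capped≤ (suc i) i<n = ⊔-lub ≤-refl (other≥3 (walk d v (suc i)) λ e →
          contradiction (e-injective 3≤n 1≤h d v {suc i} {0} (s≤s⁻¹ i<n) z≤n e) λ ())

      near far : Direction → ℕ
      near d = h (after d v)
      far  d = h (after d (after d v))

      walk-m-1 : ∀ d → walk d v (2 + k) ≡ before d (before d v)
      walk-m-1 d = trans (sym (before-after d (walk d v (2 + k)))) (cong (before d) (walk-m d v))

      losing-near : ∀ d → 4 ≤ near d → 4 ≤ h (before d v) ⊎ 4 ≤ h (before d (before d v)) → ⊥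
      losing-near d 4≤near other = losing-2-4 (2≤h v) (≤-trans 4≤near (m≤m⊔n _ 3)) (λ i → m≤n⊔m (h (walk d v (2 + i))) 3)
        (case other of λ where
          (inj₁ 4≤h) → inj₂ (≤-trans (subst (λ u → 4 ≤ h u) (sym (walk-m d v)) 4≤h) (m≤m⊔n _ 3))
          (inj₂ 4≤h) → inj₁ (≤-trans (subst (λ u → 4 ≤ h u) (sym (walk-m-1 d)) 4≤h) (m≤m⊔n _ 3)))
        (capped-win d)

      3⊎4 : ∀ u → 3 ≤ h u → h u ≡ 3 ⊎ 4 ≤ h u
      3⊎4 u 3≤hu = [ inj₂ , inj₁ ∘ sym ]′ (m≤n⇒m<n∨m≡n 3≤hu)

      near-3⊎4 : ∀ d → near d ≡ 3 ⊎ 4 ≤ near d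
      near-3⊎4 d = 3⊎4 (after d v) (after≥3 d hv≡2)

      far-3⊎4 : ∀ d → far d ≡ 3 ⊎ 4 ≤ far d
      far-3⊎4 d = 3⊎4 (after d (after d v)) (other≥3 (after d (after d v)) λ e →
        contradiction (e-injective 3≤n 1≤h d v {2} {0} (s≤s (s≤s z≤n)) z≤n e) λ ())

      -- Two neighbours with three colors give (3,2,3). If one neighbour has four, `losing-near`
      -- forces three colors on the first two vertices of the other side, which gives (2,3,3).
      one-two : near forward ≡ 3 ⊎ 4 ≤ near forward → near backward ≡ 3 ⊎ 4 ≤ near backward → Pattern n h 2≤h
      one-two (inj₁ e) (inj₁ e′) =
        (prev v , v , next v , inj₁ (sym (next-prev v) , refl) , inj₂ (e′ , hv≡2 , e)) , h≤4
      one-two (inj₁ e) (inj₂ 4≤) = case far-3⊎4 forward of λ where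
        (inj₁ e′)  → (v , next v , next (next v) , inj₁ (refl , refl) , inj₁ (hv≡2 , e , e′)) , h≤4
        (inj₂ 4≤′) → ⊥-elim (losing-near backward 4≤ (inj₂ 4≤′))
      one-two (inj₂ 4≤) (inj₁ e) = case far-3⊎4 backward of λ where
        (inj₁ e′)  → (v , prev v , prev (prev v) , inj₂ (sym (next-prev (prev v)) , sym (next-prev v)) , inj₁ (hv≡2 , e , e′)) , h≤4
        (inj₂ 4≤′) → ⊥-elim (losing-near forward 4≤ (inj₂ 4≤′))
      one-two (inj₂ 4≤) (inj₂ 4≤′) = ⊥-elim (losing-near forward 4≤ (inj₁ 4≤′))

      pattern-found : Pattern n h 2≤h
      pattern-found = one-two (near-3⊎4 forward) (near-3⊎4 backward)

  winning⇒conclusion : Conclusion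
  winning⇒conclusion = by-2 (any? λ v → h v ≟ 2)
    where
    not-joined : (∀ d a → ¬ TwosJoined d a) → ∀ {v} → h v ≡ 2 → Dec (∃[ b ] 5 ≤ h b) → Conclusion
    not-joined ¬joined hv≡2 (yes (b , 5≤hb)) = ⊥-elim (NotJoined.with-≥5 ¬joined hv≡2 5≤hb)
    not-joined ¬joined hv≡2 (no  ¬5≤)        = inj₂ (inj₂ (inj₂ (NotJoined.AllSmall.pattern-found ¬joined
      (λ b → s≤s⁻¹ (≰⇒> λ 5≤hb → ¬5≤ (b , 5≤hb))) hv≡2)))

    by-joined : ∀ {v} → h v ≡ 2 → Dec (∃[ a ] TwosJoined forward a) → Dec (∃[ a ] TwosJoined backward a) → Conclusion
    by-joined _ (yes (a , joined)) _ = inj₂ (inj₂ (inj₁ (joined⇒subgame forward a joined)))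
    by-joined _ (no _) (yes (a , joined)) = inj₂ (inj₂ (inj₁ (joined⇒subgame backward a joined)))
    by-joined hv≡2 (no ¬forward) (no ¬backward) = not-joined
      (λ { forward a joined → ¬forward (a , joined) ; backward a joined → ¬backward (a , joined) }) hv≡2 (any? λ b → 5 ≤? h b)

    by-2 : Dec (∃[ v ] h v ≡ 2) → Conclusion
    by-2 (yes (v , hv≡2)) = by-joined hv≡2 (any? (joined? forward)) (any? (joined? backward))
    by-2 (no  ¬2)         = all-≥3 λ v → ≢2⇒≥3 v λ h≡2 → ¬2 (v , h≡2)

theorem1p1 : (n : ℕ) (3≤n : 3 ≤ n) (h : Fin n → ℕ) (2≤h : ∀ v → 2 ≤ h v) →
    Winning (cycle n 3≤n) h
    ⇔
    ( ((n ≡ 4 ⊎ 3 ∣ n) × (∀ v → h v ≤ 3))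
    ⊎ (n ≡ 3 × 1ℚ ≤ℚ reciprocalSum h (λ v → ≥2⇒nonZero (2≤h v)))
    ⊎ HasWinningProperSubgame (cycle n 3≤n) h
    ⊎ ((∃[ a ] ∃[ b ] ∃[ c ] (Consecutive a b c ×
    ((h a ≡ 2 × h b ≡ 3 × h c ≡ 3) ⊎ (h a ≡ 3 × h b ≡ 2 × h c ≡ 3))))
    × (∀ v → h v ≤ 4)) )
theorem1p1 (suc (suc (suc k))) 3≤n h 2≤h = mk⇔ (to k 3≤n 2≤h) from
  where
  to : ∀ k (3≤n : 3 ≤ 3 + k) {h : Fin (3 + k) → ℕ} (2≤h : ∀ v → 2 ≤ h v) → Winning (cycle (3 + k) 3≤n) h →
       ThreeColors (3 + k) h 2≤h ⊎ TriangleSum (3 + k) h 2≤h ⊎ HasWinningProperSubgame (cycle (3 + k) 3≤n) h ⊎ Pattern (3 + k) h 2≤h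
  -- By the counting bound a winning triangle always satisfies the sum condition, so this
  -- alternative covers every win.
  to zero    3≤n 2≤h won = inj₂ (inj₁ (refl , winning⇒triangleSum 3≤n 2≤h won))
  to (suc k) 3≤n 2≤h won = winning⇒conclusion 3≤n 2≤h won

  from : ThreeColors (3 + k) h 2≤h ⊎ TriangleSum (3 + k) h 2≤h ⊎ HasWinningProperSubgame (cycle (3 + k) 3≤n) h ⊎ Pattern (3 + k) h 2≤h →
         Winning (cycle (3 + k) 3≤n) h
  from (inj₁ colors)                         = threeColors⇒winning 3≤n 2≤h colors
  from (inj₂ (inj₁ (refl , 1≤sum)))          = triangleSum⇒winning 3≤n 2≤h 1≤sum
  from (inj₂ (inj₂ (inj₁ (H , (H⊆ , _) , won)))) = winning-⊆ᴳ (λ v → ≤-trans (s≤s z≤n) (2≤h v)) H⊆ won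
  from (inj₂ (inj₂ (inj₂ pattern′)))         = pattern⇒winning 3≤n 2≤h pattern′
theorem1p1 (suc (suc zero)) (s≤s (s≤s ()))
theorem1p1 (suc zero) (s≤s ())
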